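{- Let $a,b$ be positive integers and $N=3^a\cdot 7^b$. Then there is no generalized bent function of type $[1,2N]$, i.e. no function $f:\mathbb{Z}/2N\mathbb{Z}\to\mathbb{Z}/2N\mathbb{Z}$ such that $\left|\sum_{x\in\mathbb{Z}/2N\mathbb{Z}}\zeta_{2N}^{f(x)-\lambda x}\right|^2=2N$ for all $\lambda\in\mathbb{Z}/2N\mathbb{Z}$, where $\zeta_{2N}=e^{2\pi i/(2N)}$.
   Context: A generalized bent function of type $[n,q]$ is a function $f:(\mathbb{Z}/q\mathbb{Z})^n\to\mathbb{Z}/q\mathbb{Z}$ with $|\sum_{x}e^{2\pi i (f(x)-\lambda\cdot x)/q}|^2=q^n$ for all $\lambda\in(\mathbb{Z}/q\mathbb{Z})^n$. -}

module Defs where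

open import Data.Nat as ℕ using (ℕ; zero; suc; _∸_; _≤?_)
open import Data.Nat.Divisibility using (_∣?_)
open import Data.Integer as ℤ using (ℤ; +_; -_)
open import Data.Fin using (Fin; toℕ)
open import Data.List using (List; []; _∷_; map; foldr; reverse; replicate; _++_; allFin; filter; upTo; length)
open import Data.List.Relation.Unary.All using (All)
open import Data.Product using (_×_; _,_; proj₁; proj₂)
open import Relation.Binary.PropositionalEquality using (_≡_)
open import Relation.Nullary using (does)
open import Data.Bool using (true; false)

-- Polynomials over ℤ, as coefficient lists, LOWEST degree first.

Poly : Set
Poly = List ℤ

infixl 6 _+P_ _-P_
infixl 7 _*P_

_+P_ : Poly → Poly → Poly
[]       +P q        = q
(a ∷ p)  +P []       = a ∷ p
(a ∷ p)  +P (b ∷ q)  = (a ℤ.+ b) ∷ (p +P q)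

negP : Poly → Poly
negP = map -_

_-P_ : Poly → Poly → Poly
p -P q = p +P negP q

_*P_ : Poly → Poly → Poly
[]      *P q = []
(a ∷ p) *P q = map (a ℤ.*_) q +P (+ 0 ∷ (p *P q))

constP : ℤ → Poly
constP c = c ∷ []

X^ : ℕ → Poly
X^ k = replicate k (+ 0) ++ (+ 1 ∷ [])

sumP : List Poly → Poly
sumP = foldr _+P_ []

prodP : List Poly → Poly
prodP = foldr _*P_ (constP (+ 1))

-- Long division by a MONIC polynomial.
-- Work with HIGHEST-degree-first lists.  The divisor is given as the
-- list ds of its non-leading coefficients (highest first), i.e. the
-- divisor is X^(length ds) + ...

subPrefix : ℤ → List ℤ → List ℤ → List ℤ
subPrefix c []       rs       = rs
subPrefix c (d ∷ ds) []       = (- (c ℤ.* d)) ∷ subPrefix c ds []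
subPrefix c (d ∷ ds) (r ∷ rs) = (r ℤ.- c ℤ.* d) ∷ subPrefix c ds rs

-- (quotient , remainder), both highest-degree first; fuel = length of dividend
divMonicH : (fuel : ℕ) → List ℤ → List ℤ → List ℤ × List ℤ
divMonicH zero     ds p        = [] , p
divMonicH (suc k)  ds []       = [] , []
divMonicH (suc k)  ds (c ∷ ps) with does (suc (length ds) ≤? suc (length ps))
... | false = [] , (c ∷ ps)
... | true  = let qr = divMonicH k ds (subPrefix c ds ps) in (c ∷ proj₁ qr) , proj₂ qr

dropZeros : List ℤ → List ℤ
dropZeros []             = []
dropZeros (+ zero ∷ xs)  = dropZeros xs
dropZeros (x ∷ xs)       = x ∷ xs

tailH : Poly → List ℤ
tailH d with dropZeros (reverse d)
... | []     = []
... | _ ∷ ds = ds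

quotP : Poly → Poly → Poly
quotP p d = reverse (proj₁ (divMonicH (length p) (tailH d) (reverse p)))

remP : Poly → Poly → Poly
remP p d = reverse (proj₂ (divMonicH (length p) (tailH d) (reverse p)))

-- Cyclotomic polynomials:  X^m - 1 = ∏_{d ∣ m} Φ_d,  so
--   Φ_m = (X^m - 1) / ∏_{d ∣ m, 1 ≤ d < m} Φ_d   (exact division by a monic poly).
-- Recursion uses fuel; Φ m = cyc m m (fuel suffices since proper divisors are < m).

properDivisors : ℕ → List ℕ
properDivisors m = filter (λ d → d ∣? m) (map suc (upTo (m ∸ 1)))

cyc : (fuel : ℕ) → ℕ → Poly
cyc zero    m = constP (+ 1)
cyc (suc f) m = quotP (X^ m -P constP (+ 1)) (prodP (map (cyc f) (properDivisors m)))

Φ : ℕ → Poly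
Φ m = cyc m m

-- Arithmetic in ℤ[ζ_m] = ℤ[X]/(Φ_m), ζ_m = e^{2πi/m} ↦ X.
-- A polynomial P represents 0 in ℤ[ζ_m] iff Φ_m divides P, i.e. the
-- remainder of P modulo Φ_m is the zero polynomial.

VanishesAtζ : ℕ → Poly → Set
VanishesAtζ m P = All (λ c → c ≡ + 0) (remP P (Φ m))

-- Generalized bent functions of type [1,q]:  f : ℤ/qℤ → ℤ/qℤ with
--   |Σ_x ζ_q^{f(x) - λ x}|^2 = q  for all λ.
-- ℤ/qℤ is modelled by Fin q (residues 0..q-1).  Exponents of ζ_q are
-- natural numbers (only their class mod q matters, since Φ_q ∣ X^q - 1):
--   f(x) - λx  ≡  toℕ(f x) + (q - 1)·toℕ λ·toℕ x   (mod q),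
-- and complex conjugation ζ^e ↦ ζ^{-e} = ζ^{(q-1)e}.
-- |S|^2 = S · conj(S), and the condition is S · conj(S) - q = 0 in ℤ[ζ_q].

expo : (q : ℕ) → (Fin q → Fin q) → Fin q → Fin q → ℕ
expo q f λ' x = toℕ (f x) ℕ.+ (q ∸ 1) ℕ.* (toℕ λ' ℕ.* toℕ x)

walshSum : (q : ℕ) → (Fin q → Fin q) → Fin q → Poly
walshSum q f λ' = sumP (map (λ x → X^ (expo q f λ' x)) (allFin q))

walshSumConj : (q : ℕ) → (Fin q → Fin q) → Fin q → Poly
walshSumConj q f λ' = sumP (map (λ x → X^ ((q ∸ 1) ℕ.* expo q f λ' x)) (allFin q))

IsGBent1 : (q : ℕ) → (Fin q → Fin q) → Set
IsGBent1 q f = (λ' : Fin q) →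
  VanishesAtζ q (walshSum q f λ' *P walshSumConj q f λ' -P constP (+ q))

{-# OPTIONS --safe #-}

-- Put q = 2N with N = 3ᵃ7ᵇ odd and ζ = ζ_q, so that ζᴺ = −1.  Let A(λ) and B(λ) be the parts of the
-- Walsh sum S(λ) over the even and the odd x; then S(λ) = A + B and S(λ + N) = A − B.  Both have
-- absolute value √q, hence |A|² + |B|² = 2N and BĀ is purely imaginary, so d = BĀ and u = |A|² satisfy
-- d² = u² − 2Nu.  As 2 is unramified in ℤ[ζ], this forces d ≡ u and then u ≡ 0 modulo 2.  But
-- Σ_{λ < N} |A(λ)|² = N² by Parseval, and N² is odd.

module Submission where

open import Defs
open import Data.Nat using (ℕ; _*_; _^_; _≤_)
open import Data.Nat as ℕ using (zero; suc; NonZero; _∸_; _≤?_; z≤n; s≤s)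
import Data.Nat.Properties as ℕₚ
import Data.Nat.Tactic.RingSolver as ℕ-Solver
open import Data.Nat.DivMod using (_%_; _/_; [m+kn]%n≡m%n; m≡m%n+[m/n]*n; m%n<n; m<n⇒m%n≡m; +-distrib-/-∣ʳ; m*n/n≡m; m*n%n≡0)
open import Data.Nat.Divisibility as ∣ using (_∣_; divides; _∣?_; ∣⇒≤)
open import Data.Nat.GCD using (gcd; gcd[m,n]∣m; gcd[m,n]∣n; gcd-GCD; module Bézout)
open import Data.Nat.Primality using (Prime; prime?; euclidsLemma; prime⇒nonZero; prime⇒nonTrivial)
open import Data.Integer as ℤ using (ℤ; +_; -_; -[1+_])
import Data.Integer.Properties as ℤₚ
import Data.Integer.Tactic.RingSolver as ℤ-Solver
open import Data.Fin using (Fin)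
open import Data.Fin as Fin using (toℕ; fromℕ<)
import Data.Fin.Properties as Finₚ
open import Data.Bool using (T; true; false)
open import Data.Unit using (tt)
open import Data.Empty using (⊥-elim)
open import Data.Maybe using (Maybe; just; nothing)
open import Data.Product using (Σ-syntax)
open import Data.Product using (_×_; _,_; proj₁; proj₂)
open import Data.Sum using (_⊎_; inj₁; inj₂; [_,_]′)
open import Data.List using (List; []; _∷_; _++_; _ʳ++_; map; replicate; length; reverse; upTo; applyUpTo; allFin; tabulate; cartesianProduct)
import Data.List.Properties as Listₚ
open import Data.List.Reverse using (Reverse; []; _∶_∶ʳ_; reverseView)
open import Data.List.Membership.Propositional using (_∈_)
open import Data.List.Membership.Propositional.Properties using (∈-map⁺; ∈-map⁻; ∈-filter⁺; ∈-filter⁻; ∈-upTo⁺; ∈-upTo⁻; ∈-allFin; ∈-cartesianProduct⁺; ∈-cartesianProduct⁻)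
open import Data.List.Membership.Propositional.Properties.WithK using (unique∧set⇒bag)
open import Data.List.Relation.Binary.BagAndSetEquality using (∼bag⇒↭)
open import Data.List.Relation.Binary.Permutation.Propositional as ↭ using (_↭_)
open import Data.List.Relation.Binary.Permutation.Propositional.Properties using (map⁺)
open import Data.List.Relation.Unary.All as All using (All; []; _∷_)
open import Data.List.Relation.Unary.AllPairs using (_∷_)
open import Data.List.Relation.Unary.Any using (here; there)
open import Data.List.Relation.Unary.Unique.Propositional using (Unique)
import Data.List.Relation.Unary.Unique.Propositional.Properties as Unique
open import Function using (mk⇔)
open import Relation.Nullary using (¬_; Dec; yes; no; does)
open import Relation.Nullary.Decidable using (True; toWitness; from-yes; from-no)
open import Relation.Binary.PropositionalEquality using (_≡_; _≢_; _≗_; refl; sym; trans; cong; cong₂; subst; module ≡-Reasoning)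
import Relation.Binary.Reasoning.Setoid as SetoidReasoning
open import Algebra.Bundles using (CommutativeRing; RawRing)
open import Algebra.Properties.AbelianGroup ℤₚ.+-0-abelianGroup using (∙-cancelʳ)
open import Algebra.Solver.Ring.AlmostCommutativeRing using (fromCommutativeRing; _-Raw-AlmostCommutative⟶_)
import Algebra.Solver.Ring as RingSolver

-- Polynomials tested against sequences

-- The ring ℤ[ζ] is never built. `p ≈ q [mod m ]` compares p and q under all integer sequences
-- annihilated by m, that is, under all ℤ-linear functionals on ℤ[x]/(m). For monic m that quotient
-- is free over ℤ, so this is congruence modulo m. Such a functional also ends the proof: one with
-- `F 0 ≡ + 1` sends the sum of the |A(λ)|² to an even integer by the ring argument and to N² by
-- Parseval. Of "unramified" only this is used: if z² is even, so is z. It comes from the Frobenius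
-- map and a power of 2 of the form 1 + N·odd. Conjugation enters only through exponents multiplied
-- by q - 1; the products SS̄ and BĀ are products of two polynomials. The main obstacle is `Φ`,
-- which is defined by iterated division while a and b are arbitrary. It is identified with
-- Φ₄₂(x^K), where K = N/21. After that, the remaining facts about ζ (ζᴺ = -1, vanishing sums of
-- roots of unity, a functional with value 1 at 1) reduce to finite computations with Φ₄₂, of degree
-- 12.

module _ where
  open ≡-Reasoning

  infix 9 ⟨_∣_⟩

  -- The linear functional xⁿ ↦ `F n`. It does not see trailing zeros, so lists that differ only by
  -- them become equal under all tests.
  ⟨_∣_⟩ : Poly → (ℕ → ℤ) → ℤ
  ⟨ []    ∣ F ⟩ = + 0
  ⟨ a ∷ p ∣ F ⟩ = a ℤ.* F 0 ℤ.+ ⟨ p ∣ (λ n → F (suc n)) ⟩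

  shift : ℕ → (ℕ → ℤ) → ℕ → ℤ
  shift n F k = F (n ℕ.+ k)

  pair-cong-< : ∀ p {F G} → (∀ n → n ℕ.< length p → F n ≡ G n) → ⟨ p ∣ F ⟩ ≡ ⟨ p ∣ G ⟩
  pair-cong-< []      F≗G = refl
  pair-cong-< (a ∷ p) F≗G =
    cong₂ (λ x y → a ℤ.* x ℤ.+ y) (F≗G 0 (ℕ.s≤s ℕ.z≤n)) (pair-cong-< p (λ n n<p → F≗G (suc n) (ℕ.s≤s n<p)))

  pair-cong : ∀ p {F G} → F ≗ G → ⟨ p ∣ F ⟩ ≡ ⟨ p ∣ G ⟩
  pair-cong p F≗G = pair-cong-< p (λ n _ → F≗G n)

  pair-0ᶠ : ∀ p → ⟨ p ∣ (λ _ → + 0) ⟩ ≡ + 0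
  pair-0ᶠ []      = refl
  pair-0ᶠ (a ∷ p) = trans (cong₂ ℤ._+_ (ℤₚ.*-zeroʳ a) (pair-0ᶠ p)) refl

  pair-+ᶠ : ∀ p F G → ⟨ p ∣ (λ n → F n ℤ.+ G n) ⟩ ≡ ⟨ p ∣ F ⟩ ℤ.+ ⟨ p ∣ G ⟩
  pair-+ᶠ []      F G = refl
  pair-+ᶠ (a ∷ p) F G =
    trans (cong (ℤ._+_ (a ℤ.* (F 0 ℤ.+ G 0))) (pair-+ᶠ p (shift 1 F) (shift 1 G)))
      (lemma a (F 0) (G 0) ⟨ p ∣ shift 1 F ⟩ ⟨ p ∣ shift 1 G ⟩)
    where
    lemma : ∀ a x y u v → a ℤ.* (x ℤ.+ y) ℤ.+ (u ℤ.+ v) ≡ (a ℤ.* x ℤ.+ u) ℤ.+ (a ℤ.* y ℤ.+ v)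
    lemma = ℤ-Solver.solve-∀

  pair-*ᶠ : ∀ p c F → ⟨ p ∣ (λ n → c ℤ.* F n) ⟩ ≡ c ℤ.* ⟨ p ∣ F ⟩
  pair-*ᶠ []      c F = sym (ℤₚ.*-zeroʳ c)
  pair-*ᶠ (a ∷ p) c F =
    trans (cong (ℤ._+_ (a ℤ.* (c ℤ.* F 0))) (pair-*ᶠ p c (shift 1 F))) (lemma a c (F 0) ⟨ p ∣ shift 1 F ⟩)
    where
    lemma : ∀ a c x u → a ℤ.* (c ℤ.* x) ℤ.+ c ℤ.* u ≡ c ℤ.* (a ℤ.* x ℤ.+ u)
    lemma = ℤ-Solver.solve-∀

  pair-+ : ∀ p q F → ⟨ p +P q ∣ F ⟩ ≡ ⟨ p ∣ F ⟩ ℤ.+ ⟨ q ∣ F ⟩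
  pair-+ []      q       F = sym (ℤₚ.+-identityˡ _)
  pair-+ (a ∷ p) []      F = sym (ℤₚ.+-identityʳ _)
  pair-+ (a ∷ p) (b ∷ q) F =
    trans (cong (ℤ._+_ ((a ℤ.+ b) ℤ.* F 0)) (pair-+ p q (shift 1 F)))
      (lemma a b (F 0) ⟨ p ∣ shift 1 F ⟩ ⟨ q ∣ shift 1 F ⟩)
    where
    lemma : ∀ a b x u v → (a ℤ.+ b) ℤ.* x ℤ.+ (u ℤ.+ v) ≡ (a ℤ.* x ℤ.+ u) ℤ.+ (b ℤ.* x ℤ.+ v)
    lemma = ℤ-Solver.solve-∀

  pair-neg : ∀ p F → ⟨ negP p ∣ F ⟩ ≡ - ⟨ p ∣ F ⟩
  pair-neg []      F = refl
  pair-neg (a ∷ p) F =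
    trans (cong (ℤ._+_ ((- a) ℤ.* F 0)) (pair-neg p (shift 1 F))) (lemma a (F 0) ⟨ p ∣ shift 1 F ⟩)
    where
    lemma : ∀ a x u → (- a) ℤ.* x ℤ.+ (- u) ≡ - (a ℤ.* x ℤ.+ u)
    lemma = ℤ-Solver.solve-∀

  pair-scale : ∀ c p F → ⟨ map (c ℤ.*_) p ∣ F ⟩ ≡ c ℤ.* ⟨ p ∣ F ⟩
  pair-scale c []      F = sym (ℤₚ.*-zeroʳ c)
  pair-scale c (a ∷ p) F =
    trans (cong (ℤ._+_ ((c ℤ.* a) ℤ.* F 0)) (pair-scale c p (shift 1 F))) (lemma a c (F 0) ⟨ p ∣ shift 1 F ⟩)
    where
    lemma : ∀ a c x u → (c ℤ.* a) ℤ.* x ℤ.+ c ℤ.* u ≡ c ℤ.* (a ℤ.* x ℤ.+ u)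
    lemma = ℤ-Solver.solve-∀

  pair-0∷ : ∀ p F → ⟨ + 0 ∷ p ∣ F ⟩ ≡ ⟨ p ∣ shift 1 F ⟩
  pair-0∷ p F = ℤₚ.+-identityˡ _

  pair-const : ∀ c F → ⟨ constP c ∣ F ⟩ ≡ c ℤ.* F 0
  pair-const c F = ℤₚ.+-identityʳ _

  -- Multiplication by xⁿ is dual to the shift by n. The ring laws for products all come from this
  -- formula.
  pair-* : ∀ p q F → ⟨ p *P q ∣ F ⟩ ≡ ⟨ p ∣ (λ n → ⟨ q ∣ shift n F ⟩) ⟩
  pair-* []      q F = refl
  pair-* (a ∷ p) q F = trans (pair-+ (map (a ℤ.*_) q) _ F)
    (cong₂ ℤ._+_ (pair-scale a q F) (trans (pair-0∷ (p *P q) F) (pair-* p q _)))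

  pair-swap : ∀ p q (H : ℕ → ℕ → ℤ) →
    ⟨ p ∣ (λ n → ⟨ q ∣ H n ⟩) ⟩ ≡ ⟨ q ∣ (λ m → ⟨ p ∣ (λ n → H n m) ⟩) ⟩
  pair-swap []      q H = sym (pair-0ᶠ q)
  pair-swap (a ∷ p) q H = begin
    a ℤ.* ⟨ q ∣ H 0 ⟩ ℤ.+ ⟨ p ∣ (λ n → ⟨ q ∣ H (suc n) ⟩) ⟩
      ≡⟨ cong₂ ℤ._+_ (sym (pair-*ᶠ q a (H 0))) (pair-swap p q (λ n → H (suc n))) ⟩
    ⟨ q ∣ (λ m → a ℤ.* H 0 m) ⟩ ℤ.+ ⟨ q ∣ (λ m → ⟨ p ∣ (λ n → H (suc n) m) ⟩) ⟩
      ≡⟨ sym (pair-+ᶠ q _ _) ⟩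
    ⟨ q ∣ (λ m → a ℤ.* H 0 m ℤ.+ ⟨ p ∣ (λ n → H (suc n) m) ⟩) ⟩ ∎

  pair-*-comm : ∀ p q F → ⟨ p *P q ∣ F ⟩ ≡ ⟨ q *P p ∣ F ⟩
  pair-*-comm p q F = begin
    ⟨ p *P q ∣ F ⟩                          ≡⟨ pair-* p q F ⟩
    ⟨ p ∣ (λ n → ⟨ q ∣ shift n F ⟩) ⟩        ≡⟨ pair-swap p q (λ n m → F (n ℕ.+ m)) ⟩
    ⟨ q ∣ (λ m → ⟨ p ∣ (λ n → F (n ℕ.+ m)) ⟩) ⟩
      ≡⟨ pair-cong q (λ m → pair-cong p (λ n → cong F (ℕₚ.+-comm n m))) ⟩
    ⟨ q ∣ (λ m → ⟨ p ∣ shift m F ⟩) ⟩        ≡⟨ sym (pair-* q p F) ⟩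
    ⟨ q *P p ∣ F ⟩                          ∎

  pair-*-assoc : ∀ p q r F → ⟨ (p *P q) *P r ∣ F ⟩ ≡ ⟨ p *P (q *P r) ∣ F ⟩
  pair-*-assoc p q r F = begin
    ⟨ (p *P q) *P r ∣ F ⟩                                   ≡⟨ pair-* (p *P q) r F ⟩
    ⟨ p *P q ∣ (λ n → ⟨ r ∣ shift n F ⟩) ⟩                   ≡⟨ pair-* p q _ ⟩
    ⟨ p ∣ (λ n → ⟨ q ∣ (λ m → ⟨ r ∣ shift (n ℕ.+ m) F ⟩) ⟩) ⟩
      ≡⟨ pair-cong p (λ n → pair-cong q (λ m → pair-cong r (λ k → cong F (ℕₚ.+-assoc n m k)))) ⟩
    ⟨ p ∣ (λ n → ⟨ q ∣ (λ m → ⟨ r ∣ shift m (shift n F) ⟩) ⟩) ⟩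
      ≡⟨ pair-cong p (λ n → sym (pair-* q r (shift n F))) ⟩
    ⟨ p ∣ (λ n → ⟨ q *P r ∣ shift n F ⟩) ⟩                   ≡⟨ sym (pair-* p (q *P r) F) ⟩
    ⟨ p *P (q *P r) ∣ F ⟩                                   ∎

  pair-++ : ∀ p q F → ⟨ p ++ q ∣ F ⟩ ≡ ⟨ p ∣ F ⟩ ℤ.+ ⟨ q ∣ shift (length p) F ⟩
  pair-++ []      q F = sym (ℤₚ.+-identityˡ _)
  pair-++ (a ∷ p) q F = trans (cong (ℤ._+_ (a ℤ.* F 0)) (pair-++ p q (shift 1 F)))
    (sym (ℤₚ.+-assoc (a ℤ.* F 0) ⟨ p ∣ shift 1 F ⟩ _))

  pair-∷ʳ : ∀ p a F → ⟨ p ++ a ∷ [] ∣ F ⟩ ≡ ⟨ p ∣ F ⟩ ℤ.+ a ℤ.* F (length p)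
  pair-∷ʳ p a F = trans (pair-++ p (a ∷ []) F) (cong (ℤ._+_ ⟨ p ∣ F ⟩)
    (trans (pair-const a (shift (length p) F)) (cong (λ n → a ℤ.* F n) (ℕₚ.+-identityʳ (length p)))))

  pair-0s++ : ∀ k p F → ⟨ replicate k (+ 0) ++ p ∣ F ⟩ ≡ ⟨ p ∣ shift k F ⟩
  pair-0s++ zero    p F = refl
  pair-0s++ (suc k) p F = trans (pair-0∷ (replicate k (+ 0) ++ p) F) (pair-0s++ k p _)

  pair-X^ : ∀ k F → ⟨ X^ k ∣ F ⟩ ≡ F k
  pair-X^ k F = trans (pair-0s++ k _ F) (trans (pair-const (+ 1) (shift k F))
    (trans (ℤₚ.*-identityˡ _) (cong F (ℕₚ.+-identityʳ k))))

  pair-All0 : ∀ {p} → All (λ c → c ≡ + 0) p → ∀ F → ⟨ p ∣ F ⟩ ≡ + 0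
  pair-All0 []             F = refl
  pair-All0 (refl ∷ zeros) F = trans (ℤₚ.+-identityˡ _) (pair-All0 zeros _)

  infix 4 _≈_[mod_]

  -- Congruence modulo the ideal (m), tested against the linear recurrences with characteristic
  -- polynomial m.  Every sequence is a recurrence for m = [], so [mod []] is equality in ℤ[x].
  Recurrence : Poly → (ℕ → ℤ) → Set
  Recurrence m F = ∀ n → ⟨ m ∣ shift n F ⟩ ≡ + 0

  record _≈_[mod_] (p q m : Poly) : Set where
    constructor tested
    field test : ∀ F → Recurrence m F → ⟨ p ∣ F ⟩ ≡ ⟨ q ∣ F ⟩
  open _≈_[mod_] public

  shift-recurrence : ∀ m {F} n → Recurrence m F → Recurrence m (shift n F)
  shift-recurrence m {F} n rec k =
    trans (pair-cong m {G = shift (n ℕ.+ k) F} (λ j → cong F (sym (ℕₚ.+-assoc n k j)))) (rec (n ℕ.+ k))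

  quotientRing : Poly → CommutativeRing _ _
  quotientRing m = record
    { Carrier = Poly ; _≈_ = _≈_[mod m ] ; _+_ = _+P_ ; _*_ = _*P_ ; -_ = negP ; 0# = [] ; 1# = constP (+ 1)
    ; isCommutativeRing = record
      { isRing = record
        { +-isAbelianGroup = record
          { isGroup = record
            { isMonoid = record
              { isSemigroup = record
                { isMagma = record
                  { isEquivalence = record
                    { refl  = tested λ F _ → refl
                    ; sym   = λ e → tested λ F r → sym (test e F r)
                    ; trans = λ e e′ → tested λ F r → trans (test e F r) (test e′ F r) }
                  ; ∙-cong = λ {p} {p′} {q} {q′} e e′ → tested λ F r →
                      trans (pair-+ p q F) (trans (cong₂ ℤ._+_ (test e F r) (test e′ F r))
                          (sym (pair-+ p′ q′ F))) }
                ; assoc = λ p q s → tested λ F _ → begin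
                    ⟨ p +P q +P s ∣ F ⟩ ≡⟨ trans (pair-+ (p +P q) s F) (cong (ℤ._+ ⟨ s ∣ F ⟩) (pair-+ p q F)) ⟩
                    ⟨ p ∣ F ⟩ ℤ.+ ⟨ q ∣ F ⟩ ℤ.+ ⟨ s ∣ F ⟩ ≡⟨ ℤₚ.+-assoc ⟨ p ∣ F ⟩ _ _ ⟩
                    ⟨ p ∣ F ⟩ ℤ.+ (⟨ q ∣ F ⟩ ℤ.+ ⟨ s ∣ F ⟩)
                      ≡⟨ sym (trans (pair-+ p (q +P s) F) (cong (ℤ._+_ ⟨ p ∣ F ⟩) (pair-+ q s F))) ⟩
                    ⟨ p +P (q +P s) ∣ F ⟩ ∎ }
              ; identity = (λ p → tested λ F _ → refl)
                         , (λ p → tested λ F _ → trans (pair-+ p [] F) (ℤₚ.+-identityʳ _)) }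
            ; inverse = (λ p → tested λ F _ → trans (pair-+ (negP p) p F)
                          (trans (cong (ℤ._+ ⟨ p ∣ F ⟩) (pair-neg p F)) (ℤₚ.+-inverseˡ ⟨ p ∣ F ⟩)))
                      , (λ p → tested λ F _ → trans (pair-+ p (negP p) F)
                          (trans (cong (ℤ._+_ ⟨ p ∣ F ⟩) (pair-neg p F)) (ℤₚ.+-inverseʳ ⟨ p ∣ F ⟩)))
            ; ⁻¹-cong = λ {p} {q} e → tested λ F r →
                trans (pair-neg p F) (trans (cong -_ (test e F r)) (sym (pair-neg q F))) }
          ; comm = λ p q → tested λ F _ →
              trans (pair-+ p q F) (trans (ℤₚ.+-comm ⟨ p ∣ F ⟩ _) (sym (pair-+ q p F))) }
        ; *-cong = λ {p} {p′} {q} {q′} e e′ → tested λ F r → begin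
            ⟨ p *P q ∣ F ⟩ ≡⟨ *-congʳ p q q′ e′ F r ⟩
            ⟨ p *P q′ ∣ F ⟩ ≡⟨ pair-*-comm p q′ F ⟩
            ⟨ q′ *P p ∣ F ⟩ ≡⟨ *-congʳ q′ p p′ e F r ⟩
            ⟨ q′ *P p′ ∣ F ⟩ ≡⟨ pair-*-comm q′ p′ F ⟩
            ⟨ p′ *P q′ ∣ F ⟩ ∎
        ; *-assoc = λ p q s → tested λ F _ → pair-*-assoc p q s F
        ; *-identity = (λ p → tested λ F _ → *-identityˡ p F)
                     , (λ p → tested λ F _ → trans (pair-*-comm p _ F) (*-identityˡ p F))
        ; distrib = (λ p q s → tested λ F _ → begin
                      ⟨ p *P (q +P s) ∣ F ⟩ ≡⟨ pair-*-comm p (q +P s) F ⟩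
                      ⟨ (q +P s) *P p ∣ F ⟩ ≡⟨ *-distribʳ p q s F ⟩
                      ⟨ q *P p +P s *P p ∣ F ⟩ ≡⟨ pair-+ (q *P p) _ F ⟩
                      ⟨ q *P p ∣ F ⟩ ℤ.+ ⟨ s *P p ∣ F ⟩
                        ≡⟨ cong₂ ℤ._+_ (pair-*-comm q p F) (pair-*-comm s p F) ⟩
                      ⟨ p *P q ∣ F ⟩ ℤ.+ ⟨ p *P s ∣ F ⟩ ≡⟨ sym (pair-+ (p *P q) _ F) ⟩
                      ⟨ p *P q +P p *P s ∣ F ⟩ ∎)
                  , (λ p q s → tested λ F _ → *-distribʳ p q s F) }
      ; *-comm = λ p q → tested λ F _ → pair-*-comm p q F } }
    where
    *-congʳ : ∀ p q q′ → q ≈ q′ [mod m ] → ∀ F → Recurrence m F → ⟨ p *P q ∣ F ⟩ ≡ ⟨ p *P q′ ∣ F ⟩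
    *-congʳ p q q′ e F r = trans (pair-* p q F)
      (trans (pair-cong p (λ n → test e (shift n F) (shift-recurrence m {F} n r))) (sym (pair-* p q′ F)))

    *-identityˡ : ∀ p F → ⟨ constP (+ 1) *P p ∣ F ⟩ ≡ ⟨ p ∣ F ⟩
    *-identityˡ p F = trans (pair-* (constP (+ 1)) p F)
        (trans (pair-const (+ 1) (λ n → ⟨ p ∣ shift n F ⟩)) (ℤₚ.*-identityˡ _))

    *-distribʳ : ∀ p q s F → ⟨ (q +P s) *P p ∣ F ⟩ ≡ ⟨ q *P p +P s *P p ∣ F ⟩
    *-distribʳ p q s F = begin
      ⟨ (q +P s) *P p ∣ F ⟩ ≡⟨ trans (pair-* (q +P s) p F) (pair-+ q s _) ⟩
      _ ≡⟨ sym (cong₂ ℤ._+_ (pair-* q p F) (pair-* s p F)) ⟩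
      ⟨ q *P p ∣ F ⟩ ℤ.+ ⟨ s *P p ∣ F ⟩ ≡⟨ sym (pair-+ (q *P p) _ F) ⟩
      ⟨ q *P p +P s *P p ∣ F ⟩ ∎

  ≈-exact : ∀ {m p q} → p ≈ q [mod [] ] → p ≈ q [mod m ]
  ≈-exact e = tested λ F _ → test e F (λ _ → refl)

  modulus≈0 : ∀ m → m ≈ [] [mod m ]
  modulus≈0 m = tested λ F r → r 0

  module QuotientSolver (m : Poly) where
    private
      ℤ-raw : RawRing _ _
      ℤ-raw = CommutativeRing.rawRing ℤₚ.+-*-commutativeRing

      constant : ℤ-raw -Raw-AlmostCommutative⟶ fromCommutativeRing (quotientRing m)
      constant = record
        { ⟦_⟧    = constP
        ; +-homo = λ a b → tested λ F _ → refl
        ; *-homo = λ a b → tested λ F _ → cong (λ c → c ℤ.* F 0 ℤ.+ + 0) (sym (ℤₚ.+-identityʳ (a ℤ.* b)))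
        ; -‿homo = λ a → tested λ F _ → refl
        ; 0-homo = tested λ F _ → refl
        ; 1-homo = tested λ F _ → refl }

      equal? : ∀ a b → Maybe (constP a ≈ constP b [mod m ])
      equal? a b with a ℤₚ.≟ b
      ... | yes refl = just (tested λ F _ → refl)
      ... | no  _    = nothing

    open RingSolver ℤ-raw (fromCommutativeRing (quotientRing m)) constant equal? public
      using (solve; _:=_; _:+_; _:*_; _:-_; :-_; con)

-- Parity in quotient rings

2· : Poly → Poly
2· p = constP (+ 2) *P p

Even[mod_] : Poly → Poly → Set
Even[mod m ] p = Σ[ q ∈ Poly ] p ≈ 2· q [mod m ]

-- The tests take values in ℤ, where 2 can be cancelled; hence the quotient is torsion-free for
-- every m.
2·-cancel : ∀ {m p q} → 2· p ≈ 2· q [mod m ] → p ≈ q [mod m ]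
2·-cancel {m} {p} {q} e = tested λ F r → ℤₚ.*-cancelˡ-≡ (+ 2) _ _
  (trans (sym (pair-2· p F)) (trans (test e F r) (pair-2· q F)))
  where
  pair-2· : ∀ p F → ⟨ 2· p ∣ F ⟩ ≡ + 2 ℤ.* ⟨ p ∣ F ⟩
  pair-2· p F = trans (pair-* (constP (+ 2)) p F) (pair-const (+ 2) (λ n → ⟨ p ∣ shift n F ⟩))

module _ {m : Poly} (reduced : ∀ z → Even[mod m ] (z *P z) → Even[mod m ] z) where
  open CommutativeRing (quotientRing m) using (setoid; +-cong; *-cong; -‿cong; zeroʳ) renaming (refl to ≈-refl; sym to ≈-sym; trans to ≈-trans)
  open QuotientSolver m
  open SetoidReasoning setoid

  -- With u = aa′ and d = ba′ the hypotheses give d² = u² − 2nu.  So d ≡ u modulo 2, say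
  -- d = u + 2e, and then nu = −2(ue + e²) with n odd.
  even-product : ∀ {a a′ b b′} k → let n = constP (+ 1) +P 2· k in
    (a +P b) *P (a′ +P b′) ≈ 2· n [mod m ] →
    (a -P b) *P (a′ -P b′) ≈ 2· n [mod m ] →
    Even[mod m ] (a *P a′)
  even-product {a} {a′} {b} {b′} k plus minus = _ , half
    where
    n u d d′ v : Poly
    n = constP (+ 1) +P 2· k
    u = a *P a′
    v = b *P b′
    d = b *P a′
    d′ = a *P b′
    u+v : u +P v ≈ 2· n [mod m ]
    u+v = 2·-cancel (begin
      2· (u +P v) ≈⟨ solve 4 (λ a a′ b b′ → con (+ 2) :* (a :* a′ :+ b :* b′) := (a :+ b) :* (a′ :+ b′) :+
          (a :- b) :* (a′ :- b′)) ≈-refl a a′ b b′ ⟩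
      (a +P b) *P (a′ +P b′) +P (a -P b) *P (a′ -P b′) ≈⟨ +-cong plus minus ⟩
      2· n +P 2· n ≈⟨ solve 1 (λ x → x :+ x := con (+ 2) :* x) ≈-refl (2· n) ⟩
      2· (2· n) ∎)
    d+d′ : d +P d′ ≈ [] [mod m ]
    d+d′ = 2·-cancel (begin
      2· (d +P d′) ≈⟨ solve 4 (λ a a′ b b′ → con (+ 2) :* (b :* a′ :+ a :* b′) := (a :+ b) :* (a′ :+ b′) :-
          (a :- b) :* (a′ :- b′)) ≈-refl a a′ b b′ ⟩
      (a +P b) *P (a′ +P b′) -P (a -P b) *P (a′ -P b′) ≈⟨ +-cong plus (-‿cong minus) ⟩
      -- The zero of the solver is the list `+ 0 ∷ []`, that of the ring is `[]`; `0≈` passes from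
      -- one to the other.
      2· n -P 2· n ≈⟨ solve 1 (λ x → x :- x := con (+ 2) :* con (+ 0)) ≈-refl (2· n) ⟩
      2· (constP (+ 0)) ≈⟨ *-cong {constP (+ 2)} ≈-refl 0≈ ⟩
      2· [] ∎)
      where
      0≈ : constP (+ 0) ≈ [] [mod m ]
      0≈ = tested λ _ _ → refl
    dd : d *P d ≈ u *P u -P 2· (n *P u) [mod m ]
    dd = begin
      -- Since dd′ = uv, d² = d(d + d′) - uv = d(d + d′) + u² - u(u + v), and both sums in brackets
      -- are known.
      d *P d ≈⟨ solve 4 (λ a a′ b b′ → (b :* a′) :* (b :* a′) := (b :* a′) :* (b :* a′ :+ a :* b′) :+
          (a :* a′) :* (a :* a′) :- (a :* a′) :* (a :* a′ :+ b :* b′)) ≈-refl a a′ b b′ ⟩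
      d *P (d +P d′) +P u *P u -P u *P (u +P v) ≈⟨ +-cong (+-cong (*-cong {d} ≈-refl d+d′) ≈-refl)
          (-‿cong (*-cong {u} ≈-refl u+v)) ⟩
      d *P [] +P u *P u -P u *P (2· n) ≈⟨ +-cong (+-cong (zeroʳ d) ≈-refl) ≈-refl ⟩
      u *P u -P u *P (2· n) ≈⟨ solve 2 (λ u n → u :* u :- u :* (con (+ 2) :* n) := u :* u :- con (+ 2) :*
          (n :* u)) ≈-refl u n ⟩
      u *P u -P 2· (n *P u) ∎
    diff : Even[mod m ] (d -P u)
    diff = reduced (d -P u) (_ , (begin
      (d -P u) *P (d -P u) ≈⟨ solve 2 (λ d u → (d :- u) :* (d :- u) := d :* d :+ u :* u :- con (+ 2) :*
          (d :* u)) ≈-refl d u ⟩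
      d *P d +P u *P u -P 2· (d *P u) ≈⟨ +-cong (+-cong dd ≈-refl) ≈-refl ⟩
      u *P u -P 2· (n *P u) +P u *P u -P 2· (d *P u) ≈⟨ solve 3
          (λ u n d → u :* u :- con (+ 2) :* (n :* u) :+ u :* u :- con (+ 2) :* (d :* u) := con (+ 2) :*
          (u :* u :- n :* u :- d :* u)) ≈-refl u n d ⟩
      2· (u *P u -P n *P u -P d *P u) ∎))
    e : Poly
    e = proj₁ diff
    d≈ : d ≈ u +P 2· e [mod m ]
    d≈ = ≈-trans (solve 2 (λ d u → d := u :+ (d :- u)) ≈-refl d u) (+-cong {u} ≈-refl (proj₂ diff))
    nu : n *P u ≈ negP (2· (u *P e +P e *P e)) [mod m ]
    nu = 2·-cancel (begin
      2· (n *P u) ≈⟨ solve 2 (λ x y → y := x :- (x :- y)) ≈-refl (u *P u) (2· (n *P u)) ⟩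
      u *P u -P (u *P u -P 2· (n *P u)) ≈⟨ +-cong {u *P u} ≈-refl (-‿cong (≈-trans (≈-sym dd) (*-cong d≈ d≈))) ⟩
      u *P u -P (u +P 2· e) *P (u +P 2· e) ≈⟨ solve 2
          (λ u e → u :* u :- (u :+ con (+ 2) :* e) :* (u :+ con (+ 2) :* e) := con (+ 2) :*
          (:- (con (+ 2) :* (u :* e :+ e :* e)))) ≈-refl u e ⟩
      2· (negP (2· (u *P e +P e *P e))) ∎)
    half : u ≈ 2· (negP (u *P e +P e *P e) -P k *P u) [mod m ]
    half = begin
      u ≈⟨ solve 2 (λ u k → u := (con (+ 1) :+ con (+ 2) :* k) :* u :- con (+ 2) :* (k :* u)) ≈-refl u k ⟩
      n *P u -P 2· (k *P u) ≈⟨ +-cong nu ≈-refl ⟩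
      negP (2· (u *P e +P e *P e)) -P 2· (k *P u) ≈⟨ solve 3
          (λ u e k → :- (con (+ 2) :* (u :* e :+ e :* e)) :- con (+ 2) :* (k :* u) := con (+ 2) :*
          (:- (u :* e :+ e :* e) :- k :* u)) ≈-refl u e k ⟩
      2· (negP (u *P e +P e *P e) -P k *P u) ∎

-- Reducedness modulo 2

-- The substitution x ↦ xᵏ, for k ≥ 1.
expand : ℕ → Poly → Poly
expand k []      = []
expand k (a ∷ p) = a ∷ replicate (ℕ.pred k) (+ 0) ++ expand k p

pair-expand : ∀ k .{{_ : NonZero k}} p F → ⟨ expand k p ∣ F ⟩ ≡ ⟨ p ∣ (λ n → F (n ℕ.* k)) ⟩
pair-expand k       []      F = refl
pair-expand (suc k) (a ∷ p) F = cong (ℤ._+_ (a ℤ.* F 0))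
  (trans (pair-0s++ k (expand (suc k) p) (shift 1 F)) (pair-expand (suc k) p (shift k (shift 1 F))))

expand-cong : ∀ k .{{_ : NonZero k}} {p q} → p ≈ q [mod [] ] → expand k p ≈ expand k q [mod [] ]
expand-cong k {p} {q} e = tested λ F _ →
  trans (pair-expand k p F) (trans (test e _ (λ _ → refl)) (sym (pair-expand k q F)))

expand-* : ∀ k .{{_ : NonZero k}} p q → expand k (p *P q) ≈ expand k p *P expand k q [mod [] ]
expand-* k p q = tested λ F _ → begin
  ⟨ expand k (p *P q) ∣ F ⟩ ≡⟨ pair-expand k (p *P q) F ⟩
  ⟨ p *P q ∣ (λ n → F (n ℕ.* k)) ⟩ ≡⟨ pair-* p q _ ⟩
  ⟨ p ∣ (λ n → ⟨ q ∣ (λ j → F ((n ℕ.+ j) ℕ.* k)) ⟩) ⟩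
    ≡⟨ pair-cong p (λ n → pair-cong q (λ j → cong F (ℕₚ.*-distribʳ-+ k n j))) ⟩
  ⟨ p ∣ (λ n → ⟨ q ∣ (λ j → F (n ℕ.* k ℕ.+ j ℕ.* k)) ⟩) ⟩
    ≡⟨ pair-cong p (λ n → sym (pair-expand k q (shift (n ℕ.* k) F))) ⟩
  ⟨ p ∣ (λ n → ⟨ expand k q ∣ shift (n ℕ.* k) F ⟩) ⟩ ≡⟨ pair-expand k p _ ⟨
  ⟨ expand k p ∣ (λ n → ⟨ expand k q ∣ shift n F ⟩) ⟩ ≡⟨ pair-* (expand k p) (expand k q) F ⟨
  ⟨ expand k p *P expand k q ∣ F ⟩ ∎
  where open ≡-Reasoning

expand-expand : ∀ k l .{{_ : NonZero k}} .{{_ : NonZero l}} .{{_ : NonZero (l ℕ.* k)}} p →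
  expand k (expand l p) ≈ expand (l ℕ.* k) p [mod [] ]
expand-expand k l p = tested λ F _ → begin
  ⟨ expand k (expand l p) ∣ F ⟩ ≡⟨ pair-expand k (expand l p) F ⟩
  ⟨ expand l p ∣ (λ n → F (n ℕ.* k)) ⟩ ≡⟨ pair-expand l p _ ⟩
  ⟨ p ∣ (λ n → F (n ℕ.* l ℕ.* k)) ⟩ ≡⟨ pair-cong p (λ n → cong F (ℕₚ.*-assoc n l k)) ⟩
  ⟨ p ∣ (λ n → F (n ℕ.* (l ℕ.* k))) ⟩ ≡⟨ pair-expand (l ℕ.* k) p F ⟨
  ⟨ expand (l ℕ.* k) p ∣ F ⟩ ∎
  where open ≡-Reasoning

square≡self+2 : ∀ a → Σ[ t ∈ ℤ ] a ℤ.* a ≡ a ℤ.+ + 2 ℤ.* t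
square≡self+2 (+ n) = square-ℕ n
  where
  square-ℕ : ∀ n → Σ[ t ∈ ℤ ] + n ℤ.* + n ≡ + n ℤ.+ + 2 ℤ.* t
  square-ℕ zero    = + 0 , refl
  square-ℕ (suc n) with square-ℕ n
  ... | t , e = t ℤ.+ + n , trans (lemma (+ n))
      (trans (cong (λ x → x ℤ.+ (+ n ℤ.+ + n) ℤ.+ + 1) e) (lemma′ (+ n) t))
    where
    lemma : ∀ x → (+ 1 ℤ.+ x) ℤ.* (+ 1 ℤ.+ x) ≡ x ℤ.* x ℤ.+ (x ℤ.+ x) ℤ.+ + 1
    lemma = ℤ-Solver.solve-∀
    lemma′ : ∀ x t → (x ℤ.+ + 2 ℤ.* t) ℤ.+ (x ℤ.+ x) ℤ.+ + 1 ≡ (+ 1 ℤ.+ x) ℤ.+ + 2 ℤ.* (t ℤ.+ x)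
    lemma′ = ℤ-Solver.solve-∀
square≡self+2 -[1+ n ] with square≡self+2 (+ suc n)
... | t , e = t ℤ.+ + suc n , trans (lemma (+ suc n)) (trans e (lemma′ (+ suc n) t))
  where
  lemma : ∀ x → (- x) ℤ.* (- x) ≡ x ℤ.* x
  lemma = ℤ-Solver.solve-∀
  lemma′ : ∀ x t → x ℤ.+ + 2 ℤ.* t ≡ - x ℤ.+ + 2 ℤ.* (t ℤ.+ x)
  lemma′ = ℤ-Solver.solve-∀

module _ where
  open CommutativeRing (quotientRing []) using (setoid; +-cong; *-cong) renaming (refl to ≈-refl; sym to ≈-sym; trans to ≈-trans)
  open QuotientSolver []
  open SetoidReasoning setoid

  private
    square-step : ∀ a x p t e r → a *P a ≈ a +P 2· t [mod [] ] → p *P p ≈ e +P 2· r [mod [] ] →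
      (a +P x *P p) *P (a +P x *P p) ≈ (a +P x *P x *P e) +P 2· (t +P a *P x *P p +P x *P x *P r) [mod [] ]
    square-step a x p t e r a² p² = begin
      (a +P x *P p) *P (a +P x *P p)
        ≈⟨ solve 3 (λ a x p → (a :+ x :* p) :* (a :+ x :* p) :=
             a :* a :+ con (+ 2) :* (a :* x :* p) :+ x :* x :* (p :* p)) ≈-refl a x p ⟩
      a *P a +P 2· (a *P x *P p) +P x *P x *P (p *P p)
        ≈⟨ +-cong (+-cong a² ≈-refl) (*-cong {x *P x} ≈-refl p²) ⟩
      a +P 2· t +P 2· (a *P x *P p) +P x *P x *P (e +P 2· r)
        ≈⟨ solve 6 (λ a x p t e r →
             a :+ con (+ 2) :* t :+ con (+ 2) :* (a :* x :* p) :+ x :* x :* (e :+ con (+ 2) :* r) :=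
             (a :+ x :* x :* e) :+ con (+ 2) :* (t :+ a :* x :* p :+ x :* x :* r)) ≈-refl a x p t e r ⟩
      (a +P x *P x *P e) +P 2· (t +P a *P x *P p +P x *P x *P r) ∎

    pair-x* : ∀ p F → ⟨ X^ 1 *P p ∣ F ⟩ ≡ ⟨ p ∣ shift 1 F ⟩
    pair-x* p F = trans (pair-* (X^ 1) p F) (pair-X^ 1 (λ n → ⟨ p ∣ shift n F ⟩))

    pair-split : ∀ a p F → ⟨ constP a +P p ∣ F ⟩ ≡ a ℤ.* F 0 ℤ.+ ⟨ p ∣ F ⟩
    pair-split a p F = trans (pair-+ (constP a) p F) (cong (ℤ._+ ⟨ p ∣ F ⟩) (pair-const a F))

    ∷≈ : ∀ a p → a ∷ p ≈ constP a +P X^ 1 *P p [mod [] ]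
    ∷≈ a p = tested λ F _ →
      sym (trans (pair-split a (X^ 1 *P p) F) (cong (ℤ._+_ (a ℤ.* F 0)) (pair-x* p F)))

    ∷0∷≈ : ∀ a p → constP a +P X^ 1 *P X^ 1 *P p ≈ a ∷ + 0 ∷ p [mod [] ]
    ∷0∷≈ a p = tested λ F _ → trans (pair-split a (X^ 1 *P X^ 1 *P p) F) (cong (ℤ._+_ (a ℤ.* F 0))
      (trans (pair-*-assoc (X^ 1) (X^ 1) p F) (trans (pair-x* (X^ 1 *P p) F)
        (trans (pair-x* p (shift 1 F)) (sym (pair-0∷ p (shift 1 F)))))))

    pair-const-* : ∀ a b F → ⟨ constP a *P constP b ∣ F ⟩ ≡ a ℤ.* (b ℤ.* F 0)
    pair-const-* a b F = trans (pair-* (constP a) (constP b) F)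
      (trans (pair-const a (λ n → ⟨ constP b ∣ shift n F ⟩)) (cong (a ℤ.*_) (pair-const b F)))

    const² : ∀ a t → a ℤ.* a ≡ a ℤ.+ + 2 ℤ.* t → constP a *P constP a ≈ constP a +P 2· (constP t) [mod [] ]
    const² a t a² = tested λ F _ → ≡R.begin
      ⟨ constP a *P constP a ∣ F ⟩           ≡R.≡⟨ pair-const-* a a F ⟩
      a ℤ.* (a ℤ.* F 0)                     ≡R.≡⟨ sym (ℤₚ.*-assoc a a (F 0)) ⟩
      a ℤ.* a ℤ.* F 0                       ≡R.≡⟨ cong (ℤ._* F 0) a² ⟩
      (a ℤ.+ + 2 ℤ.* t) ℤ.* F 0             ≡R.≡⟨ lemma a t (F 0) ⟩
      a ℤ.* F 0 ℤ.+ + 2 ℤ.* (t ℤ.* F 0)     ≡R.≡⟨ cong (ℤ._+_ (a ℤ.* F 0)) (sym (pair-const-* (+ 2) t F)) ⟩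
      a ℤ.* F 0 ℤ.+ ⟨ 2· (constP t) ∣ F ⟩    ≡R.≡⟨ sym (pair-split a (2· (constP t)) F) ⟩
      ⟨ constP a +P 2· (constP t) ∣ F ⟩      ≡R.∎
      where
      module ≡R = ≡-Reasoning
      lemma : ∀ a t x → (a ℤ.+ + 2 ℤ.* t) ℤ.* x ≡ a ℤ.* x ℤ.+ + 2 ℤ.* (t ℤ.* x)
      lemma = ℤ-Solver.solve-∀

  -- The Frobenius map modulo 2, by recursion on the coefficients: (a + xp)² = a² + 2axp + x²p²,
  -- where a² ≡ a and p² ≡ p(x²).
  square≈expand : ∀ z → Σ[ r ∈ Poly ] z *P z ≈ expand 2 z +P 2· r [mod [] ]
  square≈expand []      = [] , tested λ _ _ → refl
  square≈expand (a ∷ p) with square≡self+2 a | square≈expand p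
  ... | t , a² | r , p² = r′ ,
      ≈-trans {a∷p *P a∷p} {a+xp *P a+xp} {expand 2 a∷p +P 2· r′}
          (*-cong {a∷p} {a+xp} {a∷p} {a+xp} (∷≈ a p) (∷≈ a p))
      (≈-trans {a+xp *P a+xp} {a+xxe +P 2· r′} {expand 2 a∷p +P 2· r′}
        (square-step (constP a) (X^ 1) p (constP t) (expand 2 p) r (const² a t a²) p²)
        (+-cong {a+xxe} {expand 2 a∷p} {2· r′} {2· r′} (∷0∷≈ a (expand 2 p)) ≈-refl))
    where
    r′ a∷p a+xp a+xxe : Poly
    r′ = constP t +P constP a *P X^ 1 *P p +P X^ 1 *P X^ 1 *P r
    a∷p = a ∷ p
    a+xp = constP a +P X^ 1 *P p
    a+xxe = constP a +P X^ 1 *P X^ 1 *P expand 2 p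

-- Signs and antiperiodic sequences

-- This is (-1)ⁿx.
flip : ℕ → ℤ → ℤ
flip zero    x = x
flip (suc n) x = - flip n x

flip-+ : ∀ m n x → flip (m ℕ.+ n) x ≡ flip m (flip n x)
flip-+ zero    n x = refl
flip-+ (suc m) n x = cong -_ (flip-+ m n x)

flip-neg : ∀ n x → flip n (- x) ≡ - flip n x
flip-neg zero    x = refl
flip-neg (suc n) x = cong -_ (flip-neg n x)

flip-double : ∀ n x → flip (n ℕ.+ n) x ≡ x
flip-double zero    x = refl
flip-double (suc n) x = trans (cong (λ k → - flip k x) (ℕₚ.+-suc n n))
  (trans (ℤₚ.neg-involutive _) (flip-double n x))

flip-*-odd : ∀ n s x → flip (n ℕ.* (1 ℕ.+ 2 ℕ.* s)) x ≡ flip n x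
flip-*-odd n s x = trans (cong (λ k → flip k x) (lemma n s))
  (trans (flip-+ n (n ℕ.* s ℕ.+ n ℕ.* s) x) (cong (flip n) (flip-double (n ℕ.* s) x)))
  where
  lemma : ∀ n s → n ℕ.* (1 ℕ.+ 2 ℕ.* s) ≡ n ℕ.+ (n ℕ.* s ℕ.+ n ℕ.* s)
  lemma = ℕ-Solver.solve-∀

-- The dual form of the relation xᴺ = -1.
Antiperiodic : ℕ → (ℕ → ℤ) → Set
Antiperiodic N F = ∀ n → F (n ℕ.+ N) ≡ - F n

antiperiodic-* : ∀ {N F} → Antiperiodic N F → ∀ j n → F (n ℕ.+ j ℕ.* N) ≡ flip j (F n)
antiperiodic-* {N} {F} anti zero    n = cong F (ℕₚ.+-identityʳ n)
antiperiodic-* {N} {F} anti (suc j) n =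
  trans (cong F (sym (ℕₚ.+-assoc n N (j ℕ.* N))))
    (trans (antiperiodic-* {F = F} anti j (n ℕ.+ N)) (trans (cong (flip j) (anti n)) (flip-neg j (F n))))

-- z(−x) and (z(x) − z(−x)) / 2.
alternate oddPart : Poly → Poly
alternate []      = []
alternate (a ∷ p) = a ∷ negP (alternate p)
oddPart []      = []
oddPart (a ∷ p) = + 0 ∷ (p -P oddPart p)

pair-alternate : ∀ p F → ⟨ alternate p ∣ F ⟩ ≡ ⟨ p ∣ (λ n → flip n (F n)) ⟩
pair-alternate []      F = refl
pair-alternate (a ∷ p) F = cong (ℤ._+_ (a ℤ.* F 0)) (begin
  ⟨ negP (alternate p) ∣ shift 1 F ⟩ ≡⟨ pair-neg (alternate p) (shift 1 F) ⟩
  - ⟨ alternate p ∣ shift 1 F ⟩ ≡⟨ cong -_ (pair-alternate p (shift 1 F)) ⟩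
  - ⟨ p ∣ (λ n → flip n (F (suc n))) ⟩ ≡⟨ ℤₚ.-1*i≡-i ⟨ p ∣ (λ n → flip n (F (suc n))) ⟩ ⟨
  - (+ 1) ℤ.* ⟨ p ∣ (λ n → flip n (F (suc n))) ⟩ ≡⟨ pair-*ᶠ p (- (+ 1)) (λ n → flip n (F (suc n))) ⟨
  ⟨ p ∣ (λ n → - (+ 1) ℤ.* flip n (F (suc n))) ⟩ ≡⟨ pair-cong p (λ n → ℤₚ.-1*i≡-i (flip n (F (suc n)))) ⟩
  ⟨ p ∣ (λ n → - flip n (F (suc n))) ⟩ ∎)
  where open ≡-Reasoning

alternate-oddPart : ∀ p F → ⟨ p ∣ F ⟩ ≡ ⟨ alternate p ∣ F ⟩ ℤ.+ + 2 ℤ.* ⟨ oddPart p ∣ F ⟩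
alternate-oddPart []      F = refl
alternate-oddPart (a ∷ p) F = begin
  a ℤ.* F 0 ℤ.+ P ≡⟨ lemma (a ℤ.* F 0) P A O (alternate-oddPart p (shift 1 F)) ⟩
  (a ℤ.* F 0 ℤ.+ - A) ℤ.+ + 2 ℤ.* (P ℤ.+ - O)
    ≡⟨ cong₂ (λ x y → (a ℤ.* F 0 ℤ.+ x) ℤ.+ + 2 ℤ.* y) (pair-neg (alternate p) (shift 1 F))
        (trans (pair-0∷ (p -P oddPart p) F) (trans (pair-+ p (negP (oddPart p)) (shift 1 F))
            (cong (ℤ._+_ P) (pair-neg (oddPart p) (shift 1 F))))) ⟨
  ⟨ alternate (a ∷ p) ∣ F ⟩ ℤ.+ + 2 ℤ.* ⟨ oddPart (a ∷ p) ∣ F ⟩ ∎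
  where
  open ≡-Reasoning
  P A O : ℤ
  P = ⟨ p ∣ shift 1 F ⟩
  A = ⟨ alternate p ∣ shift 1 F ⟩
  O = ⟨ oddPart p ∣ shift 1 F ⟩
  lemma : ∀ c P A O → P ≡ A ℤ.+ + 2 ℤ.* O → c ℤ.+ P ≡ (c ℤ.+ - A) ℤ.+ + 2 ℤ.* (P ℤ.+ - O)
  lemma c _ A O refl = lemma′ c A O
    where
    lemma′ : ∀ c A O → c ℤ.+ (A ℤ.+ + 2 ℤ.* O) ≡ (c ℤ.+ - A) ℤ.+ + 2 ℤ.* ((A ℤ.+ + 2 ℤ.* O) ℤ.+ - O)
    lemma′ = ℤ-Solver.solve-∀

module _ {m : Poly} {N : ℕ} (anti : ∀ F → Recurrence m F → Antiperiodic N F) where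
  open CommutativeRing (quotientRing m) using (setoid; +-cong; *-cong) renaming (refl to ≈-refl; sym to ≈-sym; trans to ≈-trans)
  open QuotientSolver m
  open SetoidReasoning setoid

  private
    even-square : ∀ z → Even[mod m ] z → Even[mod m ] (z *P z)
    even-square z (y , z≈) = y *P z ,
      ≈-trans (*-cong z≈ ≈-refl) (solve 2 (λ y z → con (+ 2) :* y :* z := con (+ 2) :* (y :* z)) ≈-refl y z)

    even-expand-2 : ∀ z → Even[mod m ] (z *P z) → Even[mod m ] (expand 2 z)
    even-expand-2 z (y , zz≈) with square≈expand z
    ... | r , e = y -P r , (begin
      expand 2 z ≈⟨ solve 2 (λ e r → e := (e :+ con (+ 2) :* r) :- con (+ 2) :* r) ≈-refl (expand 2 z) r ⟩
      (expand 2 z +P 2· r) -P 2· r ≈⟨ +-cong (≈-trans (≈-sym (≈-exact e)) zz≈) ≈-refl ⟩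
      2· y -P 2· r ≈⟨ solve 2 (λ y r → con (+ 2) :* y :- con (+ 2) :* r := con (+ 2) :* (y :- r)) ≈-refl y r ⟩
      2· (y -P r) ∎)

    expand-2^-suc : ∀ k z → expand (2 ℕ.* 2 ℕ.^ k) z ≈ expand 2 (expand (2 ℕ.^ k) z) [mod [] ]
    expand-2^-suc k z = tested λ F _ → trans (pair-expand (2 ℕ.* 2 ℕ.^ k) {{ℕₚ.m^n≢0 2 (suc k)}} z F)
      (sym (trans (pair-expand 2 (expand (2 ℕ.^ k) z) F)
        (trans (pair-expand (2 ℕ.^ k) {{ℕₚ.m^n≢0 2 k}} z (λ n → F (n ℕ.* 2)))
          (pair-cong z (λ n → cong F (lemma n (2 ℕ.^ k)))))))
      where
      lemma : ∀ n t → n ℕ.* t ℕ.* 2 ≡ n ℕ.* (2 ℕ.* t)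
      lemma = ℕ-Solver.solve-∀

    even-resp : ∀ p q → p ≈ q [mod m ] → Even[mod m ] q → Even[mod m ] p
    even-resp p q e (y , q≈) = y , ≈-trans e q≈

    -- Evenness passes from a polynomial to its square, and the square is congruent to the expansion
    -- by 2; each round thus doubles the power substituted for x.
    even-expand-2^ : ∀ z → Even[mod m ] (z *P z) → ∀ k → Even[mod m ] (expand (2 ℕ.^ suc k) z)
    even-expand-2^ z zz zero    = even-expand-2 z zz
    even-expand-2^ z zz (suc k) = even-resp (expand (2 ℕ.^ suc (suc k)) z) (expand 2 (expand (2 ℕ.^ suc k) z))
      (≈-exact (expand-2^-suc (suc k) z))
      (even-expand-2 (expand (2 ℕ.^ suc k) z) (even-square (expand (2 ℕ.^ suc k) z) (even-expand-2^ z zz k)))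

  -- By Frobenius, a power of z is congruent to z(x^(2^k)) = z(−x) ≡ z modulo 2.
  reduced-mod-2 : ∀ k s → 2 ℕ.^ suc k ≡ 1 ℕ.+ N ℕ.* (1 ℕ.+ 2 ℕ.* s) →
    ∀ z → Even[mod m ] (z *P z) → Even[mod m ] z
  reduced-mod-2 k s 2^k z zz with even-expand-2^ z zz k
  ... | y , e = y +P oddPart z , (begin
    z ≈⟨ (tested λ F _ → trans (alternate-oddPart z F)
        (sym (trans (pair-+ (alternate z) (2· (oddPart z)) F)
        (cong (ℤ._+_ ⟨ alternate z ∣ F ⟩) (trans (pair-* (constP (+ 2)) (oddPart z) F)
        (pair-const (+ 2) (λ n → ⟨ oddPart z ∣ shift n F ⟩))))))) ⟩
    alternate z +P 2· (oddPart z) ≈⟨ +-cong (≈-trans (≈-sym expand≈) e) ≈-refl ⟩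
    2· y +P 2· (oddPart z) ≈⟨ solve 2 (λ y o → con (+ 2) :* y :+ con (+ 2) :* o := con (+ 2) :* (y :+ o))
        ≈-refl y (oddPart z) ⟩
    2· (y +P oddPart z) ∎)
    where
    exponent : ∀ n → n ℕ.* 2 ℕ.^ suc k ≡ n ℕ.+ n ℕ.* (1 ℕ.+ 2 ℕ.* s) ℕ.* N
    exponent n = trans (cong (n ℕ.*_) 2^k) (lemma n N s)
      where
      lemma : ∀ n N s → n ℕ.* (1 ℕ.+ N ℕ.* (1 ℕ.+ 2 ℕ.* s)) ≡ n ℕ.+ n ℕ.* (1 ℕ.+ 2 ℕ.* s) ℕ.* N
      lemma = ℕ-Solver.solve-∀
    -- As 1 + 2s is odd, n factors x^(N(1 + 2s)) contribute the sign (-1)ⁿ, so xⁿ becomes (-x)ⁿ.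
    expand≈ : expand (2 ℕ.^ suc k) z ≈ alternate z [mod m ]
    expand≈ = tested λ F r → trans (pair-expand (2 ℕ.^ suc k) {{ℕₚ.m^n≢0 2 (suc k)}} z F)
      (trans (pair-cong z (λ n → trans (cong F (exponent n))
        (trans (antiperiodic-* {F = F} (anti F r) (n ℕ.* (1 ℕ.+ 2 ℕ.* s)) n) (flip-*-odd n s (F n)))))
      (sym (pair-alternate z F)))

-- Powers of 2 congruent to 1 modulo N

parity : ∀ n → Σ[ s ∈ ℕ ] (n ≡ 2 ℕ.* s ⊎ n ≡ 1 ℕ.+ 2 ℕ.* s)
parity zero = 0 , inj₁ refl
parity (suc n) with parity n
... | s , inj₁ e = s , inj₂ (cong suc e)
... | s , inj₂ e = suc s , inj₁ (trans (cong suc e) (sym (ℕₚ.*-suc 2 s)))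

even≢odd : ∀ m n → ¬ (2 ℕ.* m ≡ 1 ℕ.+ 2 ℕ.* n)
even≢odd zero    n       ()
even≢odd (suc m) zero    e = ℕₚ.1+n≢0 (ℕₚ.suc-injective (trans (sym (ℕₚ.*-suc 2 m)) e))
even≢odd (suc m) (suc n) e = even≢odd m n (ℕₚ.suc-injective (ℕₚ.suc-injective
  (trans (sym (ℕₚ.*-suc 2 m)) (trans e (cong suc (ℕₚ.*-suc 2 n))))))

binomial₂ : ∀ v n → Σ[ w ∈ ℕ ] (1 ℕ.+ v) ℕ.^ n ≡ 1 ℕ.+ (n ℕ.* v ℕ.+ v ℕ.* v ℕ.* w)
binomial₂ v zero    = 0 , cong suc (sym (ℕₚ.*-zeroʳ (v ℕ.* v)))
binomial₂ v (suc n) with binomial₂ v n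
... | w , e = _ , trans (cong ((1 ℕ.+ v) ℕ.*_) e) (lemma v n w)
  where
  lemma : ∀ v n w → (1 ℕ.+ v) ℕ.* (1 ℕ.+ (n ℕ.* v ℕ.+ v ℕ.* v ℕ.* w)) ≡
    1 ℕ.+ ((1 ℕ.+ n) ℕ.* v ℕ.+ v ℕ.* v ℕ.* (n ℕ.+ w ℕ.+ v ℕ.* w))
  lemma = ℕ-Solver.solve-∀

-- The exponent `suc k` excludes the trivial power 1 and makes the left side visibly even.
HasPowerOf2≡1 : ℕ → Set
HasPowerOf2≡1 m = Σ[ k ∈ ℕ ] Σ[ s ∈ ℕ ] 2 ℕ.^ suc k ≡ 1 ℕ.+ m ℕ.* s

-- With r = p + 1 and 2^(k+1) = 1 + v, v = rms, the r-th power is 1 + rv + v²w. Both rv and v² are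
-- multiples of r²m, so one more factor r is gained.
lift-power : ∀ p m → HasPowerOf2≡1 (suc p ℕ.* m) → HasPowerOf2≡1 (suc p ℕ.* (suc p ℕ.* m))
lift-power p m (k , s , e) with binomial₂ (suc p ℕ.* m ℕ.* s) (suc p)
-- This is (k + 1)(p + 1) - 1, whose successor is the product of the two exponents by computation.
... | w , e′ = p ℕ.+ k ℕ.* suc p , _ , trans (sym (ℕₚ.^-*-assoc 2 (suc k) (suc p)))
    (trans (cong (ℕ._^ suc p) e) (trans e′ (lemma (suc p) m s w)))
  where
  lemma : ∀ p m s w → 1 ℕ.+ (p ℕ.* (p ℕ.* m ℕ.* s) ℕ.+ p ℕ.* m ℕ.* s ℕ.* (p ℕ.* m ℕ.* s) ℕ.* w) ≡
    1 ℕ.+ p ℕ.* (p ℕ.* m) ℕ.* (s ℕ.+ m ℕ.* s ℕ.* s ℕ.* w)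
  lemma = ℕ-Solver.solve-∀

power≡1 : ∀ a b → HasPowerOf2≡1 (3 ℕ.^ suc a ℕ.* 7 ℕ.^ suc b)
-- 2⁶ = 64 = 1 + 21 · 3.
power≡1 zero    zero    = 5 , 3 , refl
power≡1 zero    (suc b) = subst HasPowerOf2≡1 (lemma′ (7 ℕ.^ b))
  (lift-power 6 (3 ℕ.* 7 ℕ.^ b) (subst HasPowerOf2≡1 (lemma (7 ℕ.^ b)) (power≡1 zero b)))
  where
  lemma : ∀ x → 3 ℕ.* 1 ℕ.* (7 ℕ.* x) ≡ 7 ℕ.* (3 ℕ.* x)
  lemma = ℕ-Solver.solve-∀
  lemma′ : ∀ x → 7 ℕ.* (7 ℕ.* (3 ℕ.* x)) ≡ 3 ℕ.* 1 ℕ.* (7 ℕ.* (7 ℕ.* x))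
  lemma′ = ℕ-Solver.solve-∀
power≡1 (suc a) b = subst HasPowerOf2≡1 (lemma′ (3 ℕ.^ a) (7 ℕ.^ suc b))
  (lift-power 2 (3 ℕ.^ a ℕ.* 7 ℕ.^ suc b) (subst HasPowerOf2≡1 (lemma (3 ℕ.^ a) (7 ℕ.^ suc b)) (power≡1 a b)))
  where
  lemma : ∀ x y → 3 ℕ.* x ℕ.* y ≡ 3 ℕ.* (x ℕ.* y)
  lemma = ℕ-Solver.solve-∀
  lemma′ : ∀ x y → 3 ℕ.* (3 ℕ.* (x ℕ.* y)) ≡ 3 ℕ.* (3 ℕ.* x) ℕ.* y
  lemma′ = ℕ-Solver.solve-∀

-- An even cofactor would make the even number 2^(k+1) odd. The odd cofactor is what turns xᴺ = -1
-- into x^(2^(k+1)) = -x.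
power≡1-odd : ∀ a b → Σ[ k ∈ ℕ ] Σ[ s ∈ ℕ ] 2 ℕ.^ suc k ≡ 1 ℕ.+ 3 ℕ.^ suc a ℕ.* 7 ℕ.^ suc b ℕ.* (1 ℕ.+ 2 ℕ.* s)
power≡1-odd a b with power≡1 a b
... | k , n , e with parity n
...   | s , inj₂ refl = k , s , e
...   | s , inj₁ refl = ⊥-elim (even≢odd (2 ℕ.^ k) (N ℕ.* s) (trans e (cong suc (lemma N s))))
  where
  N = 3 ℕ.^ suc a ℕ.* 7 ℕ.^ suc b
  lemma : ∀ N s → N ℕ.* (2 ℕ.* s) ≡ 2 ℕ.* (N ℕ.* s)
  lemma = ℕ-Solver.solve-∀

-- Division by monic polynomials

-- Pairing with `δ k` reads off the coefficient of xᵏ.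
δ : ℕ → ℕ → ℤ
δ zero    zero    = + 1
δ zero    (suc n) = + 0
δ (suc k) zero    = + 0
δ (suc k) (suc n) = δ k n

δ-refl : ∀ k → δ k k ≡ + 1
δ-refl zero    = refl
δ-refl (suc k) = δ-refl k

δ-< : ∀ {n k} → n ℕ.< k → δ k n ≡ + 0
δ-< {zero}  {suc k} _         = refl
δ-< {suc n} {suc k} (s≤s n<k) = δ-< n<k

pair-δ-short : ∀ p {k} → length p ℕ.≤ k → ⟨ p ∣ δ k ⟩ ≡ + 0
pair-δ-short p p≤k = trans (pair-cong-< p (λ n n<p → δ-< (ℕₚ.≤-trans n<p p≤k))) (pair-0ᶠ p)

∷-injectiveˡ : ∀ {a b p q} → a ∷ p ≈ b ∷ q [mod [] ] → a ≡ b
∷-injectiveˡ {a} {b} {p} {q} e = trans (sym (pair-δ0 a p)) (trans (test e (δ 0) (λ _ → refl)) (pair-δ0 b q))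
  where
  pair-δ0 : ∀ a p → ⟨ a ∷ p ∣ δ 0 ⟩ ≡ a
  pair-δ0 a p = trans (cong₂ ℤ._+_ (ℤₚ.*-identityʳ a) (pair-0ᶠ p)) (ℤₚ.+-identityʳ a)

∷-injectiveʳ : ∀ {a b p q} → a ∷ p ≈ b ∷ q [mod [] ] → p ≈ q [mod [] ]
∷-injectiveʳ {a} {b} {p} {q} e = tested λ F _ →
  trans (sym (pair-tail a p F)) (trans (test e (delay F) (λ _ → refl)) (pair-tail b q F))
  where
  delay : (ℕ → ℤ) → ℕ → ℤ
  delay F zero    = + 0
  delay F (suc n) = F n
  pair-tail : ∀ a p F → ⟨ a ∷ p ∣ delay F ⟩ ≡ ⟨ p ∣ F ⟩
  pair-tail a p F = trans (cong (ℤ._+ ⟨ p ∣ F ⟩) (ℤₚ.*-zeroʳ a)) (ℤₚ.+-identityˡ _)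

[]≈0∷ : [] ≈ + 0 ∷ [] [mod [] ]
[]≈0∷ = tested λ _ _ → refl

≈[]⇒zeros : ∀ p → p ≈ [] [mod [] ] → p ≡ replicate (length p) (+ 0)
≈[]⇒zeros []      e = refl
≈[]⇒zeros (a ∷ p) e = cong₂ _∷_ (∷-injectiveˡ e′) (≈[]⇒zeros p (∷-injectiveʳ e′))
  where
  e′ : a ∷ p ≈ + 0 ∷ [] [mod [] ]
  e′ = CommutativeRing.trans (quotientRing []) e []≈0∷

-- Stated up to equality in ℤ[x], because sums and products of lists may carry trailing zeros. The
-- degree is `length l`.
Monic : Poly → Set
Monic p = Σ[ l ∈ Poly ] p ≈ l ++ + 1 ∷ [] [mod [] ]

[]-not-monic : ¬ Monic []
[]-not-monic (l , e) with trans (test e (δ (length l)) (λ _ → refl)) (trans (pair-∷ʳ l (+ 1) (δ (length l)))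
  (cong₂ ℤ._+_ (pair-δ-short l ℕₚ.≤-refl) (cong (+ 1 ℤ.*_) (δ-refl (length l)))))
... | ()

monic-zeros : ∀ p l → p ≈ l ++ + 1 ∷ [] [mod [] ] → Σ[ k ∈ ℕ ] p ≡ (l ++ + 1 ∷ []) ++ replicate k (+ 0)
monic-zeros []      l       e = ⊥-elim ([]-not-monic (l , e))
monic-zeros (a ∷ p) []      e = length p , cong₂ _∷_ (∷-injectiveˡ e) (≈[]⇒zeros p (∷-injectiveʳ e))
monic-zeros (a ∷ p) (b ∷ l) e with monic-zeros p l (∷-injectiveʳ e)
... | k , p≡ = k , cong₂ _∷_ (∷-injectiveˡ e) p≡

-- Trailing zeros of d come first in `reverse d`, and `dropZeros` strips them down to the leading 1.
tailH-monic : ∀ d l → d ≈ l ++ + 1 ∷ [] [mod [] ] → tailH d ≡ reverse l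
tailH-monic d l e = tailH-dropZeros (begin
  dropZeros (reverse d)                                       ≡⟨ cong (λ d → dropZeros (reverse d)) d≡ ⟩
  dropZeros (reverse ((l ++ + 1 ∷ []) ++ replicate k (+ 0)))   ≡⟨ cong dropZeros
      (Listₚ.++-ʳ++ (l ++ + 1 ∷ [])) ⟩
  dropZeros (replicate k (+ 0) ʳ++ reverse (l ++ + 1 ∷ []))    ≡⟨ dropZeros-zeros k _ ⟩
  dropZeros (reverse (l ++ + 1 ∷ []))                                ≡⟨ cong dropZeros (Listₚ.reverse-++ l _) ⟩
  + 1 ∷ reverse l                                                    ∎)
  where
  open ≡-Reasoning
  k = proj₁ (monic-zeros d l e)
  d≡ = proj₂ (monic-zeros d l e)
  dropZeros-zeros : ∀ k xs → dropZeros (replicate k (+ 0) ʳ++ xs) ≡ dropZeros xs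
  dropZeros-zeros zero    xs = refl
  dropZeros-zeros (suc k) xs = dropZeros-zeros k (+ 0 ∷ xs)
  tailH-dropZeros : dropZeros (reverse d) ≡ + 1 ∷ reverse l → tailH d ≡ reverse l
  tailH-dropZeros e with dropZeros (reverse d)
  tailH-dropZeros refl | _ = refl

-- The pairing of a polynomial given by its coefficients from the highest degree down.
pairH : List ℤ → (ℕ → ℤ) → ℤ
pairH []       F = + 0
pairH (c ∷ ps) F = c ℤ.* F (length ps) ℤ.+ pairH ps F

pair-reverse : ∀ ps F → ⟨ reverse ps ∣ F ⟩ ≡ pairH ps F
pair-reverse []       F = refl
pair-reverse (c ∷ ps) F = begin
  ⟨ reverse (c ∷ ps) ∣ F ⟩                            ≡⟨ cong (λ p → ⟨ p ∣ F ⟩) (Listₚ.unfold-reverse c ps) ⟩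
  ⟨ reverse ps ++ c ∷ [] ∣ F ⟩                        ≡⟨ pair-∷ʳ (reverse ps) c F ⟩
  ⟨ reverse ps ∣ F ⟩ ℤ.+ c ℤ.* F (length (reverse ps)) ≡⟨ cong₂ (λ x n → x ℤ.+ c ℤ.* F n) (pair-reverse ps F)
      (Listₚ.length-reverse ps) ⟩
  pairH ps F ℤ.+ c ℤ.* F (length ps)                  ≡⟨ ℤₚ.+-comm (pairH ps F) _ ⟩
  c ℤ.* F (length ps) ℤ.+ pairH ps F                  ∎
  where open ≡-Reasoning

pairH-cong : ∀ ps {F G} → (∀ n → F n ≡ G n) → pairH ps F ≡ pairH ps G
pairH-cong []       e = refl
pairH-cong (c ∷ ps) e = cong₂ (λ x y → c ℤ.* x ℤ.+ y) (e (length ps)) (pairH-cong ps e)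

length-subPrefix : ∀ c ds rs → length ds ℕ.≤ length rs → length (subPrefix c ds rs) ≡ length rs
length-subPrefix c []       rs       _       = refl
length-subPrefix c (d ∷ ds) (r ∷ rs) (s≤s h) = cong suc (length-subPrefix c ds rs h)

-- One step of long division: c times the divisor is aligned with the top of `rs`, so its lower
-- coefficients start at the difference of the lengths.
pairH-subPrefix : ∀ c ds rs F → length ds ℕ.≤ length rs →
  pairH rs F ≡ c ℤ.* pairH ds (shift (length rs ∸ length ds) F) ℤ.+ pairH (subPrefix c ds rs) F
pairH-subPrefix c []       rs       F _       =
  sym (trans (cong (ℤ._+ pairH rs F) (ℤₚ.*-zeroʳ c)) (ℤₚ.+-identityˡ _))
pairH-subPrefix c (d ∷ ds) (r ∷ rs) F (s≤s h) = begin
  r ℤ.* F (length rs) ℤ.+ pairH rs F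
    ≡⟨ cong (ℤ._+_ (r ℤ.* F (length rs))) (pairH-subPrefix c ds rs F h) ⟩
  r ℤ.* F (length rs) ℤ.+ (c ℤ.* D ℤ.+ S)
    ≡⟨ lemma r c d (F (length rs)) D S ⟩
  c ℤ.* (d ℤ.* F (length rs) ℤ.+ D) ℤ.+ ((r ℤ.- c ℤ.* d) ℤ.* F (length rs) ℤ.+ S)
    ≡⟨ cong₂ (λ i j → c ℤ.* (d ℤ.* F i ℤ.+ D) ℤ.+ ((r ℤ.- c ℤ.* d) ℤ.* F j ℤ.+ S))
        (ℕₚ.m∸n+n≡m h) (length-subPrefix c ds rs h) ⟨
  c ℤ.* (d ℤ.* F (length rs ∸ length ds ℕ.+ length ds) ℤ.+ D)
    ℤ.+ ((r ℤ.- c ℤ.* d) ℤ.* F (length (subPrefix c ds rs)) ℤ.+ S) ∎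
  where
  open ≡-Reasoning
  D = pairH ds (shift (length rs ∸ length ds) F)
  S = pairH (subPrefix c ds rs) F
  lemma : ∀ r c d x D S → r ℤ.* x ℤ.+ (c ℤ.* D ℤ.+ S) ≡ c ℤ.* (d ℤ.* x ℤ.+ D) ℤ.+ ((r ℤ.- c ℤ.* d) ℤ.* x ℤ.+ S)
  lemma = ℤ-Solver.solve-∀

-- The length of Q is recorded because a highest-first list places a coefficient by the number of
-- entries after it; a new head of Q has degree `length Q`.
record IsDivMod (ds p Q R : List ℤ) : Set where
  constructor isDivMod
  field
    length-quotient  : length Q ≡ length p ∸ length ds
    length-remainder : length R ℕ.≤ length ds
    division         : ∀ F → pairH p F ≡ pairH Q (λ n → pairH (+ 1 ∷ ds) (shift n F)) ℤ.+ pairH R F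

divMonicH-correct : ∀ k ds p → length p ℕ.≤ k →
  IsDivMod ds p (proj₁ (divMonicH k ds p)) (proj₂ (divMonicH k ds p))
divMonicH-correct zero    ds []       _ = isDivMod (sym (ℕₚ.0∸n≡0 (length ds))) z≤n (λ F → refl)
divMonicH-correct (suc k) ds []       _ = isDivMod (sym (ℕₚ.0∸n≡0 (length ds))) z≤n (λ F → refl)
divMonicH-correct (suc k) ds (c ∷ ps) (s≤s h) with does (suc (length ds) ≤? suc (length ps)) in eq
... | false = isDivMod (sym (ℕₚ.m≤n⇒m∸n≡0 ps<ds)) ps<ds (λ F → sym (ℤₚ.+-identityˡ _))
  where ps<ds = ℕₚ.≮⇒≥ (λ ds<ps → subst T eq (ℕₚ.<⇒<ᵇ ds<ps))
... | true = isDivMod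
    (trans (cong suc |Q|) (sym (ℕₚ.+-∸-assoc 1 ds≤ps)))
    (IsDivMod.length-remainder IH)
    (λ F → begin
      c ℤ.* F (length ps) ℤ.+ pairH ps F
        ≡⟨ cong (ℤ._+_ (c ℤ.* F (length ps))) (pairH-subPrefix c ds ps F ds≤ps) ⟩
      c ℤ.* F (length ps) ℤ.+ (c ℤ.* pairH ds (shift e F) ℤ.+ pairH (subPrefix c ds ps) F)
        ≡⟨ cong (λ x → c ℤ.* F (length ps) ℤ.+ (c ℤ.* pairH ds (shift e F) ℤ.+ x)) (IsDivMod.division IH F) ⟩
      c ℤ.* F (length ps) ℤ.+ (c ℤ.* pairH ds (shift e F) ℤ.+ (pairH Q (G F) ℤ.+ pairH R F))
        ≡⟨ lemma c (F (length ps)) (pairH ds (shift e F)) (pairH Q (G F)) (pairH R F) ⟩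
      c ℤ.* (+ 1 ℤ.* F (length ps) ℤ.+ pairH ds (shift e F)) ℤ.+ pairH Q (G F) ℤ.+ pairH R F
        ≡⟨ cong (λ n → c ℤ.* (+ 1 ℤ.* F n ℤ.+ pairH ds (shift e F)) ℤ.+ pairH Q (G F) ℤ.+ pairH R F)
            (ℕₚ.m∸n+n≡m ds≤ps) ⟨
      c ℤ.* G F e ℤ.+ pairH Q (G F) ℤ.+ pairH R F
        ≡⟨ cong (λ n → c ℤ.* G F n ℤ.+ pairH Q (G F) ℤ.+ pairH R F) |Q| ⟨
      c ℤ.* G F (length Q) ℤ.+ pairH Q (G F) ℤ.+ pairH R F ∎)
  where
  open ≡-Reasoning
  e = length ps ∸ length ds
  ds≤ps = ℕₚ.≤-pred (ℕₚ.<ᵇ⇒< (length ds) (suc (length ps)) (subst T (sym eq) tt))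
  |sub| = length-subPrefix c ds ps ds≤ps
  IH = divMonicH-correct k ds (subPrefix c ds ps) (subst (ℕ._≤ k) (sym |sub|) h)
  Q = proj₁ (divMonicH k ds (subPrefix c ds ps))
  R = proj₂ (divMonicH k ds (subPrefix c ds ps))
  G : (ℕ → ℤ) → ℕ → ℤ
  G F n = pairH (+ 1 ∷ ds) (shift n F)
  |Q| : length Q ≡ e
  |Q| = trans (IsDivMod.length-quotient IH) (cong (_∸ length ds) |sub|)
  lemma : ∀ c x D Q R → c ℤ.* x ℤ.+ (c ℤ.* D ℤ.+ (Q ℤ.+ R)) ≡ c ℤ.* (+ 1 ℤ.* x ℤ.+ D) ℤ.+ Q ℤ.+ R
  lemma = ℤ-Solver.solve-∀

module _ (p : Poly) {d : Poly} (monic : Monic d) where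
  private
    l = proj₁ monic
    d≈ = proj₂ monic

    correct : IsDivMod (reverse l) (reverse p) (proj₁ (divMonicH (length p) (tailH d) (reverse p)))
                                               (proj₂ (divMonicH (length p) (tailH d) (reverse p)))
    correct = subst (λ t → IsDivMod (reverse l) (reverse p) (proj₁ (divMonicH (length p) t (reverse p)))
                                                            (proj₂ (divMonicH (length p) t (reverse p))))
      (sym (tailH-monic d l d≈))
      (divMonicH-correct (length p) (reverse l) (reverse p) (ℕₚ.≤-reflexive (Listₚ.length-reverse p)))

  length-remP : length (remP p d) ℕ.≤ length l
  length-remP = subst (length (remP p d) ℕ.≤_) (Listₚ.length-reverse l)
    (subst (ℕ._≤ length (reverse l)) (sym (Listₚ.length-reverse
        (proj₂ (divMonicH (length p) (tailH d) (reverse p))))) (IsDivMod.length-remainder correct))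

  quotP-remP : p ≈ quotP p d *P d +P remP p d [mod [] ]
  quotP-remP = tested λ F _ → begin
    ⟨ p ∣ F ⟩ ≡⟨ cong (λ p → ⟨ p ∣ F ⟩) (Listₚ.reverse-involutive p) ⟨
    ⟨ reverse (reverse p) ∣ F ⟩ ≡⟨ pair-reverse (reverse p) F ⟩
    pairH (reverse p) F ≡⟨ IsDivMod.division correct F ⟩
    pairH Q (λ n → pairH (+ 1 ∷ reverse l) (shift n F)) ℤ.+ pairH R F
      ≡⟨ cong₂ ℤ._+_ (pairH-cong Q (λ n → pair-d (shift n F))) (sym (pair-reverse R F)) ⟩
    pairH Q (λ n → ⟨ d ∣ shift n F ⟩) ℤ.+ ⟨ remP p d ∣ F ⟩
      ≡⟨ cong (ℤ._+ ⟨ remP p d ∣ F ⟩) (pair-reverse Q _) ⟨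
    ⟨ quotP p d ∣ (λ n → ⟨ d ∣ shift n F ⟩) ⟩ ℤ.+ ⟨ remP p d ∣ F ⟩
      ≡⟨ cong (ℤ._+ ⟨ remP p d ∣ F ⟩) (pair-* (quotP p d) d F) ⟨
    ⟨ quotP p d *P d ∣ F ⟩ ℤ.+ ⟨ remP p d ∣ F ⟩
      ≡⟨ pair-+ (quotP p d *P d) (remP p d) F ⟨
    ⟨ quotP p d *P d +P remP p d ∣ F ⟩ ∎
    where
    open ≡-Reasoning
    Q = proj₁ (divMonicH (length p) (tailH d) (reverse p))
    R = proj₂ (divMonicH (length p) (tailH d) (reverse p))
    pair-d : ∀ F → pairH (+ 1 ∷ reverse l) F ≡ ⟨ d ∣ F ⟩
    pair-d F = begin
      pairH (+ 1 ∷ reverse l) F                ≡⟨ pair-reverse (+ 1 ∷ reverse l) F ⟨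
      ⟨ reverse (+ 1 ∷ reverse l) ∣ F ⟩         ≡⟨ cong (λ p → ⟨ p ∣ F ⟩)
          (Listₚ.unfold-reverse (+ 1) (reverse l)) ⟩
      ⟨ reverse (reverse l) ++ + 1 ∷ [] ∣ F ⟩   ≡⟨ cong (λ p → ⟨ p ++ + 1 ∷ [] ∣ F ⟩)
          (Listₚ.reverse-involutive l) ⟩
      ⟨ l ++ + 1 ∷ [] ∣ F ⟩                     ≡⟨ test d≈ F (λ _ → refl) ⟨
      ⟨ d ∣ F ⟩                                ∎

-- The last coefficient of w reappears in the product as the coefficient of a degree beyond r, hence
-- is 0; it is dropped and the argument repeated.
multiple-of-monic-short : ∀ w l r → w *P (l ++ + 1 ∷ []) ≈ r [mod [] ] → length r ℕ.≤ length l →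
    w ≈ [] [mod [] ]
multiple-of-monic-short w l r e r≤l = go (reverseView w) e
  where
  d = l ++ + 1 ∷ []
  pair-d-short : ∀ n i → i ℕ.< n → ⟨ d ∣ shift i (δ (n ℕ.+ length l)) ⟩ ≡ + 0
  pair-d-short n i i<n = trans (pair-cong-< d (λ j j<d → δ-<
      (ℕₚ.+-mono-<-≤ i<n (ℕₚ.≤-pred (subst (j ℕ.<_) |d| j<d))))) (pair-0ᶠ d)
    where |d| = trans (Listₚ.length-++ l) (ℕₚ.+-comm (length l) 1)
  pair-d-lead : ∀ n → ⟨ d ∣ shift n (δ (n ℕ.+ length l)) ⟩ ≡ + 1
  pair-d-lead n = trans (pair-∷ʳ l (+ 1) _) (cong₂ ℤ._+_
    (trans (pair-cong-< l (λ j j<l → δ-< (ℕₚ.+-monoʳ-< n j<l))) (pair-0ᶠ l))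
    (cong (+ 1 ℤ.*_) (δ-refl (n ℕ.+ length l))))
  lead≡0 : ∀ w a → (w ++ a ∷ []) *P d ≈ r [mod [] ] → a ≡ + 0
  lead≡0 w a e = begin
    a ≡⟨ ℤₚ.*-identityʳ a ⟨
    a ℤ.* + 1 ≡⟨ cong (a ℤ.*_) (pair-d-lead n) ⟨
    a ℤ.* D n ≡⟨ ℤₚ.+-identityˡ _ ⟨
    + 0 ℤ.+ a ℤ.* D n ≡⟨ cong (ℤ._+ a ℤ.* D n)
        (trans (pair-cong-< w (λ i i<w → pair-d-short n i i<w)) (pair-0ᶠ w)) ⟨
    ⟨ w ∣ D ⟩ ℤ.+ a ℤ.* D n ≡⟨ pair-∷ʳ w a D ⟨
    ⟨ w ++ a ∷ [] ∣ D ⟩ ≡⟨ pair-* (w ++ a ∷ []) d (δ (n ℕ.+ length l)) ⟨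
    ⟨ (w ++ a ∷ []) *P d ∣ δ (n ℕ.+ length l) ⟩ ≡⟨ test e _ (λ _ → refl) ⟩
    ⟨ r ∣ δ (n ℕ.+ length l) ⟩ ≡⟨ pair-δ-short r (ℕₚ.≤-trans r≤l (ℕₚ.m≤n+m (length l) n)) ⟩
    + 0 ∎
    where
    open ≡-Reasoning
    n = length w
    D : ℕ → ℤ
    D i = ⟨ d ∣ shift i (δ (n ℕ.+ length l)) ⟩
  go : ∀ {w} → Reverse w → w *P d ≈ r [mod [] ] → w ≈ [] [mod [] ]
  go []            e = tested λ _ _ → refl
  go (w ∶ rs ∶ʳ a) e = ≈.trans drop-lead (go rs (≈.trans (≈.sym (≈.*-cong {y = w} drop-lead (≈.refl {d}))) e))
    where
    module ≈ = CommutativeRing (quotientRing [])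
    drop-lead : w ++ a ∷ [] ≈ w [mod [] ]
    drop-lead = tested λ F _ → trans (pair-∷ʳ w a F)
      (trans (cong (λ a → ⟨ w ∣ F ⟩ ℤ.+ a ℤ.* F (length w)) (lead≡0 w a e)) (ℤₚ.+-identityʳ _))

-- The multiple (u - `quotP p d`)·d equals the remainder, which is too short to be a nonzero
-- multiple of d.
quotP-unique : ∀ p d u → Monic d → p ≈ u *P d [mod [] ] → quotP p d ≈ u [mod [] ]
quotP-unique p d u monic@(l , d≈) p≈ = begin
  quotP p d ≈⟨ solve 2 (λ q u → q := u :- (u :- q)) ≈.refl (quotP p d) u ⟩
  u -P (u -P quotP p d) ≈⟨ ≈.+-cong {u} ≈.refl
      (≈.-‿cong (multiple-of-monic-short (u -P quotP p d) l (remP p d) difference (length-remP p monic))) ⟩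
  u -P [] ≈⟨ ≈.+-identityʳ u ⟩
  u ∎
  where
  module ≈ = CommutativeRing (quotientRing [])
  open QuotientSolver []
  open SetoidReasoning ≈.setoid
  difference : (u -P quotP p d) *P (l ++ + 1 ∷ []) ≈ remP p d [mod [] ]
  difference = begin
    (u -P quotP p d) *P (l ++ + 1 ∷ []) ≈⟨ ≈.*-cong {u -P quotP p d} ≈.refl d≈ ⟨
    (u -P quotP p d) *P d ≈⟨ solve 3 (λ u q d → (u :- q) :* d := u :* d :- q :* d) ≈.refl u (quotP p d) d ⟩
    u *P d -P quotP p d *P d ≈⟨ ≈.+-cong (≈.trans (≈.sym p≈) (quotP-remP p monic)) ≈.refl ⟩
    quotP p d *P d +P remP p d -P quotP p d *P d ≈⟨ solve 2 (λ x r → x :+ r :- x := r) ≈.refl (quotP p d *P d)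
        (remP p d) ⟩
    remP p d ∎

-- Divisors of 2ᶜ 3ⁱ 7ʲ

prime-2 : Prime 2
prime-2 = from-yes (prime? 2)

prime-3 : Prime 3
prime-3 = from-yes (prime? 3)

prime-7 : Prime 7
prime-7 = from-yes (prime? 7)

-- Induction on k. In qd = p^(k+1)n the prime p divides q or d by Euclid's lemma, and is cancelled
-- there; in the second case i grows by one.
divisor-split : ∀ {p} → Prime p → ∀ k n {d} → d ∣ p ℕ.^ k ℕ.* n →
  Σ[ i ∈ ℕ ] Σ[ e ∈ ℕ ] i ℕ.≤ k × e ∣ n × d ≡ p ℕ.^ i ℕ.* e
divisor-split pr zero    n {d} d∣n =
  0 , d , z≤n , subst (d ∣_) (ℕₚ.*-identityˡ n) d∣n , sym (ℕₚ.*-identityˡ d)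
divisor-split {p} pr (suc k) n {d} (divides q eq) with euclidsLemma q d pr
    (divides M (trans (sym eq) (lemma p (p ℕ.^ k) n)))
  where
  M = p ℕ.^ k ℕ.* n
  lemma : ∀ p x n → p ℕ.* x ℕ.* n ≡ x ℕ.* n ℕ.* p
  lemma = ℕ-Solver.solve-∀
... | inj₁ (divides q′ refl) with divisor-split pr k n {d}
    (divides q′ (ℕₚ.*-cancelˡ-≡ _ _ p {{prime⇒nonZero pr}}
    (trans (sym (ℕₚ.*-assoc p (p ℕ.^ k) n)) (trans eq (lemma q′ p d)))))
  where
  lemma : ∀ q p d → q ℕ.* p ℕ.* d ≡ p ℕ.* (q ℕ.* d)
  lemma = ℕ-Solver.solve-∀
...   | i , e , i≤k , e∣n , d≡ = i , e , ℕₚ.m≤n⇒m≤1+n i≤k , e∣n , d≡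
divisor-split {p} pr (suc k) n {d} (divides q eq) | inj₂ (divides d′ refl) with divisor-split pr k n {d′}
    (divides q (ℕₚ.*-cancelˡ-≡ _ _ p {{prime⇒nonZero pr}}
    (trans (sym (ℕₚ.*-assoc p (p ℕ.^ k) n)) (trans eq (lemma q d′ p)))))
  where
  lemma : ∀ q d p → q ℕ.* (d ℕ.* p) ≡ p ℕ.* (q ℕ.* d)
  lemma = ℕ-Solver.solve-∀
...   | i , e , i≤k , e∣n , d≡ = suc i , e , s≤s i≤k , e∣n , trans (cong (ℕ._* p) d≡) (lemma (p ℕ.^ i) e p)
  where
  lemma : ∀ x e p → x ℕ.* e ℕ.* p ≡ p ℕ.* x ℕ.* e
  lemma = ℕ-Solver.solve-∀

prime∣power : ∀ {p} → Prime p → ∀ q k → p ∣ q ℕ.^ k → p ∣ q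
prime∣power {p} pr q zero    p∣1 = ⊥-elim (ℕₚ.<⇒≢ (ℕ.nonTrivial⇒n>1 p {{prime⇒nonTrivial pr}})
    (sym (∣.∣1⇒≡1 p∣1)))
prime∣power pr q (suc k) p∣ = [ (λ x → x) , prime∣power pr q k ]′ (euclidsLemma q (q ℕ.^ k) pr p∣)

-- Uniqueness of the p-adic valuation.
power-cofactor-injective : ∀ p .{{_ : NonZero p}} i j {u v} → ¬ p ∣ u → ¬ p ∣ v →
  p ℕ.^ i ℕ.* u ≡ p ℕ.^ j ℕ.* v → i ≡ j × u ≡ v
power-cofactor-injective p zero    zero    {u} {v} _ _ e = refl , trans (sym (ℕₚ.*-identityˡ u))
    (trans e (ℕₚ.*-identityˡ v))
power-cofactor-injective p zero    (suc j) {u} {v} p∤u _ e =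
  ⊥-elim (p∤u (divides (p ℕ.^ j ℕ.* v) (trans (sym (ℕₚ.*-identityˡ u))
      (trans e (trans (ℕₚ.*-assoc p (p ℕ.^ j) v) (ℕₚ.*-comm p _))))))
power-cofactor-injective p (suc i) zero    {u} {v} _ p∤v e =
  ⊥-elim (p∤v (divides (p ℕ.^ i ℕ.* u) (trans (sym (ℕₚ.*-identityˡ v))
      (trans (sym e) (trans (ℕₚ.*-assoc p (p ℕ.^ i) u) (ℕₚ.*-comm p _))))))
power-cofactor-injective p (suc i) (suc j) {u} {v} p∤u p∤v e
  with power-cofactor-injective p i j p∤u p∤v (ℕₚ.*-cancelˡ-≡ _ _ p
      (trans (sym (ℕₚ.*-assoc p (p ℕ.^ i) u)) (trans e (ℕₚ.*-assoc p (p ℕ.^ j) v))))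
... | i≡j , u≡v = cong suc i≡j , u≡v

-- The exponents of 2, 7 and 3, in this order: products over the grid telescope in the last
-- coordinate first.
Exponents : Set
Exponents = ℕ × ℕ × ℕ

value : Exponents → ℕ
value (c , j , i) = 2 ℕ.^ c ℕ.* (3 ℕ.^ i ℕ.* 7 ℕ.^ j)

value>0 : ∀ x → 0 ℕ.< value x
value>0 (c , j , i) = ℕₚ.*-mono-≤ (ℕₚ.m^n>0 2 c) (ℕₚ.*-mono-≤ (ℕₚ.m^n>0 3 i) (ℕₚ.m^n>0 7 j))

value-injective : ∀ {x y} → value x ≡ value y → x ≡ y
value-injective {c , j , i} {c′ , j′ , i′} e
  with power-cofactor-injective 2 c c′ (2∤ i j) (2∤ i′ j′) e
  where
  2∤ : ∀ i j → ¬ 2 ∣ 3 ℕ.^ i ℕ.* 7 ℕ.^ j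
  2∤ i j 2∣ = [ (λ h → from-no (2 ∣? 3) (prime∣power prime-2 3 i h)) ,
      (λ h → from-no (2 ∣? 7) (prime∣power prime-2 7 j h)) ]′
    (euclidsLemma (3 ℕ.^ i) (7 ℕ.^ j) prime-2 2∣)
... | refl , e′ with power-cofactor-injective 3 i i′ (3∤ j) (3∤ j′) e′
  where
  3∤ : ∀ j → ¬ 3 ∣ 7 ℕ.^ j
  3∤ j h = from-no (3 ∣? 7) (prime∣power prime-3 7 j h)
...   | refl , e″ with power-cofactor-injective 7 j j′ {1} {1} (from-no (7 ∣? 1)) (from-no (7 ∣? 1))
    (cong (ℕ._* 1) e″)
...     | refl , _ = refl

grid : Exponents → List Exponents
grid (c , j , i) = cartesianProduct (upTo (suc c)) (cartesianProduct (upTo (suc j)) (upTo (suc i)))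

unique-grid : ∀ x → Unique (grid x)
unique-grid (c , j , i) = Unique.cartesianProduct⁺ (Unique.upTo⁺ (suc c))
    (Unique.cartesianProduct⁺ (Unique.upTo⁺ (suc j)) (Unique.upTo⁺ (suc i)))

divisor⇒grid : ∀ x {d} → d ∣ value x → d ∈ map value (grid x)
divisor⇒grid (c , j , i) d∣ with divisor-split prime-2 c (3 ℕ.^ i ℕ.* 7 ℕ.^ j) d∣
... | c′ , _ , c′≤c , e∣ , refl with divisor-split prime-3 i (7 ℕ.^ j) e∣
...   | i′ , _ , i′≤i , e′∣ , refl with divisor-split prime-7 j 1
    (subst (_ ∣_) (sym (ℕₚ.*-identityʳ (7 ℕ.^ j))) e′∣)
...     | j′ , u , j′≤j , u∣1 , refl with ∣.∣1⇒≡1 u∣1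
...       | refl = subst (_∈ map value (grid (c , j , i)))
    (cong (λ k → 2 ℕ.^ c′ ℕ.* (3 ℕ.^ i′ ℕ.* k)) (sym (ℕₚ.*-identityʳ (7 ℕ.^ j′))))
  (∈-map⁺ value (∈-cartesianProduct⁺ (∈-upTo⁺ (s≤s c′≤c))
      (∈-cartesianProduct⁺ (∈-upTo⁺ (s≤s j′≤j)) (∈-upTo⁺ (s≤s i′≤i)))))

∈-grid : ∀ c j i {c′ j′ i′} → (c′ , j′ , i′) ∈ grid (c , j , i) → c′ ℕ.≤ c × j′ ℕ.≤ j × i′ ℕ.≤ i
∈-grid c j i h with ∈-cartesianProduct⁻ (upTo (suc c)) _ h
... | hc , h′ with ∈-cartesianProduct⁻ (upTo (suc j)) (upTo (suc i)) h′
...   | hj , hi = ℕₚ.≤-pred (∈-upTo⁻ hc) , ℕₚ.≤-pred (∈-upTo⁻ hj) , ℕₚ.≤-pred (∈-upTo⁻ hi)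

power-∣ : ∀ p {i j} → i ℕ.≤ j → p ℕ.^ i ∣ p ℕ.^ j
power-∣ p {i} {j} i≤j = divides (p ℕ.^ (j ∸ i))
    (trans (cong (p ℕ.^_) (sym (ℕₚ.m∸n+n≡m i≤j))) (ℕₚ.^-distribˡ-+-* p (j ∸ i) i))

grid⇒divisor : ∀ x {d} → d ∈ map value (grid x) → d ∣ value x
grid⇒divisor (c , j , i) h with ∈-map⁻ value {xs = grid (c , j , i)} h
... | _ , h′ , refl with ∈-grid c j i h′
...   | c≤ , j≤ , i≤ = ∣.*-pres-∣ (power-∣ 2 c≤) (∣.*-pres-∣ (power-∣ 3 i≤) (power-∣ 7 j≤))

∈-properDivisors⁻ : ∀ m {d} → d ∈ properDivisors m → d ∣ m × d ℕ.< m
∈-properDivisors⁻ (suc m) h with ∈-filter⁻ (_∣? suc m) {xs = map suc (upTo m)} h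
... | h′ , d∣m with ∈-map⁻ suc {xs = upTo m} h′
...   | _ , h″ , refl = d∣m , s≤s (∈-upTo⁻ h″)
∈-properDivisors⁻ zero ()

∈-properDivisors⁺ : ∀ {m d} → 0 ℕ.< m → d ∣ m → d ≢ m → d ∈ properDivisors m
∈-properDivisors⁺ {suc m} {zero}  _ 0∣m d≢m = ⊥-elim (d≢m (sym (∣.0∣⇒≡0 0∣m)))
∈-properDivisors⁺ {suc m} {suc d} _ d∣m d≢m = ∈-filter⁺ (_∣? suc m)
  (∈-map⁺ suc (∈-upTo⁺ (ℕₚ.≤-pred (ℕₚ.≤∧≢⇒< (∣.∣⇒≤ d∣m) d≢m)))) d∣m

unique-divisors : ∀ m → Unique (m ∷ properDivisors m)
unique-divisors m = All.tabulate (λ d∈ m≡d → ℕₚ.<⇒≢ (proj₂ (∈-properDivisors⁻ m d∈)) (sym m≡d))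
  ∷ Unique.filter⁺ (_∣? m) (Unique.map⁺ ℕₚ.suc-injective (Unique.upTo⁺ (m ∸ 1)))

-- Both lists are free of repetitions and have the same members, but one runs by size and the other
-- by exponents.
divisors↭grid : ∀ x → value x ∷ properDivisors (value x) ↭ map value (grid x)
divisors↭grid x = ∼bag⇒↭ (unique∧set⇒bag (unique-divisors (value x))
    (Unique.map⁺ value-injective (unique-grid x))
  (mk⇔ to from))
  where
  to : ∀ {d} → d ∈ value x ∷ properDivisors (value x) → d ∈ map value (grid x)
  to (here refl) = divisor⇒grid x ∣.∣-refl
  to (there h)   = divisor⇒grid x (proj₁ (∈-properDivisors⁻ (value x) h))
  from : ∀ {d} → d ∈ map value (grid x) → d ∈ value x ∷ properDivisors (value x)
  from {d} h with d ℕₚ.≟ value x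
  ... | yes d≡ = here d≡
  ... | no  d≢ = there (∈-properDivisors⁺ (value>0 x) (grid⇒divisor x h) d≢)

-- Cyclotomic polynomials

module _ where
  open CommutativeRing (quotientRing []) using (setoid; +-cong; *-cong; *-assoc; *-identityˡ; *-identityʳ)
    renaming (refl to ≈-refl; sym to ≈-sym; trans to ≈-trans; reflexive to ≈-reflexive)
  open QuotientSolver []
  open SetoidReasoning setoid

  -- Subtraction and a test for zeros, rather than equality of lists, so that trailing zeros do no
  -- harm.
  ≈-computed : ∀ p q → True (All.all? (ℤₚ._≟ + 0) (p -P q)) → p ≈ q [mod [] ]
  ≈-computed p q h = tested λ F _ → ℤₚ.i-j≡0⇒i≡j _ _
      (trans (sym (trans (pair-+ p (negP q) F) (cong (ℤ._+_ ⟨ p ∣ F ⟩) (pair-neg q F))))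
    (pair-All0 (toWitness h) F))

  length-+P : ∀ p q → length (p +P q) ≡ length p ℕ.⊔ length q
  length-+P []      q       = refl
  length-+P (a ∷ p) []      = refl
  length-+P (a ∷ p) (b ∷ q) = cong suc (length-+P p q)

  length-*P : ∀ p q → length (p *P q) ℕ.≤ length p ℕ.+ length q
  length-*P []      q = z≤n
  length-*P (a ∷ p) q = subst (ℕ._≤ suc (length p ℕ.+ length q))
      (sym (length-+P (map (a ℤ.*_) q) (+ 0 ∷ p *P q)))
    (ℕₚ.⊔-lub (subst (ℕ._≤ suc (length p ℕ.+ length q)) (sym (Listₚ.length-map (a ℤ.*_) q))
        (ℕₚ.m≤n⇒m≤1+n (ℕₚ.m≤n+m (length q) (length p))))
              (s≤s (length-*P p q)))

  monic-intro : ∀ {p} r k → length r ℕ.≤ k → p ≈ r +P X^ k [mod [] ] → Monic p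
  monic-intro {p} r k r≤k e = r ++ replicate (k ∸ length r) (+ 0) , ≈-trans e (tested λ F _ → ≡R.begin
    ⟨ r +P X^ k ∣ F ⟩                            ≡R.≡⟨ pair-+ r (X^ k) F ⟩
    ⟨ r ∣ F ⟩ ℤ.+ ⟨ X^ k ∣ F ⟩                    ≡R.≡⟨ cong₂ ℤ._+_ (sym (pair-padded F))
        (trans (pair-X^ k F) (sym (ℤₚ.*-identityˡ _))) ⟩
    ⟨ l ∣ F ⟩ ℤ.+ + 1 ℤ.* F k                    ≡R.≡⟨ cong (λ n → ⟨ l ∣ F ⟩ ℤ.+ + 1 ℤ.* F n) (sym |l|) ⟩
    ⟨ l ∣ F ⟩ ℤ.+ + 1 ℤ.* F (length l)           ≡R.≡⟨ sym (pair-∷ʳ l (+ 1) F) ⟩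
    ⟨ l ++ + 1 ∷ [] ∣ F ⟩                        ≡R.∎)
    where
    module ≡R = ≡-Reasoning
    l = r ++ replicate (k ∸ length r) (+ 0)
    |l| : length l ≡ k
    |l| = trans (Listₚ.length-++ r) (trans (cong (length r ℕ.+_) (Listₚ.length-replicate (k ∸ length r)))
        (ℕₚ.m+[n∸m]≡n r≤k))
    pair-0s : ∀ n F → ⟨ replicate n (+ 0) ∣ F ⟩ ≡ + 0
    pair-0s zero    F = refl
    pair-0s (suc n) F = trans (pair-0∷ (replicate n (+ 0)) F) (pair-0s n (shift 1 F))
    pair-padded : ∀ F → ⟨ l ∣ F ⟩ ≡ ⟨ r ∣ F ⟩
    pair-padded F = trans (pair-++ r _ F) (trans (cong (ℤ._+_ ⟨ r ∣ F ⟩) (pair-0s (k ∸ length r) _))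
        (ℤₚ.+-identityʳ _))

  ∷ʳ≈ : ∀ l → l ++ + 1 ∷ [] ≈ l +P X^ (length l) [mod [] ]
  ∷ʳ≈ l = tested λ F _ → trans (pair-∷ʳ l (+ 1) F)
    (trans (cong (ℤ._+_ ⟨ l ∣ F ⟩) (trans (ℤₚ.*-identityˡ _) (sym (pair-X^ (length l) F))))
        (sym (pair-+ l (X^ (length l)) F)))

  X^*≈ : ∀ k p → X^ k *P p ≈ replicate k (+ 0) ++ p [mod [] ]
  X^*≈ k p = tested λ F _ → trans (pair-* (X^ k) p F)
    (trans (pair-X^ k (λ n → ⟨ p ∣ shift n F ⟩)) (sym (pair-0s++ k p F)))

  monic-resp : ∀ {p q} → p ≈ q [mod [] ] → Monic q → Monic p
  monic-resp e (l , q≈) = l , ≈-trans e q≈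

  monic-* : ∀ {p q} → Monic p → Monic q → Monic (p *P q)
  monic-* {p} {q} (l , p≈) (m , q≈) = monic-intro r (j ℕ.+ k) |r| (begin
    p *P q ≈⟨ *-cong (≈-trans p≈ (∷ʳ≈ l)) (≈-trans q≈ (∷ʳ≈ m)) ⟩
    (l +P X^ j) *P (m +P X^ k) ≈⟨ expandProduct l (X^ j) m (X^ k) ⟩
    l *P m +P X^ k *P l +P X^ j *P m +P X^ j *P X^ k ≈⟨ +-cong
        (+-cong (+-cong (≈-refl {l *P m}) (X^*≈ k l)) (X^*≈ j m)) (X^+ j k) ⟩
    r +P X^ (j ℕ.+ k) ∎)
    where
    j = length l
    k = length m
    r = l *P m +P (replicate k (+ 0) ++ l) +P (replicate j (+ 0) ++ m)
    expandProduct : ∀ l x m y → (l +P x) *P (m +P y) ≈ l *P m +P y *P l +P x *P m +P x *P y [mod [] ]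
    expandProduct = solve 4 (λ l x m y → (l :+ x) :* (m :+ y) := l :* m :+ y :* l :+ x :* m :+ x :* y) ≈-refl
    X^+ : ∀ j k → X^ j *P X^ k ≈ X^ (j ℕ.+ k) [mod [] ]
    X^+ j k = tested λ F _ → trans (pair-* (X^ j) (X^ k) F)
        (trans (pair-X^ j (λ n → ⟨ X^ k ∣ shift n F ⟩))
        (trans (pair-X^ k (shift j F)) (sym (pair-X^ (j ℕ.+ k) F))))
    |0s++| : ∀ k (p : Poly) → length (replicate k (+ 0) ++ p) ≡ k ℕ.+ length p
    |0s++| k p = trans (Listₚ.length-++ (replicate k (+ 0))) (cong (ℕ._+ length p) (Listₚ.length-replicate k))
    |r| : length r ℕ.≤ j ℕ.+ k
    |r| = ℕₚ.≤-trans (ℕₚ.≤-reflexive (trans (length-+P (l *P m +P (replicate k (+ 0) ++ l))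
        (replicate j (+ 0) ++ m)) (cong (ℕ._⊔ length (replicate j (+ 0) ++ m))
        (length-+P (l *P m) (replicate k (+ 0) ++ l)))))
      (ℕₚ.⊔-lub (ℕₚ.⊔-lub (length-*P l m) (ℕₚ.≤-reflexive (trans (|0s++| k l) (ℕₚ.+-comm k j))))
          (ℕₚ.≤-reflexive (|0s++| j m)))

  monic-expand : ∀ k .{{_ : NonZero k}} l → Monic (expand k (l ++ + 1 ∷ []))
  monic-expand k l = expand k l , tested λ F _ → ≡R.begin
    ⟨ expand k (l ++ + 1 ∷ []) ∣ F ⟩ ≡R.≡⟨ trans (pair-expand k (l ++ + 1 ∷ []) F)
        (pair-∷ʳ l (+ 1) (λ n → F (n ℕ.* k))) ⟩
    ⟨ l ∣ (λ n → F (n ℕ.* k)) ⟩ ℤ.+ + 1 ℤ.* F (length l ℕ.* k)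
      ≡R.≡⟨ sym (cong₂ (λ x n → x ℤ.+ + 1 ℤ.* F n) (pair-expand k l F) (length-expand k l)) ⟩
    ⟨ expand k l ∣ F ⟩ ℤ.+ + 1 ℤ.* F (length (expand k l)) ≡R.≡⟨ sym (pair-∷ʳ (expand k l) (+ 1) F) ⟩
    ⟨ expand k l ++ + 1 ∷ [] ∣ F ⟩ ≡R.∎
    where
    module ≡R = ≡-Reasoning
    length-expand : ∀ k .{{_ : NonZero k}} p → length (expand k p) ≡ length p ℕ.* k
    length-expand k       []      = refl
    length-expand (suc k) (a ∷ p) = cong suc (trans (Listₚ.length-++ (replicate k (+ 0)))
      (cong₂ ℕ._+_ (Listₚ.length-replicate k) (length-expand (suc k) p)))

  prod-cong : ∀ {A : Set} (g h : A → Poly) xs → (∀ x → x ∈ xs → g x ≈ h x [mod [] ]) →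
    prodP (map g xs) ≈ prodP (map h xs) [mod [] ]
  prod-cong g h []       e = ≈-refl
  prod-cong g h (x ∷ xs) e = *-cong (e x (here refl)) (prod-cong g h xs (λ y y∈ → e y (there y∈)))

  prod-++ : ∀ ps qs → prodP (ps ++ qs) ≈ prodP ps *P prodP qs [mod [] ]
  prod-++ []       qs = ≈-sym (*-identityˡ (prodP qs))
  prod-++ (p ∷ ps) qs = ≈-trans (*-cong (≈-refl {p}) (prod-++ ps qs)) (≈-sym (*-assoc p (prodP ps) (prodP qs)))

  prod-↭ : ∀ {ps qs} → ps ↭ qs → prodP ps ≈ prodP qs [mod [] ]
  prod-↭ ↭.refl         = ≈-refl
  prod-↭ (↭.prep p h)   = *-cong (≈-refl {p}) (prod-↭ h)
  prod-↭ (↭.swap {ps} {qs} p q h) = ≈-trans (*-cong (≈-refl {p}) (*-cong (≈-refl {q}) (prod-↭ h)))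
    (solve 3 (λ p q r → p :* (q :* r) := q :* (p :* r)) ≈-refl p q (prodP qs))
  prod-↭ (↭.trans h h′) = ≈-trans (prod-↭ h) (prod-↭ h′)

  prod-cartesian : ∀ {A B : Set} (g : A × B → Poly) xs ys →
    prodP (map g (cartesianProduct xs ys)) ≈ prodP (map (λ x → prodP (map (λ y → g (x , y)) ys)) xs) [mod [] ]
  prod-cartesian g []       ys = ≈-refl
  prod-cartesian g (x ∷ xs) ys = begin
    prodP (map g (map (x ,_) ys ++ cartesianProduct xs ys))
      ≡⟨ cong prodP (trans (Listₚ.map-++ g (map (x ,_) ys) _)
          (cong (_++ map g (cartesianProduct xs ys)) (sym (Listₚ.map-∘ ys)))) ⟩
    prodP (map (λ y → g (x , y)) ys ++ map g (cartesianProduct xs ys))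
      ≈⟨ prod-++ (map (λ y → g (x , y)) ys) _ ⟩
    prodP (map (λ y → g (x , y)) ys) *P prodP (map g (cartesianProduct xs ys))
      ≈⟨ *-cong (≈-refl {prodP (map (λ y → g (x , y)) ys)}) (prod-cartesian g xs ys) ⟩
    prodP (map (λ x → prodP (map (λ y → g (x , y)) ys)) (x ∷ xs)) ∎

  prod-telescope : ∀ (g G : ℕ → Poly) → g 0 ≈ G 0 [mod [] ] → (∀ n → G n *P g (suc n) ≈ G (suc n) [mod [] ]) →
    ∀ n → prodP (map g (upTo (suc n))) ≈ G n [mod [] ]
  prod-telescope g G e₀ e₊ zero    = ≈-trans (*-identityʳ (g 0)) e₀
  prod-telescope g G e₀ e₊ (suc n) = begin
    prodP (map g (upTo (suc (suc n)))) ≡⟨ cong (λ xs → prodP (map g xs)) (sym (Listₚ.upTo-∷ʳ (suc n))) ⟩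
    prodP (map g (upTo (suc n) ++ suc n ∷ [])) ≡⟨ cong prodP (Listₚ.map-++ g (upTo (suc n)) _) ⟩
    prodP (map g (upTo (suc n)) ++ g (suc n) ∷ []) ≈⟨ prod-++ (map g (upTo (suc n))) _ ⟩
    prodP (map g (upTo (suc n))) *P (g (suc n) *P constP (+ 1)) ≈⟨ *-cong (prod-telescope g G e₀ e₊ n)
        (*-identityʳ (g (suc n))) ⟩
    G n *P g (suc n) ≈⟨ e₊ n ⟩
    G (suc n) ∎

  monic-prod : ∀ {A : Set} (g : A → Poly) xs → (∀ x → x ∈ xs → Monic (g x)) → Monic (prodP (map g xs))
  monic-prod g []       h = [] , ≈-refl
  monic-prod g (x ∷ xs) h = monic-* (h x (here refl)) (monic-prod g xs (λ y y∈ → h y (there y∈)))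

  -- The cyclotomic polynomials of index 1, 3, 7, 21 for c = 0, and of twice that index for c = 1.
  Φ₁ Φ₃ Φ₇ Φ₂₁ : ℕ → Poly
  Φ₁ zero     = - + 1 ∷ + 1 ∷ []
  Φ₁ (suc _)  = + 1 ∷ + 1 ∷ []
  Φ₃ zero     = + 1 ∷ + 1 ∷ + 1 ∷ []
  Φ₃ (suc _)  = + 1 ∷ - + 1 ∷ + 1 ∷ []
  Φ₇ zero     = + 1 ∷ + 1 ∷ + 1 ∷ + 1 ∷ + 1 ∷ + 1 ∷ + 1 ∷ []
  Φ₇ (suc _)  = + 1 ∷ - + 1 ∷ + 1 ∷ - + 1 ∷ + 1 ∷ - + 1 ∷ + 1 ∷ []
  Φ₂₁ zero    = + 1 ∷ - + 1 ∷ + 0 ∷ + 1 ∷ - + 1 ∷ + 0 ∷ + 1 ∷ + 0 ∷ - + 1 ∷ + 1 ∷ + 0 ∷ - + 1 ∷ + 1 ∷ []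
  Φ₂₁ (suc _) = + 1 ∷ + 1 ∷ + 0 ∷ - + 1 ∷ - + 1 ∷ + 0 ∷ + 1 ∷ + 0 ∷ - + 1 ∷ - + 1 ∷ + 0 ∷ + 1 ∷ + 1 ∷ []

  -- The closed form of the cyclotomic polynomial of index `value`, for c ≤ 1: by Φ_{pm}(x) =
  -- Φ_m(x^p) for p dividing m, everything reduces to a squarefree index. For c ≥ 2 the value is a
  -- placeholder.
  Ψ : Exponents → Poly
  Ψ (c , zero  , zero)  = Φ₁ c
  Ψ (c , zero  , suc i) = expand (3 ℕ.^ i) (Φ₃ c)
  Ψ (c , suc j , zero)  = expand (7 ℕ.^ j) (Φ₇ c)
  Ψ (c , suc j , suc i) = expand (3 ℕ.^ i ℕ.* 7 ℕ.^ j) (Φ₂₁ c)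

  3^*7^≢0 : ∀ i j → NonZero (3 ℕ.^ i ℕ.* 7 ℕ.^ j)
  3^*7^≢0 i j = ℕₚ.m*n≢0 (3 ℕ.^ i) (7 ℕ.^ j) {{ℕₚ.m^n≢0 3 i}} {{ℕₚ.m^n≢0 7 j}}

  monic-Ψ : ∀ x → Monic (Ψ x)
  monic-Ψ (zero  , zero  , zero)  = - + 1 ∷ [] , ≈-refl
  monic-Ψ (suc _ , zero  , zero)  = + 1 ∷ [] , ≈-refl
  monic-Ψ (zero  , zero  , suc i) = monic-expand (3 ℕ.^ i) {{ℕₚ.m^n≢0 3 i}} (+ 1 ∷ + 1 ∷ [])
  monic-Ψ (suc _ , zero  , suc i) = monic-expand (3 ℕ.^ i) {{ℕₚ.m^n≢0 3 i}} (+ 1 ∷ - + 1 ∷ [])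
  monic-Ψ (zero  , suc j , zero)  = monic-expand (7 ℕ.^ j) {{ℕₚ.m^n≢0 7 j}}
      (+ 1 ∷ + 1 ∷ + 1 ∷ + 1 ∷ + 1 ∷ + 1 ∷ [])
  monic-Ψ (suc _ , suc j , zero)  = monic-expand (7 ℕ.^ j) {{ℕₚ.m^n≢0 7 j}}
      (+ 1 ∷ - + 1 ∷ + 1 ∷ - + 1 ∷ + 1 ∷ - + 1 ∷ [])
  monic-Ψ (zero  , suc j , suc i) = monic-expand (3 ℕ.^ i ℕ.* 7 ℕ.^ j) {{3^*7^≢0 i j}}
    (+ 1 ∷ - + 1 ∷ + 0 ∷ + 1 ∷ - + 1 ∷ + 0 ∷ + 1 ∷ + 0 ∷ - + 1 ∷ + 1 ∷ + 0 ∷ - + 1 ∷ [])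
  monic-Ψ (suc _ , suc j , suc i) = monic-expand (3 ℕ.^ i ℕ.* 7 ℕ.^ j) {{3^*7^≢0 i j}}
    (+ 1 ∷ + 1 ∷ + 0 ∷ - + 1 ∷ - + 1 ∷ + 0 ∷ + 1 ∷ + 0 ∷ - + 1 ∷ - + 1 ∷ + 0 ∷ + 1 ∷ [])

  -- This and the next three are cases of Φ_m(x)Φ_{pm}(x) = Φ_m(x^p), with p a prime not dividing m.
  Φ₁Φ₃ : ∀ c → Φ₁ c *P Φ₃ c ≈ expand 3 (Φ₁ c) [mod [] ]
  Φ₁Φ₃ zero    = ≈-computed (Φ₁ 0 *P Φ₃ 0) (expand 3 (Φ₁ 0)) _
  Φ₁Φ₃ (suc _) = ≈-computed (Φ₁ 1 *P Φ₃ 1) (expand 3 (Φ₁ 1)) _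

  Φ₁Φ₇ : ∀ c → Φ₁ c *P Φ₇ c ≈ expand 7 (Φ₁ c) [mod [] ]
  Φ₁Φ₇ zero    = ≈-computed (Φ₁ 0 *P Φ₇ 0) (expand 7 (Φ₁ 0)) _
  Φ₁Φ₇ (suc _) = ≈-computed (Φ₁ 1 *P Φ₇ 1) (expand 7 (Φ₁ 1)) _

  Φ₇Φ₂₁ : ∀ c → Φ₇ c *P Φ₂₁ c ≈ expand 3 (Φ₇ c) [mod [] ]
  Φ₇Φ₂₁ zero    = ≈-computed (Φ₇ 0 *P Φ₂₁ 0) (expand 3 (Φ₇ 0)) _
  Φ₇Φ₂₁ (suc _) = ≈-computed (Φ₇ 1 *P Φ₂₁ 1) (expand 3 (Φ₇ 1)) _

  Φ₁Φ₂ : Φ₁ 0 *P Φ₁ 1 ≈ expand 2 (Φ₁ 0) [mod [] ]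
  Φ₁Φ₂ = ≈-computed (Φ₁ 0 *P Φ₁ 1) (expand 2 (Φ₁ 0)) _

  expand-step : ∀ k l .{{_ : NonZero k}} .{{_ : NonZero l}} .{{_ : NonZero (l ℕ.* k)}} p q r →
      p *P q ≈ expand l r [mod [] ] →
    expand k p *P expand k q ≈ expand (l ℕ.* k) r [mod [] ]
  expand-step k l p q r e = begin
    expand k p *P expand k q ≈⟨ expand-* k p q ⟨
    expand k (p *P q) ≈⟨ expand-cong k e ⟩
    expand k (expand l r) ≈⟨ expand-expand k l r ⟩
    expand (l ℕ.* k) r ∎

  expand-1 : ∀ p → p ≈ expand 1 p [mod [] ]
  expand-1 p = tested λ F _ → trans (pair-cong p (λ n → cong F (sym (ℕₚ.*-identityʳ n))))
      (sym (pair-expand 1 p F))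

  expand-≡ : ∀ p {k l} → k ≡ l → expand k p ≈ expand l p [mod [] ]
  expand-≡ p e = ≈-reflexive (cong (λ k → expand k p) e)

  rowProduct : ℕ → ℕ → ℕ → Poly
  rowProduct c i zero    = expand (3 ℕ.^ i) (Φ₁ c)
  rowProduct c i (suc j) = expand (3 ℕ.^ i ℕ.* 7 ℕ.^ j) (Φ₇ c)

  -- Telescoping in i: Φ₁Φ₃ = Φ₁(x³), or Φ₇Φ₂₁ = Φ₇(x³), taken at a power of x, carries the partial
  -- product from i to i + 1.
  row : ∀ c i j → prodP (map (λ i → Ψ (c , j , i)) (upTo (suc i))) ≈ rowProduct c i j [mod [] ]
  row c i zero = prod-telescope (λ i → Ψ (c , zero , i)) (λ i → rowProduct c i zero) (expand-1 (Φ₁ c))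
    (λ i → expand-step (3 ℕ.^ i) 3 {{ℕₚ.m^n≢0 3 i}} {{_}} {{ℕₚ.m^n≢0 3 (suc i)}} (Φ₁ c) (Φ₃ c) (Φ₁ c) (Φ₁Φ₃ c))
        i
  row c i (suc j) = prod-telescope (λ i → Ψ (c , suc j , i)) (λ i → rowProduct c i (suc j))
    (expand-≡ (Φ₇ c) (sym (ℕₚ.*-identityˡ (7 ℕ.^ j))))
    (λ i → ≈-trans (expand-step (3 ℕ.^ i ℕ.* 7 ℕ.^ j) 3 {{3^*7^≢0 i j}} {{_}}
        {{ℕₚ.m*n≢0 3 _ {{_}} {{3^*7^≢0 i j}}}} (Φ₇ c) (Φ₂₁ c) (Φ₇ c) (Φ₇Φ₂₁ c))
      (expand-≡ (Φ₇ c) (sym (ℕₚ.*-assoc 3 (3 ℕ.^ i) (7 ℕ.^ j))))) i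

  block : ∀ c i j → prodP (map (λ j → rowProduct c i j) (upTo (suc j))) ≈ expand (3 ℕ.^ i ℕ.* 7 ℕ.^ j)
      (Φ₁ c) [mod [] ]
  block c i = prod-telescope (rowProduct c i) (λ j → expand (3 ℕ.^ i ℕ.* 7 ℕ.^ j) (Φ₁ c))
    (expand-≡ (Φ₁ c) (sym (ℕₚ.*-identityʳ (3 ℕ.^ i))))
    (λ j → ≈-trans (expand-step (3 ℕ.^ i ℕ.* 7 ℕ.^ j) 7 {{3^*7^≢0 i j}} {{_}}
        {{ℕₚ.m*n≢0 7 _ {{_}} {{3^*7^≢0 i j}}}} (Φ₁ c) (Φ₇ c) (Φ₁ c) (Φ₁Φ₇ c))
      (expand-≡ (Φ₁ c) (lemma (3 ℕ.^ i) (7 ℕ.^ j))))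
    where
    lemma : ∀ x y → 7 ℕ.* (x ℕ.* y) ≡ x ℕ.* (7 ℕ.* y)
    lemma = ℕ-Solver.solve-∀

  expand-Φ₁ : ∀ k .{{_ : NonZero k}} → expand k (Φ₁ 0) ≈ X^ k -P constP (+ 1) [mod [] ]
  expand-Φ₁ k = tested λ F _ → trans (pair-expand k (Φ₁ 0) F) (trans (lemma (F 0) (F (k ℕ.+ 0)))
    (trans (cong (λ n → F n ℤ.+ - (+ 1 ℤ.* F 0)) (ℕₚ.+-identityʳ k))
    (sym (trans (pair-+ (X^ k) (negP (constP (+ 1))) F)
        (cong₂ ℤ._+_ (pair-X^ k F) (trans (pair-neg (constP (+ 1)) F) (cong -_ (pair-const (+ 1) F))))))))
    where
    lemma : ∀ x y → - (+ 1) ℤ.* x ℤ.+ (+ 1 ℤ.* y ℤ.+ + 0) ≡ y ℤ.+ - (+ 1 ℤ.* x)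
    lemma = ℤ-Solver.solve-∀

  -- Telescoping over the powers of 3, then of 7, leaves x^M - 1 for c = 0 and x^M + 1 for c = 1,
  -- with M = 3ⁱ7ʲ; the product of the two is x^(2M) - 1.
  grid-product : ∀ c j i → c ℕ.≤ 1 → prodP (map Ψ (grid (c , j , i))) ≈ X^ (value (c , j , i)) -P constP
      (+ 1) [mod [] ]
  grid-product c j i c≤1 = begin
    prodP (map Ψ (grid (c , j , i))) ≈⟨ prod-cartesian Ψ (upTo (suc c))
        (cartesianProduct (upTo (suc j)) (upTo (suc i))) ⟩
    prodP (map (λ c → prodP (map (λ y → Ψ (c , y)) (cartesianProduct (upTo (suc j)) (upTo (suc i)))))
        (upTo (suc c)))
      ≈⟨ prod-cong _ (λ c → expand M (Φ₁ c)) (upTo (suc c)) (λ c _ → slice c) ⟩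
    prodP (map (λ c → expand M (Φ₁ c)) (upTo (suc c))) ≈⟨ signs c c≤1 ⟩
    X^ (value (c , j , i)) -P constP (+ 1) ∎
    where
    M = 3 ℕ.^ i ℕ.* 7 ℕ.^ j
    slice : ∀ c → prodP (map (λ y → Ψ (c , y)) (cartesianProduct (upTo (suc j)) (upTo (suc i)))) ≈ expand M
        (Φ₁ c) [mod [] ]
    slice c = begin
      prodP (map (λ y → Ψ (c , y)) (cartesianProduct (upTo (suc j)) (upTo (suc i)))) ≈⟨ prod-cartesian
          (λ y → Ψ (c , y)) (upTo (suc j)) (upTo (suc i)) ⟩
      prodP (map (λ j → prodP (map (λ i → Ψ (c , j , i)) (upTo (suc i)))) (upTo (suc j))) ≈⟨ prod-cong _
          (rowProduct c i) (upTo (suc j)) (λ j _ → row c i j) ⟩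
      prodP (map (rowProduct c i) (upTo (suc j))) ≈⟨ block c i j ⟩
      expand M (Φ₁ c) ∎
    signs : ∀ c → c ℕ.≤ 1 → prodP (map (λ c → expand M (Φ₁ c)) (upTo (suc c))) ≈ X^
        (value (c , j , i)) -P constP (+ 1) [mod [] ]
    signs zero _ = begin
      expand M (Φ₁ 0) *P constP (+ 1) ≈⟨ *-identityʳ (expand M (Φ₁ 0)) ⟩
      expand M (Φ₁ 0) ≈⟨ expand-Φ₁ M {{3^*7^≢0 i j}} ⟩
      X^ M -P constP (+ 1) ≡⟨ cong (λ k → X^ k -P constP (+ 1)) (sym (ℕₚ.*-identityˡ M)) ⟩
      X^ (1 ℕ.* M) -P constP (+ 1) ∎
    signs (suc zero) _ = begin
      expand M (Φ₁ 0) *P (expand M (Φ₁ 1) *P constP (+ 1)) ≈⟨ *-cong (≈-refl {expand M (Φ₁ 0)})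
          (*-identityʳ (expand M (Φ₁ 1))) ⟩
      expand M (Φ₁ 0) *P expand M (Φ₁ 1) ≈⟨ expand-step M 2 {{3^*7^≢0 i j}} {{_}}
          {{ℕₚ.m*n≢0 2 _ {{_}} {{3^*7^≢0 i j}}}} (Φ₁ 0) (Φ₁ 1) (Φ₁ 0) Φ₁Φ₂ ⟩
      expand (2 ℕ.* M) (Φ₁ 0) ≈⟨ expand-Φ₁ (2 ℕ.* M) {{ℕₚ.m*n≢0 2 _ {{_}} {{3^*7^≢0 i j}}}} ⟩
      X^ (2 ℕ.* M) -P constP (+ 1) ∎
    signs (suc (suc _)) (s≤s ())

  -- Induction on the fuel. The proper divisors are values of other grid points, so the divisor D is
  -- monic; x^m - 1 = Ψ·D by the grid product, and quotients by monic polynomials are unique.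
  cyc≈Ψ : ∀ f c j i → c ℕ.≤ 1 → value (c , j , i) ℕ.≤ f → cyc f (value (c , j , i)) ≈ Ψ (c , j , i) [mod [] ]
  cyc≈Ψ zero    c j i c≤1 m≤0 = ⊥-elim (ℕₚ.<⇒≱ (value>0 (c , j , i)) m≤0)
  cyc≈Ψ (suc f) c j i c≤1 m≤f = quotP-unique (X^ m -P constP (+ 1)) D (Ψ x) monic-D exact
    where
    x = c , j , i
    m = value x
    D = prodP (map (cyc f) (properDivisors m))

    smaller : ∀ y → y ∈ grid x → value y ℕ.< m → cyc f (value y) ≈ Ψ y [mod [] ]
    smaller (c′ , j′ , i′) y∈ y<m = cyc≈Ψ f c′ j′ i′ (ℕₚ.≤-trans (proj₁ (∈-grid c j i y∈)) c≤1)
        (ℕₚ.≤-pred (ℕₚ.≤-trans y<m m≤f))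

    monic-D : Monic D
    monic-D = monic-prod (cyc f) (properDivisors m) λ d d∈ →
      monic-at d (proj₂ (∈-properDivisors⁻ m d∈))
          (∈-map⁻ value (divisor⇒grid x (proj₁ (∈-properDivisors⁻ m d∈))))
      where
      monic-at : ∀ d → d ℕ.< m → (Σ[ y ∈ Exponents ] y ∈ grid x × d ≡ value y) → Monic (cyc f d)
      monic-at d d<m (y , y∈ , refl) = monic-resp (smaller y y∈ d<m) (monic-Ψ y)

    -- cyc f overridden at m by the claimed value, so that the product can run over all divisors of m.
    g : ℕ → Poly
    g d with d ℕₚ.≟ m
    ... | yes _ = Ψ x
    ... | no  _ = cyc f d

    g-m : ∀ d → d ≡ m → Ψ x ≡ g d
    g-m d d≡m with d ℕₚ.≟ m
    ... | yes _  = refl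
    ... | no d≢m = ⊥-elim (d≢m d≡m)

    g-d : ∀ d → d ≢ m → cyc f d ≡ g d
    g-d d d≢m with d ℕₚ.≟ m
    ... | yes d≡m = ⊥-elim (d≢m d≡m)
    ... | no  _   = refl

    g-grid : ∀ y → y ∈ grid x → g (value y) ≈ Ψ y [mod [] ]
    g-grid y y∈ = at (value y ℕₚ.≟ m)
      where
      y≤m : value y ℕ.≤ m
      y≤m = ∣⇒≤ {{ℕ.>-nonZero (value>0 x)}} (grid⇒divisor x (∈-map⁺ value y∈))
      at : Dec (value y ≡ m) → g (value y) ≈ Ψ y [mod [] ]
      at (yes e) = ≈-reflexive (trans (sym (g-m (value y) e)) (cong Ψ (sym (value-injective {y} {x} e))))
      at (no ¬e) = ≈-trans (≈-reflexive (sym (g-d (value y) ¬e))) (smaller y y∈ (ℕₚ.≤∧≢⇒< y≤m ¬e))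

    exact : X^ m -P constP (+ 1) ≈ Ψ x *P D [mod [] ]
    exact = ≈-sym (begin
      Ψ x *P D ≈⟨ *-cong (≈-reflexive (g-m m refl)) (prod-cong (cyc f) g (properDivisors m)
          (λ d d∈ → ≈-reflexive (g-d d (ℕₚ.<⇒≢ (proj₂ (∈-properDivisors⁻ m d∈)))))) ⟩
      prodP (map g (m ∷ properDivisors m)) ≈⟨ prod-↭ (map⁺ g (divisors↭grid x)) ⟩
      prodP (map g (map value (grid x))) ≡⟨ cong prodP (sym (Listₚ.map-∘ {g = g} {f = value} (grid x))) ⟩
      prodP (map (λ y → g (value y)) (grid x)) ≈⟨ prod-cong (λ y → g (value y)) Ψ (grid x) g-grid ⟩
      prodP (map Ψ (grid x)) ≈⟨ grid-product c j i c≤1 ⟩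
      X^ m -P constP (+ 1) ∎)

  Φ≈Ψ : ∀ c j i → c ℕ.≤ 1 → Φ (value (c , j , i)) ≈ Ψ (c , j , i) [mod [] ]
  Φ≈Ψ c j i c≤1 = cyc≈Ψ (value (c , j , i)) c j i c≤1 ℕₚ.≤-refl

  -- After division by `Φ m` the remainder consists of zeros, and the multiple of `Φ m` is killed by
  -- every recurrence for Ψ.
  vanishes⇒≈0 : ∀ c j i → c ℕ.≤ 1 → ∀ p → VanishesAtζ (value (c , j , i)) p → p ≈ [] [mod Ψ (c , j , i) ]
  vanishes⇒≈0 c j i c≤1 p vanishes = tested λ F r → trans (test (quotP-remP p monic) F (λ _ → refl))
    (trans (pair-+ (quotP p (Φ m) *P Φ m) (remP p (Φ m)) F) (trans (cong₂ ℤ._+_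
      (trans (pair-* (quotP p (Φ m)) (Φ m) F) (trans
          (pair-cong (quotP p (Φ m)) {G = λ _ → + 0}
          (λ n → trans (test (Φ≈Ψ c j i c≤1) (shift n F) (λ _ → refl)) (r n))) (pair-0ᶠ (quotP p (Φ m)))))
      (pair-All0 vanishes F)) refl))
    where
    m = value (c , j , i)
    monic : Monic (Φ m)
    monic = monic-resp (Φ≈Ψ c j i c≤1) (monic-Ψ (c , j , i))

-- Walsh sums

module _ where
  open ≡-Reasoning

  ∑ : {A : Set} → List A → (A → ℤ) → ℤ
  ∑ []       g = + 0
  ∑ (x ∷ xs) g = g x ℤ.+ ∑ xs g

  ∑-cong : ∀ {A : Set} (xs : List A) {g h} → (∀ x → x ∈ xs → g x ≡ h x) → ∑ xs g ≡ ∑ xs h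
  ∑-cong []       e = refl
  ∑-cong (x ∷ xs) e = cong₂ ℤ._+_ (e x (here refl)) (∑-cong xs (λ y y∈ → e y (there y∈)))

  ∑-0 : ∀ {A : Set} (xs : List A) → ∑ xs (λ _ → + 0) ≡ + 0
  ∑-0 []       = refl
  ∑-0 (x ∷ xs) = trans (ℤₚ.+-identityˡ _) (∑-0 xs)

  ∑-+ : ∀ {A : Set} (xs : List A) g h → ∑ xs (λ x → g x ℤ.+ h x) ≡ ∑ xs g ℤ.+ ∑ xs h
  ∑-+ []       g h = refl
  ∑-+ (x ∷ xs) g h = trans (cong (ℤ._+_ (g x ℤ.+ h x)) (∑-+ xs g h)) (lemma (g x) (h x) (∑ xs g) (∑ xs h))
    where
    lemma : ∀ a b c d → a ℤ.+ b ℤ.+ (c ℤ.+ d) ≡ a ℤ.+ c ℤ.+ (b ℤ.+ d)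
    lemma = ℤ-Solver.solve-∀

  ∑-* : ∀ {A : Set} (xs : List A) c g → ∑ xs (λ x → c ℤ.* g x) ≡ c ℤ.* ∑ xs g
  ∑-* []       c g = sym (ℤₚ.*-zeroʳ c)
  ∑-* (x ∷ xs) c g = trans (cong (ℤ._+_ (c ℤ.* g x)) (∑-* xs c g)) (sym (ℤₚ.*-distribˡ-+ c (g x) (∑ xs g)))

  ∑-swap : ∀ {A B : Set} (xs : List A) (ys : List B) (g : A → B → ℤ) →
    ∑ xs (λ x → ∑ ys (g x)) ≡ ∑ ys (λ y → ∑ xs (λ x → g x y))
  ∑-swap []       ys g = sym (∑-0 ys)
  ∑-swap (x ∷ xs) ys g = trans (cong (ℤ._+_ (∑ ys (g x))) (∑-swap xs ys g))
      (sym (∑-+ ys (g x) (λ y → ∑ xs (λ x → g x y))))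

  ∑-++ : ∀ {A : Set} (xs ys : List A) g → ∑ (xs ++ ys) g ≡ ∑ xs g ℤ.+ ∑ ys g
  ∑-++ []       ys g = sym (ℤₚ.+-identityˡ _)
  ∑-++ (x ∷ xs) ys g = trans (cong (ℤ._+_ (g x)) (∑-++ xs ys g)) (sym (ℤₚ.+-assoc (g x) (∑ xs g) (∑ ys g)))

  ∑-supported : ∀ {A : Set} {xs : List A} {x} g → Unique xs → x ∈ xs → (∀ y → x ≢ y → g y ≡ + 0) → ∑ xs g ≡ g x
  ∑-supported {xs = x ∷ xs} g (x∉ ∷ u) (here refl) g0 = trans (cong (ℤ._+_ (g x))
    (trans (∑-cong xs (λ y y∈ → g0 y (All.lookup x∉ y∈))) (∑-0 xs))) (ℤₚ.+-identityʳ _)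
  ∑-supported {xs = z ∷ xs} {x} g (z∉ ∷ u) (there x∈) g0 =
    trans (cong₂ ℤ._+_ (g0 z (λ x≡z → All.lookup z∉ x∈ (sym x≡z))) (∑-supported g u x∈ g0)) (ℤₚ.+-identityˡ _)

  -- Sums over an initial segment become pairings with 1 + x + ... + x^(n-1), so that their
  -- vanishing can follow from divisibility of polynomials.
  pair-1s : ∀ n F → ⟨ replicate n (+ 1) ∣ F ⟩ ≡ ∑ (upTo n) F
  pair-1s n F = go n (λ k → k)
    where
    go : ∀ n (f : ℕ → ℕ) → ⟨ replicate n (+ 1) ∣ (λ k → F (f k)) ⟩ ≡ ∑ (applyUpTo f n) F
    go zero    f = refl
    go (suc n) f = cong₂ ℤ._+_ (ℤₚ.*-identityˡ (F (f 0))) (go n (λ k → f (suc k)))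

  ∑-allFin : ∀ n G → ∑ (allFin n) (λ i → G (toℕ i)) ≡ ⟨ replicate n (+ 1) ∣ G ⟩
  ∑-allFin n G = go n (λ i → i) (λ i → G (toℕ i)) G (λ i → refl)
    where
    go : ∀ {A : Set} n (f : Fin n → A) (g : A → ℤ) G → (∀ i → g (f i) ≡ G (toℕ i)) →
      ∑ (tabulate f) g ≡ ⟨ replicate n (+ 1) ∣ G ⟩
    go zero    f g G e = refl
    go (suc n) f g G e = cong₂ ℤ._+_ (trans (e Fin.zero) (sym (ℤₚ.*-identityˡ _)))
      (go n (λ i → f (Fin.suc i)) g (λ k → G (suc k)) (λ i → e (Fin.suc i)))

  ∑-upTo-suc : ∀ n G → ∑ (upTo n) (λ k → G (suc k)) ℤ.+ G 0 ≡ ∑ (upTo n) G ℤ.+ G n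
  ∑-upTo-suc n G = begin
    ∑ (upTo n) (λ k → G (suc k)) ℤ.+ G 0         ≡⟨ ℤₚ.+-comm _ (G 0) ⟩
    G 0 ℤ.+ ∑ (upTo n) (λ k → G (suc k))         ≡⟨ cong₂ ℤ._+_ (ℤₚ.*-identityˡ (G 0))
        (pair-1s n (λ k → G (suc k))) ⟨
    ⟨ replicate (suc n) (+ 1) ∣ G ⟩              ≡⟨ pair-1s (suc n) G ⟩
    ∑ (upTo (suc n)) G                          ≡⟨ cong (λ xs → ∑ xs G) (Listₚ.upTo-∷ʳ n) ⟨
    ∑ (upTo n ++ n ∷ []) G                      ≡⟨ ∑-++ (upTo n) (n ∷ []) G ⟩
    ∑ (upTo n) G ℤ.+ (G n ℤ.+ + 0)              ≡⟨ cong (ℤ._+_ (∑ (upTo n) G)) (ℤₚ.+-identityʳ (G n)) ⟩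
    ∑ (upTo n) G ℤ.+ G n                        ∎

  ∑-const : ∀ n c → ∑ (upTo n) (λ _ → c) ≡ + n ℤ.* c
  ∑-const n c = trans (sym (pair-1s n (λ _ → c))) (go n)
    where
    go : ∀ n → ⟨ replicate n (+ 1) ∣ (λ _ → c) ⟩ ≡ + n ℤ.* c
    go zero    = refl
    go (suc n) = trans (cong (ℤ._+_ (+ 1 ℤ.* c)) (go n)) (sym (ℤₚ.*-distribʳ-+ c (+ 1) (+ n)))

  pair-sumP : ∀ {A : Set} (p : A → Poly) xs F → ⟨ sumP (map p xs) ∣ F ⟩ ≡ ∑ xs (λ x → ⟨ p x ∣ F ⟩)
  pair-sumP p []       F = refl
  pair-sumP p (x ∷ xs) F = trans (pair-+ (p x) (sumP (map p xs)) F)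
      (cong (ℤ._+_ ⟨ p x ∣ F ⟩) (pair-sumP p xs F))

  -- An integer weight instead of a filter: the even and odd parts stay sums over all of `allFin q`.
  [even] : ℕ → ℤ
  [even] zero          = + 1
  [even] (suc zero)    = + 0
  [even] (suc (suc n)) = [even] n

  [odd] : ℕ → ℤ
  [odd] n = [even] (suc n)

  [even]-double : ∀ n → [even] (2 ℕ.* n) ≡ + 1
  [even]-double zero    = refl
  [even]-double (suc n) = trans (cong [even] (ℕₚ.*-suc 2 n)) ([even]-double n)

  [even]-odd : ∀ n → [even] (1 ℕ.+ 2 ℕ.* n) ≡ + 0
  [even]-odd zero    = refl
  [even]-odd (suc n) = trans (cong (λ k → [even] (suc k)) (ℕₚ.*-suc 2 n)) ([even]-odd n)

  even+odd : ∀ n y → y ≡ [even] n ℤ.* y ℤ.+ [odd] n ℤ.* y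
  even+odd zero          y = sym (trans (ℤₚ.+-identityʳ _) (ℤₚ.*-identityˡ y))
  even+odd (suc zero)    y = sym (trans (ℤₚ.+-identityˡ _) (ℤₚ.*-identityˡ y))
  even+odd (suc (suc n)) y = even+odd n y

  even-odd : ∀ n y → flip n y ≡ [even] n ℤ.* y ℤ.+ - ([odd] n ℤ.* y)
  even-odd zero          y = sym (trans (ℤₚ.+-identityʳ _) (ℤₚ.*-identityˡ y))
  even-odd (suc zero)    y = sym (trans (ℤₚ.+-identityˡ _) (cong -_ (ℤₚ.*-identityˡ y)))
  even-odd (suc (suc n)) y = trans (ℤₚ.neg-involutive (flip n y)) (even-odd n y)

  count-even : ∀ n → ⟨ replicate (2 ℕ.* n) (+ 1) ∣ [even] ⟩ ≡ + n
  count-even zero    = refl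
  count-even (suc n) = trans (cong (λ k → ⟨ replicate k (+ 1) ∣ [even] ⟩) (ℕₚ.*-suc 2 n))
    (trans (cong (ℤ._+_ (+ 1)) (trans (ℤₚ.+-identityˡ _) (count-even n))) refl)

  Even≡ : ℤ → Set
  Even≡ x = Σ[ y ∈ ℤ ] x ≡ + 2 ℤ.* y

  ∑-even : ∀ {A : Set} (xs : List A) g → (∀ x → x ∈ xs → Even≡ (g x)) → Even≡ (∑ xs g)
  ∑-even []       g h = + 0 , refl
  ∑-even (x ∷ xs) g h with h x (here refl) | ∑-even xs g (λ y y∈ → h y (there y∈))
  ... | u , gx | v , gxs = u ℤ.+ v , trans (cong₂ ℤ._+_ gx gxs) (sym (ℤₚ.*-distribˡ-+ (+ 2) u v))

  ∑-neg : ∀ {A : Set} (xs : List A) g → ∑ xs (λ x → - g x) ≡ - ∑ xs g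
  ∑-neg []       g = refl
  ∑-neg (x ∷ xs) g = trans (cong (ℤ._+_ (- g x)) (∑-neg xs g)) (sym (ℤₚ.neg-distrib-+ (g x) (∑ xs g)))

  ℤ-even≢odd : ∀ x y → ¬ (+ 2 ℤ.* x ≡ + 1 ℤ.+ + 2 ℤ.* y)
  ℤ-even≢odd x y e = even≢odd-1 ∣x-y∣ (trans (sym (ℤₚ.abs-* (+ 2) (x ℤ.- y)))
      (cong ℤ.∣_∣ (trans (lemma x y) (trans (cong (ℤ._- + 2 ℤ.* y) e) (lemma′ (+ 2 ℤ.* y))))))
    where
    ∣x-y∣ = ℤ.∣ x ℤ.- y ∣
    lemma : ∀ x y → + 2 ℤ.* (x ℤ.- y) ≡ + 2 ℤ.* x ℤ.- + 2 ℤ.* y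
    lemma = ℤ-Solver.solve-∀
    lemma′ : ∀ z → + 1 ℤ.+ z ℤ.- z ≡ + 1
    lemma′ = ℤ-Solver.solve-∀
    even≢odd-1 : ∀ n → ¬ (2 ℕ.* n ≡ 1)
    even≢odd-1 n e = even≢odd n 0 e

  -- Even and odd parts of the Walsh sums, and Parseval

  module _ (N k : ℕ) (N≡ : N ≡ 1 ℕ.+ 2 ℕ.* k) (f : Fin (2 ℕ.* N) → Fin (2 ℕ.* N)) where
    private
      q Q P : ℕ
      q = 2 ℕ.* N
      Q = q ∸ 1
      -- P = Q - 1 in a form that shows Q to be odd: (-1)ⁿ does not change when n is multiplied by
      -- Q.
      P = 2 ℕ.* (2 ℕ.* k)

      Q≡ : Q ≡ 1 ℕ.+ P
      Q≡ = trans (cong (λ n → 2 ℕ.* n ∸ 1) N≡) (cong (_∸ 1) (ℕₚ.*-suc 2 (2 ℕ.* k)))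

      1+Q≡q : 1 ℕ.+ Q ≡ q
      1+Q≡q = trans (cong suc Q≡) (trans (sym (ℕₚ.*-suc 2 (2 ℕ.* k))) (cong (2 ℕ.*_) (sym N≡)))

      instance
        N≢0 : NonZero N
        N≢0 = subst NonZero (sym N≡) _

      exponent : ℕ → Fin q → ℕ
      exponent n x = toℕ (f x) ℕ.+ Q ℕ.* (n ℕ.* toℕ x)

      monomials : (Fin q → ℕ) → Poly
      monomials u = sumP (map (λ x → X^ (u x)) (allFin q))

      walsh walsh* : ℕ → Poly
      walsh  n = monomials (exponent n)
      walsh* n = monomials (λ x → Q ℕ.* exponent n x)

      part : (ℕ → ℤ) → (Fin q → ℕ) → Poly
      part w u = sumP (map (λ x → map (w (toℕ x) ℤ.*_) (X^ (u x))) (allFin q))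

      pair-monomials : ∀ u F → ⟨ monomials u ∣ F ⟩ ≡ ∑ (allFin q) (λ x → F (u x))
      pair-monomials u F = trans (pair-sumP (λ x → X^ (u x)) (allFin q) F)
          (∑-cong (allFin q) (λ x _ → pair-X^ (u x) F))

      pair-part : ∀ w u F → ⟨ part w u ∣ F ⟩ ≡ ∑ (allFin q) (λ x → w (toℕ x) ℤ.* F (u x))
      pair-part w u F = trans (pair-sumP (λ x → map (w (toℕ x) ℤ.*_) (X^ (u x))) (allFin q) F)
        (∑-cong (allFin q) (λ x _ → trans (pair-scale (w (toℕ x)) (X^ (u x)) F)
            (cong (w (toℕ x) ℤ.*_) (pair-X^ (u x) F))))

      monomials≈ : ∀ {m} u → monomials u ≈ part [even] u +P part [odd] u [mod m ]
      monomials≈ u = tested λ F _ → begin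
        ⟨ monomials u ∣ F ⟩ ≡⟨ pair-monomials u F ⟩
        ∑ (allFin q) (λ x → F (u x)) ≡⟨ ∑-cong (allFin q) (λ x _ → even+odd (toℕ x) (F (u x))) ⟩
        ∑ (allFin q) (λ x → [even] (toℕ x) ℤ.* F (u x) ℤ.+ [odd] (toℕ x) ℤ.* F (u x)) ≡⟨ ∑-+ (allFin q) _ _ ⟩
        ∑ (allFin q) (λ x → [even] (toℕ x) ℤ.* F (u x)) ℤ.+ ∑ (allFin q) (λ x → [odd] (toℕ x) ℤ.* F (u x))
          ≡⟨ cong₂ ℤ._+_ (pair-part [even] u F) (pair-part [odd] u F) ⟨
        ⟨ part [even] u ∣ F ⟩ ℤ.+ ⟨ part [odd] u ∣ F ⟩ ≡⟨ pair-+ (part [even] u) (part [odd] u) F ⟨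
        ⟨ part [even] u +P part [odd] u ∣ F ⟩ ∎

      twisted≈ : ∀ {m} u v → (∀ F → Recurrence m F → ∀ x → F (v x) ≡ flip (toℕ x) (F (u x))) →
        monomials v ≈ part [even] u -P part [odd] u [mod m ]
      twisted≈ u v twist = tested λ F r → begin
        ⟨ monomials v ∣ F ⟩ ≡⟨ pair-monomials v F ⟩
        ∑ (allFin q) (λ x → F (v x)) ≡⟨ ∑-cong (allFin q)
            (λ x _ → trans (twist F r x) (even-odd (toℕ x) (F (u x)))) ⟩
        ∑ (allFin q) (λ x → [even] (toℕ x) ℤ.* F (u x) ℤ.+ - ([odd] (toℕ x) ℤ.* F (u x))) ≡⟨ ∑-+
            (allFin q) _ _ ⟩
        ∑ (allFin q) (λ x → [even] (toℕ x) ℤ.* F (u x)) ℤ.+ ∑ (allFin q) (λ x → - ([odd] (toℕ x) ℤ.* F (u x)))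
          ≡⟨ cong₂ ℤ._+_ (sym (pair-part [even] u F))
              (trans (∑-neg (allFin q) _) (cong -_ (sym (pair-part [odd] u F)))) ⟩
        ⟨ part [even] u ∣ F ⟩ ℤ.+ - ⟨ part [odd] u ∣ F ⟩ ≡⟨ cong (ℤ._+_ ⟨ part [even] u ∣ F ⟩)
            (pair-neg (part [odd] u) F) ⟨
        ⟨ part [even] u ∣ F ⟩ ℤ.+ ⟨ negP (part [odd] u) ∣ F ⟩ ≡⟨ pair-+ (part [even] u)
            (negP (part [odd] u)) F ⟨
        ⟨ part [even] u -P part [odd] u ∣ F ⟩ ∎

      flip-Q : ∀ x y → flip (x ℕ.* Q) y ≡ flip x y
      flip-Q x y = trans (cong (λ Q → flip (x ℕ.* Q) y) Q≡) (flip-*-odd x (2 ℕ.* k) y)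

      -- Replacing λ by λ + N adds xQN to the exponent. As ζᴺ = -1 and Q is odd, the sign is (-1)ˣ.
      twist : ∀ {F} → Antiperiodic N F → ∀ n x → F (exponent (n ℕ.+ N) x) ≡ flip (toℕ x) (F (exponent n x))
      twist {F} anti n x = trans (cong F (lemma (toℕ (f x)) Q n N (toℕ x)))
        (trans (antiperiodic-* {F = F} anti (toℕ x ℕ.* Q) (exponent n x)) (flip-Q (toℕ x) _))
        where
        lemma : ∀ c Q n N x → c ℕ.+ Q ℕ.* ((n ℕ.+ N) ℕ.* x) ≡ c ℕ.+ Q ℕ.* (n ℕ.* x) ℕ.+ x ℕ.* Q ℕ.* N
        lemma = ℕ-Solver.solve-∀

      -- Here the exponent grows by xQ²N, and Q² is odd as well.
      twist* : ∀ {F} → Antiperiodic N F → ∀ n x → F (Q ℕ.* exponent (n ℕ.+ N) x) ≡ flip (toℕ x)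
          (F (Q ℕ.* exponent n x))
      twist* {F} anti n x = trans (cong F (lemma (toℕ (f x)) Q n N (toℕ x)))
        (trans (antiperiodic-* {F = F} anti (toℕ x ℕ.* Q ℕ.* Q) (Q ℕ.* exponent n x))
            (trans (flip-Q (toℕ x ℕ.* Q) _) (flip-Q (toℕ x) _)))
        where
        lemma : ∀ c Q n N x → Q ℕ.* (c ℕ.+ Q ℕ.* ((n ℕ.+ N) ℕ.* x)) ≡ Q ℕ.*
            (c ℕ.+ Q ℕ.* (n ℕ.* x)) ℕ.+ x ℕ.* Q ℕ.* Q ℕ.* N
        lemma = ℕ-Solver.solve-∀

      A A* : ℕ → Poly
      A  n = part [even] (exponent n)
      A* n = part [even] (λ x → Q ℕ.* exponent n x)

      even-A : ∀ {m} → (∀ F → Recurrence m F → Antiperiodic N F) →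
          (∀ z → Even[mod m ] (z *P z) → Even[mod m ] z) →
        ∀ n → walsh n *P walsh* n ≈ constP (+ q) [mod m ] → walsh (n ℕ.+ N) *P walsh* (n ℕ.+ N) ≈ constP
            (+ q) [mod m ] →
        Even[mod m ] (A n *P A* n)
      even-A {m} anti reduced n h h′ = even-product reduced {A n} {A* n} {B} {B*} (constP (+ k))
        (≈.trans (≈.sym (≈.*-cong {walsh n} {A n +P B} {walsh* n} {A* n +P B*} (monomials≈ (exponent n))
            (monomials≈ (λ x → Q ℕ.* exponent n x)))) (≈.trans h q≈))
        (≈.trans (≈.sym (≈.*-cong {walsh (n ℕ.+ N)} {A n -P B} {walsh* (n ℕ.+ N)} {A* n -P B*}
          (twisted≈ (exponent n) (exponent (n ℕ.+ N)) (λ F r → twist {F} (anti F r) n))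
          (twisted≈ (λ x → Q ℕ.* exponent n x) (λ x → Q ℕ.* exponent (n ℕ.+ N) x)
              (λ F r → twist* {F} (anti F r) n)))) (≈.trans h′ q≈))
        where
        module ≈ = CommutativeRing (quotientRing m)
        B B* : Poly
        B  = part [odd] (exponent n)
        B* = part [odd] (λ x → Q ℕ.* exponent n x)
        q≈ : constP (+ q) ≈ 2· (constP (+ 1) +P 2· (constP (+ k))) [mod m ]
        q≈ = ≈.reflexive (cong constP (trans (cong (λ n → + (2 ℕ.* n)) N≡)
          (trans (ℤₚ.pos-* 2 (1 ℕ.+ 2 ℕ.* k)) (trans (cong (λ z → + 2 ℤ.* (+ 1 ℤ.+ z)) (ℤₚ.pos-* 2 k))
              (lemma (+ k))))))
          where
          lemma : ∀ k → + 2 ℤ.* (+ 1 ℤ.+ + 2 ℤ.* k) ≡ + 2 ℤ.* (+ 1 ℤ.+ (+ 2 ℤ.* k ℤ.+ + 0)) ℤ.+ + 0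
          lemma = ℤ-Solver.solve-∀

      -- `orthogonal` is the vanishing of the sum of the powers ζ^(2ej) over j < N, seen through the
      -- functional F.
      module Parseval {F : ℕ → ℤ} (anti : Antiperiodic N F)
        (orthogonal : ∀ e → ¬ N ∣ e → ∀ n → ∑ (upTo N) (λ j → F (n ℕ.+ j ℕ.* (2 ℕ.* e))) ≡ + 0) where

        inner : Fin q → Fin q → ℤ
        inner x y = ∑ (upTo N) (λ n → F (exponent n x ℕ.+ Q ℕ.* exponent n y))

        half : ∀ {x} (s : ℕ) → toℕ {q} x ≡ 2 ℕ.* s → s ℕ.< N
        half {x} s e = ℕₚ.*-cancelˡ-< 2 s N (subst (ℕ._< q) e (Finₚ.toℕ<n x))

        -- For even x and y the parameter n enters only through ζ^(2en), with e = Q(s + Qt) ≡ t - s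
        -- modulo N. Hence N values of n already give orthogonality.
        combined : ∀ n x y s t → toℕ x ≡ 2 ℕ.* s → toℕ y ≡ 2 ℕ.* t → exponent n x ℕ.+ Q ℕ.* exponent n y ≡
          (toℕ (f x) ℕ.+ Q ℕ.* toℕ (f y)) ℕ.+ n ℕ.* (2 ℕ.* (Q ℕ.* (s ℕ.+ Q ℕ.* t)))
        combined n x y s t ex ey = trans (cong₂
            (λ i j → toℕ (f x) ℕ.+ Q ℕ.* (n ℕ.* i) ℕ.+ Q ℕ.* (toℕ (f y) ℕ.+ Q ℕ.* (n ℕ.* j))) ex ey)
          (lemma (toℕ (f x)) (toℕ (f y)) Q n s t)
          where
          lemma : ∀ c d Q n s t → c ℕ.+ Q ℕ.* (n ℕ.* (2 ℕ.* s)) ℕ.+ Q ℕ.* (d ℕ.+ Q ℕ.* (n ℕ.* (2 ℕ.* t))) ≡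
            (c ℕ.+ Q ℕ.* d) ℕ.+ n ℕ.* (2 ℕ.* (Q ℕ.* (s ℕ.+ Q ℕ.* t)))
          lemma = ℕ-Solver.solve-∀

        -- Modulo N, Q is -1, so s + Q(s + Qt) ≡ t; if N divides the second summand, s and t are
        -- congruent, and both lie below N.
        distinct : ∀ s t → s ℕ.< N → t ℕ.< N → N ∣ Q ℕ.* (s ℕ.+ Q ℕ.* t) → s ≡ t
        distinct s t s<N t<N (divides E e) = begin
          s                              ≡⟨ m<n⇒m%n≡m s<N ⟨
          s % N                          ≡⟨ [m+kn]%n≡m%n s E N ⟨
          (s ℕ.+ E ℕ.* N) % N            ≡⟨ cong (_% N) same ⟩
          (t ℕ.+ M ℕ.* N) % N            ≡⟨ [m+kn]%n≡m%n t M N ⟩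
          t % N                          ≡⟨ m<n⇒m%n≡m t<N ⟩
          t                              ∎
          where
          M = 2 ℕ.* (s ℕ.+ P ℕ.* t)
          lemma : ∀ s t P → s ℕ.+ (1 ℕ.+ P) ℕ.* (s ℕ.+ (1 ℕ.+ P) ℕ.* t) ≡ t ℕ.+ (s ℕ.+ P ℕ.* t) ℕ.*
              (1 ℕ.+ (1 ℕ.+ P))
          lemma = ℕ-Solver.solve-∀
          lemma′ : ∀ x N → x ℕ.* (2 ℕ.* N) ≡ 2 ℕ.* x ℕ.* N
          lemma′ = ℕ-Solver.solve-∀
          same : s ℕ.+ E ℕ.* N ≡ t ℕ.+ M ℕ.* N
          same = begin
            s ℕ.+ E ℕ.* N                                    ≡⟨ cong (s ℕ.+_) e ⟨
            s ℕ.+ Q ℕ.* (s ℕ.+ Q ℕ.* t)                      ≡⟨ cong (λ Q → s ℕ.+ Q ℕ.* (s ℕ.+ Q ℕ.* t)) Q≡ ⟩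
            s ℕ.+ (1 ℕ.+ P) ℕ.* (s ℕ.+ (1 ℕ.+ P) ℕ.* t)      ≡⟨ lemma s t P ⟩
            t ℕ.+ (s ℕ.+ P ℕ.* t) ℕ.* (1 ℕ.+ (1 ℕ.+ P))      ≡⟨ cong (λ z → t ℕ.+ (s ℕ.+ P ℕ.* t) ℕ.* z)
                (trans (cong suc (sym Q≡)) 1+Q≡q) ⟩
            t ℕ.+ (s ℕ.+ P ℕ.* t) ℕ.* (2 ℕ.* N)              ≡⟨ cong (t ℕ.+_) (lemma′ (s ℕ.+ P ℕ.* t) N) ⟩
            t ℕ.+ M ℕ.* N                                    ∎

        inner-off : ∀ x y s t → toℕ x ≡ 2 ℕ.* s → toℕ y ≡ 2 ℕ.* t → x ≢ y → inner x y ≡ + 0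
        inner-off x y s t ex ey x≢y = trans
          (∑-cong (upTo N) (λ n _ → cong F (combined n x y s t ex ey)))
          (orthogonal (Q ℕ.* (s ℕ.+ Q ℕ.* t)) (λ N∣e → x≢y (Finₚ.toℕ-injective
            (trans ex (trans (cong (2 ℕ.*_) (distinct s t (half {x} s ex) (half {y} t ey) N∣e))
                (sym ey))))) (toℕ (f x) ℕ.+ Q ℕ.* toℕ (f y)))

        -- An exponent plus Q times itself is a multiple of q = 2N, where the two signs cancel.
        inner-diagonal : ∀ x → inner x x ≡ + N ℤ.* F 0
        inner-diagonal x = trans (∑-cong (upTo N) (λ n _ → multiple n)) (∑-const N (F 0))
          where
          lemma : ∀ u N → u ℕ.* (2 ℕ.* N) ≡ 0 ℕ.+ (u ℕ.+ u) ℕ.* N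
          lemma = ℕ-Solver.solve-∀
          multiple : ∀ n → F (exponent n x ℕ.+ Q ℕ.* exponent n x) ≡ F 0
          multiple n = trans (cong F (trans (cong (exponent n x ℕ.+_) (ℕₚ.*-comm Q _))
              (trans (sym (ℕₚ.*-suc (exponent n x) Q))
              (trans (cong (exponent n x ℕ.*_) 1+Q≡q) (lemma (exponent n x) N)))))
            (trans (antiperiodic-* {F = F} anti (exponent n x ℕ.+ exponent n x) 0)
                (flip-double (exponent n x) (F 0)))

        inner-sum : ∀ x → [even] (toℕ x) ℤ.* ∑ (allFin q) (λ y → [even] (toℕ y) ℤ.* inner x y) ≡
            (+ N ℤ.* F 0) ℤ.* [even] (toℕ x)
        inner-sum x with parity (toℕ x)
        ... | s , inj₂ ex = trans (cong (ℤ._* ∑ (allFin q) (λ y → [even] (toℕ y) ℤ.* inner x y)) zero-x)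
            (sym (trans (cong ((+ N ℤ.* F 0) ℤ.*_) zero-x) (ℤₚ.*-zeroʳ (+ N ℤ.* F 0))))
          where zero-x = trans (cong [even] ex) ([even]-odd s)
        ... | s , inj₁ ex = trans (cong₂ ℤ._*_ one-x
            (trans (∑-supported (λ y → [even] (toℕ y) ℤ.* inner x y) (Unique.allFin⁺ q) (∈-allFin x) off)
                  (trans (cong₂ ℤ._*_ one-x (inner-diagonal x)) (ℤₚ.*-identityˡ (+ N ℤ.* F 0)))))
                (trans (ℤₚ.*-comm (+ 1) (+ N ℤ.* F 0)) (cong ((+ N ℤ.* F 0) ℤ.*_) (sym one-x)))
          where
          one-x = trans (cong [even] ex) ([even]-double s)
          off : ∀ y → x ≢ y → [even] (toℕ y) ℤ.* inner x y ≡ + 0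
          off y x≢y with parity (toℕ y)
          ... | t , inj₁ ey = trans (cong ([even] (toℕ y) ℤ.*_) (inner-off x y s t ex ey x≢y))
              (ℤₚ.*-zeroʳ ([even] (toℕ y)))
          ... | t , inj₂ ey = cong (ℤ._* inner x y) (trans (cong [even] ey) ([even]-odd t))

        -- After interchanging the sums only the pairs x = y with x even survive; there are N of
        -- them, each contributing `+ N ℤ.* F 0`.
        parseval : ∑ (upTo N) (λ n → ⟨ A n *P A* n ∣ F ⟩) ≡ (+ N ℤ.* F 0) ℤ.* + N
        parseval = begin
          ∑ (upTo N) (λ n → ⟨ A n *P A* n ∣ F ⟩)
            ≡⟨ ∑-cong (upTo N) (λ n _ → trans (pair-* (A n) (A* n) F) (trans (pair-part [even] (exponent n) _)
                 (∑-cong (allFin q) (λ x _ → cong (w x ℤ.*_)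
                     (pair-part [even] (λ y → Q ℕ.* exponent n y) (shift (exponent n x) F)))))) ⟩
          ∑ (upTo N) (λ n → ∑ (allFin q) (λ x → w x ℤ.* ∑ (allFin q) (λ y → w y ℤ.* E n x y)))
            ≡⟨ ∑-swap (upTo N) (allFin q) (λ n x → w x ℤ.* ∑ (allFin q) (λ y → w y ℤ.* E n x y)) ⟩
          ∑ (allFin q) (λ x → ∑ (upTo N) (λ n → w x ℤ.* ∑ (allFin q) (λ y → w y ℤ.* E n x y)))
            ≡⟨ ∑-cong (allFin q) (λ x _ → trans
                (∑-* (upTo N) (w x) (λ n → ∑ (allFin q) (λ y → w y ℤ.* E n x y))) (cong (w x ℤ.*_)
                 (trans (∑-swap (upTo N) (allFin q) (λ n y → w y ℤ.* E n x y))
                     (∑-cong (allFin q) (λ y _ → ∑-* (upTo N) (w y) (λ n → E n x y)))))) ⟩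
          ∑ (allFin q) (λ x → w x ℤ.* ∑ (allFin q) (λ y → w y ℤ.* inner x y)) ≡⟨ ∑-cong (allFin q)
              (λ x _ → inner-sum x) ⟩
          ∑ (allFin q) (λ x → (+ N ℤ.* F 0) ℤ.* w x) ≡⟨ ∑-* (allFin q) (+ N ℤ.* F 0) w ⟩
          (+ N ℤ.* F 0) ℤ.* ∑ (allFin q) w ≡⟨ cong ((+ N ℤ.* F 0) ℤ.*_)
              (trans (∑-allFin q [even]) (count-even N)) ⟩
          (+ N ℤ.* F 0) ℤ.* + N ∎
          where
          w : Fin q → ℤ
          w x = [even] (toℕ x)
          E : ℕ → Fin q → Fin q → ℤ
          E n x y = F (exponent n x ℕ.+ Q ℕ.* exponent n y)

    not-bent-mod : ∀ {m} → (∀ F → Recurrence m F → Antiperiodic N F) →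
        (∀ z → Even[mod m ] (z *P z) → Even[mod m ] z) →
      (F : ℕ → ℤ) → Recurrence m F → F 0 ≡ + 1 →
      (∀ e → ¬ N ∣ e → ∀ n → ∑ (upTo N) (λ j → F (n ℕ.+ j ℕ.* (2 ℕ.* e))) ≡ + 0) →
      ¬ (∀ l → walshSum (2 ℕ.* N) f l *P walshSumConj (2 ℕ.* N) f l -P constP (+ (2 ℕ.* N)) ≈ [] [mod m ])
    not-bent-mod {m} anti reduced F r F0 orthogonal bent = contradict
      (∑-even (upTo N) (λ n → ⟨ A n *P A* n ∣ F ⟩) (λ n n∈ → even-at n (∈-upTo⁻ n∈)))
      where
      module ≈ = CommutativeRing (quotientRing m)
      open QuotientSolver m
      at : ∀ n → n ℕ.< q → walsh n *P walsh* n ≈ constP (+ q) [mod m ]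
      at n n<q = subst (λ n → walsh n *P walsh* n ≈ constP (+ q) [mod m ]) (Finₚ.toℕ-fromℕ< n<q)
        (≈.trans (solve 2 (λ x y → x := x :- y :+ y) ≈.refl (walshSum q f l *P walshSumConj q f l)
            (constP (+ q)))
          (≈.+-cong {y = []} (bent l) (≈.refl {constP (+ q)})))
        where l = fromℕ< n<q
      even-at : ∀ n → n ℕ.< N → Even≡ ⟨ A n *P A* n ∣ F ⟩
      even-at n n<N = ⟨ y ∣ F ⟩ , trans (test y≈ F r)
          (trans (pair-* (constP (+ 2)) y F) (pair-const (+ 2) (λ n → ⟨ y ∣ shift n F ⟩)))
        where
        n<q : n ℕ.< q
        n<q = ℕₚ.<-≤-trans n<N (ℕₚ.m≤m+n N _)
        n+N<q : n ℕ.+ N ℕ.< q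
        n+N<q = subst (n ℕ.+ N ℕ.<_) (cong (N ℕ.+_) (sym (ℕₚ.+-identityʳ N))) (ℕₚ.+-monoˡ-< N n<N)
        half = even-A anti reduced n (at n n<q) (at (n ℕ.+ N) n+N<q)
        y = proj₁ half
        y≈ = proj₂ half
      contradict : ¬ Even≡ (∑ (upTo N) (λ n → ⟨ A n *P A* n ∣ F ⟩))
      -- N² = (1 + 2k)² = 1 + 2(2k² + 2k).
      contradict (y , e) = ℤ-even≢odd y (+ 2 ℤ.* + k ℤ.* + k ℤ.+ + 2 ℤ.* + k)
          (trans (sym e) (trans (Parseval.parseval {F} (anti F r) orthogonal)
        (trans (cong₂ (λ z N → (+ N ℤ.* z) ℤ.* + N) F0 N≡)
            (trans (cong (λ z → (z ℤ.* + 1) ℤ.* z) (cong (ℤ._+_ (+ 1)) (ℤₚ.pos-* 2 k))) (lemma (+ k))))))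
        where
        lemma : ∀ k → (+ 1 ℤ.+ + 2 ℤ.* k) ℤ.* + 1 ℤ.* (+ 1 ℤ.+ + 2 ℤ.* k) ≡ + 1 ℤ.+ + 2 ℤ.*
            (+ 2 ℤ.* k ℤ.* k ℤ.+ + 2 ℤ.* k)
        lemma = ℤ-Solver.solve-∀

  -- Sums over the multiples of 2e

  Invariant : ℕ → (ℕ → ℤ) → Set
  Invariant c T = ∀ n → T (n ℕ.+ c) ≡ T n

  invariant-* : ∀ {c T} k → Invariant c T → Invariant (k ℕ.* c) T
  invariant-* {c} {T} zero    inv n = cong T (ℕₚ.+-identityʳ n)
  invariant-* {c} {T} (suc k) inv n = trans (cong T (sym (ℕₚ.+-assoc n c (k ℕ.* c))))
      (trans (invariant-* {T = T} k inv (n ℕ.+ c)) (inv n))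

  invariant-∣ : ∀ {c d T} → c ∣ d → Invariant c T → Invariant d T
  invariant-∣ {T = T} (divides k refl) inv = invariant-* {T = T} k inv

  invariant-difference : ∀ {c d g T} x y → Invariant c T → Invariant d T → g ℕ.+ y ℕ.* d ≡ x ℕ.* c →
      Invariant g T
  invariant-difference {c} {d} {g} {T} x y inv inv′ e n = begin
    T (n ℕ.+ g)                    ≡⟨ invariant-* {T = T} y inv′ (n ℕ.+ g) ⟨
    T (n ℕ.+ g ℕ.+ y ℕ.* d)        ≡⟨ cong T (trans (ℕₚ.+-assoc n g _) (cong (n ℕ.+_) e)) ⟩
    T (n ℕ.+ x ℕ.* c)              ≡⟨ invariant-* {T = T} x inv n ⟩
    T n                            ∎

  antiperiodic⇒invariant : ∀ {N F} → Antiperiodic N F → Invariant (2 ℕ.* N) F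
  antiperiodic⇒invariant {N} {F} anti n = trans (antiperiodic-* {F = F} anti 2 n) (ℤₚ.neg-involutive (F n))

  module _ (N e : ℕ) (F : ℕ → ℤ) (periodic : Invariant (2 ℕ.* N) F) where
    orbitSum : ℕ → ℤ
    orbitSum n = ∑ (upTo N) (λ j → F (n ℕ.+ j ℕ.* (2 ℕ.* e)))

    -- Shifting by 2e moves each term to the next, and the last returns to the first because 2eN is
    -- a multiple of the period 2N. Shifting by 2N fixes every term. Bézout combines the two
    -- periods.
    orbitSum-gcd : Invariant (2 ℕ.* gcd e N) orbitSum
    orbitSum-gcd = bezout (Bézout.identity (gcd-GCD e N))
      where
      step : Invariant (2 ℕ.* e) orbitSum
      step n = ∙-cancelʳ (G 0) _ _ (begin
        orbitSum (n ℕ.+ 2 ℕ.* e) ℤ.+ G 0 ≡⟨ cong (ℤ._+ G 0)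
            (∑-cong (upTo N) (λ j _ → cong F (ℕₚ.+-assoc n (2 ℕ.* e) _))) ⟩
        ∑ (upTo N) (λ j → G (suc j)) ℤ.+ G 0 ≡⟨ ∑-upTo-suc N G ⟩
        orbitSum n ℤ.+ G N ≡⟨ cong (ℤ._+_ (orbitSum n)) wrap ⟩
        orbitSum n ℤ.+ G 0 ∎)
        where
        G : ℕ → ℤ
        G j = F (n ℕ.+ j ℕ.* (2 ℕ.* e))
        lemma : ∀ N e → N ℕ.* (2 ℕ.* e) ≡ e ℕ.* (2 ℕ.* N)
        lemma = ℕ-Solver.solve-∀
        wrap : G N ≡ G 0
        wrap = trans (cong (λ k → F (n ℕ.+ k)) (lemma N e))
            (trans (invariant-* {T = F} e periodic n) (cong F (sym (ℕₚ.+-identityʳ n))))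

      around : Invariant (2 ℕ.* N) orbitSum
      around n = ∑-cong (upTo N) (λ j _ → trans (cong F (swap n (2 ℕ.* N) (j ℕ.* (2 ℕ.* e))))
          (periodic (n ℕ.+ j ℕ.* (2 ℕ.* e))))
        where
        swap : ∀ x y z → x ℕ.+ y ℕ.+ z ≡ x ℕ.+ z ℕ.+ y
        swap = ℕ-Solver.solve-∀

      double : ∀ g x y u v → g ℕ.+ y ℕ.* v ≡ x ℕ.* u → 2 ℕ.* g ℕ.+ y ℕ.* (2 ℕ.* v) ≡ x ℕ.* (2 ℕ.* u)
      double g x y u v e = trans (lemma g y v) (trans (cong (2 ℕ.*_) e) (lemma′ x u))
        where
        lemma : ∀ g y v → 2 ℕ.* g ℕ.+ y ℕ.* (2 ℕ.* v) ≡ 2 ℕ.* (g ℕ.+ y ℕ.* v)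
        lemma = ℕ-Solver.solve-∀
        lemma′ : ∀ x u → 2 ℕ.* (x ℕ.* u) ≡ x ℕ.* (2 ℕ.* u)
        lemma′ = ℕ-Solver.solve-∀

      bezout : Bézout.Identity (gcd e N) e N → Invariant (2 ℕ.* gcd e N) orbitSum
      bezout (Bézout.+- x y eq) = invariant-difference {T = orbitSum} x y step around (double _ x y e N eq)
      bezout (Bézout.-+ x y eq) = invariant-difference {T = orbitSum} y x around step (double _ y x N e eq)

    -- Averaging: p times the orbit sum is its sum over p shifts by h, and after interchanging the
    -- sums each inner sum is one of the vanishing sums of `coset`.
    orbitSum≡0 : ∀ p .{{_ : NonZero p}} h → Invariant h orbitSum →
        (∀ n → ∑ (upTo p) (λ i → F (n ℕ.+ i ℕ.* h)) ≡ + 0) →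
      ∀ n → orbitSum n ≡ + 0
    orbitSum≡0 p@(suc _) h inv coset n = [ (λ ()) , (λ z → z) ]′ (ℤₚ.i*j≡0⇒i≡0∨j≡0 (+ p) (begin
      + p ℤ.* orbitSum n ≡⟨ ∑-const p (orbitSum n) ⟨
      ∑ (upTo p) (λ _ → orbitSum n) ≡⟨ ∑-cong (upTo p) (λ i _ → invariant-* {T = orbitSum} i inv n) ⟨
      ∑ (upTo p) (λ i → orbitSum (n ℕ.+ i ℕ.* h)) ≡⟨ ∑-swap (upTo p) (upTo N)
          (λ i j → F (n ℕ.+ i ℕ.* h ℕ.+ j ℕ.* (2 ℕ.* e))) ⟩
      ∑ (upTo N) (λ j → ∑ (upTo p) (λ i → F (n ℕ.+ i ℕ.* h ℕ.+ j ℕ.* (2 ℕ.* e))))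
        ≡⟨ ∑-cong (upTo N) (λ j _ → trans (∑-cong (upTo p)
            (λ i _ → cong F (swap n (i ℕ.* h) (j ℕ.* (2 ℕ.* e))))) (coset (n ℕ.+ j ℕ.* (2 ℕ.* e)))) ⟩
      ∑ (upTo N) (λ _ → + 0) ≡⟨ ∑-0 (upTo N) ⟩
      + 0 ∎))
      where
      swap : ∀ x y z → x ℕ.+ y ℕ.+ z ≡ x ℕ.+ z ℕ.+ y
      swap = ℕ-Solver.solve-∀

  -- The two alternatives to g = N are divisibility of N/3 and of N/7 by g: a proper divisor lacks a
  -- factor 3 or a factor 7.
  properDivisor-split : ∀ a b {g} → g ∣ 3 ℕ.^ suc a ℕ.* 7 ℕ.^ suc b →
    g ≡ 3 ℕ.^ suc a ℕ.* 7 ℕ.^ suc b ⊎ g ∣ 7 ℕ.* (3 ℕ.^ a ℕ.* 7 ℕ.^ b) ⊎ g ∣ 3 ℕ.* (3 ℕ.^ a ℕ.* 7 ℕ.^ b)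
  properDivisor-split a b {g} g∣N with divisor-split prime-3 (suc a) (7 ℕ.^ suc b) g∣N
  ... | i , g′ , i≤ , g′∣ , refl with divisor-split prime-7 (suc b) 1
      (subst (g′ ∣_) (sym (ℕₚ.*-identityʳ (7 ℕ.^ suc b))) g′∣)
  ...   | j , u , j≤ , u∣1 , refl with ∣.∣1⇒≡1 u∣1
  ...     | refl with ℕₚ.m≤n⇒m<n∨m≡n i≤ | ℕₚ.m≤n⇒m<n∨m≡n j≤
  ...       | inj₁ i<  | _         = inj₂ (inj₁
      (subst (3 ℕ.^ i ℕ.* (7 ℕ.^ j ℕ.* 1) ∣_) (lemma (3 ℕ.^ a) (7 ℕ.^ b))
      (∣.*-pres-∣ (power-∣ 3 (ℕₚ.≤-pred i<)) g′∣)))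
    where
    lemma : ∀ x y → x ℕ.* (7 ℕ.* y) ≡ 7 ℕ.* (x ℕ.* y)
    lemma = ℕ-Solver.solve-∀
  ...       | inj₂ refl | inj₁ j<   = inj₂ (inj₂
      (subst (3 ℕ.^ suc a ℕ.* (7 ℕ.^ j ℕ.* 1) ∣_) (ℕₚ.*-assoc 3 (3 ℕ.^ a) (7 ℕ.^ b))
      (∣.*-pres-∣ (∣.∣-refl {3 ℕ.^ suc a}) (subst (_∣ 7 ℕ.^ b) (sym (ℕₚ.*-identityʳ (7 ℕ.^ j)))
          (power-∣ 7 (ℕₚ.≤-pred j<))))))
  ...       | inj₂ refl | inj₂ refl = inj₁ (cong (3 ℕ.^ suc a ℕ.*_) (ℕₚ.*-identityʳ (7 ℕ.^ suc b)))

  -- Computations with the 42nd cyclotomic polynomial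

  -- The quotient serves only as a certificate: the check is that it multiplies back to p.
  multiple≈0 : ∀ m p → True (All.all? (ℤₚ._≟ + 0) (p -P quotP p m *P m)) → p ≈ [] [mod m ]
  multiple≈0 m p h = ≈.trans (≈-exact (≈-computed p (quotP p m *P m) h))
    (≈.trans (≈.*-cong (≈.refl {quotP p m}) (modulus≈0 m)) (≈.zeroʳ (quotP p m)))
    where module ≈ = CommutativeRing (quotientRing m)

  -- A recurrence for p(x^K) does not mix residue classes modulo K. This reduces statements about
  -- Φ₄₂(x^K) to Φ₄₂.
  recurrence-sample : ∀ K .{{_ : NonZero K}} p {F} → Recurrence (expand K p) F → ∀ n → Recurrence p
      (λ k → F (n ℕ.+ k ℕ.* K))
  recurrence-sample K p {F} r n j = begin
    ⟨ p ∣ (λ i → F (n ℕ.+ (j ℕ.+ i) ℕ.* K)) ⟩ ≡⟨ pair-cong p (λ i → cong F (lemma n j i K)) ⟩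
    ⟨ p ∣ (λ i → F (n ℕ.+ j ℕ.* K ℕ.+ i ℕ.* K)) ⟩ ≡⟨ pair-expand K p (shift (n ℕ.+ j ℕ.* K) F) ⟨
    ⟨ expand K p ∣ shift (n ℕ.+ j ℕ.* K) F ⟩ ≡⟨ r (n ℕ.+ j ℕ.* K) ⟩
    + 0 ∎
    where
    lemma : ∀ n j i K → n ℕ.+ (j ℕ.+ i) ℕ.* K ≡ n ℕ.+ j ℕ.* K ℕ.+ i ℕ.* K
    lemma = ℕ-Solver.solve-∀

  module _ (K : ℕ) .{{_ : NonZero K}} {F : ℕ → ℤ} (r : Recurrence (expand K (Φ₂₁ 1)) F) where

    -- Φ₄₂ divides x²¹ + 1.
    recurrence-antiperiodic : Antiperiodic (21 ℕ.* K) F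
    recurrence-antiperiodic n = ℤₚ.i-j≡0⇒i≡j (F (n ℕ.+ 21 ℕ.* K)) (- F n) (begin
      F (n ℕ.+ 21 ℕ.* K) ℤ.+ - - F n ≡⟨ cong (ℤ._+_ (F (n ℕ.+ 21 ℕ.* K)))
          (trans (ℤₚ.neg-involutive (F n)) (cong F (sym (ℕₚ.+-identityʳ n)))) ⟩
      G 21 ℤ.+ G 0 ≡⟨ cong₂ ℤ._+_ (pair-X^ 21 G) (pair-X^ 0 G) ⟨
      ⟨ X^ 21 ∣ G ⟩ ℤ.+ ⟨ X^ 0 ∣ G ⟩ ≡⟨ pair-+ (X^ 21) (X^ 0) G ⟨
      ⟨ X^ 21 +P X^ 0 ∣ G ⟩ ≡⟨ test (multiple≈0 (Φ₂₁ 1) (X^ 21 +P X^ 0) _) G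
          (recurrence-sample K (Φ₂₁ 1) {F} r n) ⟩
      + 0 ∎)
      where
      G : ℕ → ℤ
      G k = F (n ℕ.+ k ℕ.* K)

    private
      coset : ∀ p h .{{_ : NonZero h}} → expand h (replicate p (+ 1)) ≈ [] [mod Φ₂₁ 1 ] →
        ∀ n → ∑ (upTo p) (λ i → F (n ℕ.+ i ℕ.* (h ℕ.* K))) ≡ + 0
      coset p h e n = begin
        ∑ (upTo p) (λ i → F (n ℕ.+ i ℕ.* (h ℕ.* K))) ≡⟨ ∑-cong (upTo p)
            (λ i _ → cong (λ k → F (n ℕ.+ k)) (ℕₚ.*-assoc i h K)) ⟨
        ∑ (upTo p) (λ i → G (i ℕ.* h)) ≡⟨ pair-1s p (λ i → G (i ℕ.* h)) ⟨
        ⟨ replicate p (+ 1) ∣ (λ i → G (i ℕ.* h)) ⟩ ≡⟨ pair-expand h (replicate p (+ 1)) G ⟨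
        ⟨ expand h (replicate p (+ 1)) ∣ G ⟩ ≡⟨ test e G (recurrence-sample K (Φ₂₁ 1) {F} r n) ⟩
        + 0 ∎
        where
        G : ℕ → ℤ
        G k = F (n ℕ.+ k ℕ.* K)

    -- At a primitive 42nd root of unity, x¹⁴ is a primitive cube root, so 1 + x¹⁴ + x²⁸ is a
    -- multiple of Φ₄₂.
    coset-3 : ∀ n → ∑ (upTo 3) (λ i → F (n ℕ.+ i ℕ.* (14 ℕ.* K))) ≡ + 0
    coset-3 = coset 3 14 (multiple≈0 (Φ₂₁ 1) (expand 14 (replicate 3 (+ 1))) _)

    -- Likewise x⁶ is a primitive seventh root of unity.
    coset-7 : ∀ n → ∑ (upTo 7) (λ i → F (n ℕ.+ i ℕ.* (6 ℕ.* K))) ≡ + 0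
    coset-7 = coset 7 6 (multiple≈0 (Φ₂₁ 1) (expand 6 (replicate 7 (+ 1))) _)

  -- As N does not divide e, g = gcd(e, N) divides 7K or 3K. So the orbit sum has period 14K or 6K,
  -- and the sums of F over three, respectively seven, such steps vanish.
  recurrence-orthogonal : ∀ a b F → Recurrence (Ψ (1 , suc b , suc a)) F → let N = 3 ℕ.^ suc a ℕ.* 7 ℕ.^ suc b in
    Antiperiodic N F → ∀ e → ¬ N ∣ e → ∀ n → ∑ (upTo N) (λ j → F (n ℕ.+ j ℕ.* (2 ℕ.* e))) ≡ + 0
  recurrence-orthogonal a b F r anti e N∤e = split (properDivisor-split a b (gcd[m,n]∣n e N))
    where
    N = 3 ℕ.^ suc a ℕ.* 7 ℕ.^ suc b
    K = 3 ℕ.^ a ℕ.* 7 ℕ.^ b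
    instance
      K≢0 : NonZero K
      K≢0 = 3^*7^≢0 a b
    S : ℕ → ℤ
    S = orbitSum N e F (antiperiodic⇒invariant {F = F} anti)
    invariant-g : ∀ p → gcd e N ∣ p ℕ.* K → Invariant (2 ℕ.* p ℕ.* K) S
    invariant-g p g∣ = invariant-∣ {T = S} (subst (2 ℕ.* gcd e N ∣_) (sym (ℕₚ.*-assoc 2 p K))
        (∣.*-monoʳ-∣ 2 g∣)) (orbitSum-gcd N e F (antiperiodic⇒invariant {F = F} anti))
    split : gcd e N ≡ N ⊎ gcd e N ∣ 7 ℕ.* K ⊎ gcd e N ∣ 3 ℕ.* K → ∀ n → S n ≡ + 0
    split (inj₁ g≡N)        = ⊥-elim (N∤e (subst (_∣ e) g≡N (gcd[m,n]∣m e N)))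
    split (inj₂ (inj₁ g∣7K)) = orbitSum≡0 N e F (antiperiodic⇒invariant {F = F} anti) 3 (14 ℕ.* K)
        (invariant-g 7 g∣7K) (coset-3 K {F} r)
    split (inj₂ (inj₂ g∣3K)) = orbitSum≡0 N e F (antiperiodic⇒invariant {F = F} anti) 7 (6 ℕ.* K)
        (invariant-g 3 g∣3K) (coset-7 K {F} r)

  -- A product of sequences of periods 2, 3 and 7 whose sums over a period vanish.
  residueValue : ℕ → ℤ
  residueValue r = flip r (difference (r % 3) ℤ.* difference (r % 7))
    where
    difference : ℕ → ℤ
    difference 0 = + 1
    difference 1 = - + 1
    difference _ = + 0

  recurrence₄₂ : ℕ → ℤ
  recurrence₄₂ n = residueValue (n % 42)

  -- The sequence has period 42, which leaves 42 starting points to be checked by evaluation.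
  recurrence₄₂-correct : Recurrence (Φ₂₁ 1) recurrence₄₂
  recurrence₄₂-correct n = begin
    ⟨ Φ₂₁ 1 ∣ shift n recurrence₄₂ ⟩
      ≡⟨ pair-cong (Φ₂₁ 1) (λ j → trans (cong (λ n → recurrence₄₂ (n ℕ.+ j)) (m≡m%n+[m/n]*n n 42))
          (trans (cong recurrence₄₂ (swap (n % 42) (n / 42 ℕ.* 42) j)) (periodic (n / 42) (n % 42 ℕ.+ j)))) ⟩
    ⟨ Φ₂₁ 1 ∣ shift (n % 42) recurrence₄₂ ⟩ ≡⟨ All.lookup period (∈-upTo⁺ (m%n<n n 42)) ⟩
    + 0 ∎
    where
    swap : ∀ x y z → x ℕ.+ y ℕ.+ z ≡ x ℕ.+ z ℕ.+ y
    swap = ℕ-Solver.solve-∀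
    periodic : ∀ k m → recurrence₄₂ (m ℕ.+ k ℕ.* 42) ≡ recurrence₄₂ m
    periodic k m = cong residueValue ([m+kn]%n≡m%n m k 42)
    period : All (λ r → ⟨ Φ₂₁ 1 ∣ shift r recurrence₄₂ ⟩ ≡ + 0) (upTo 42)
    period = toWitness {a? = All.all? (λ r → ⟨ Φ₂₁ 1 ∣ shift r recurrence₄₂ ⟩ ℤₚ.≟ + 0) (upTo 42)} _

  module _ (K : ℕ) .{{_ : NonZero K}} where
    private
      [0] : ℕ → ℤ
      [0] zero    = + 1
      [0] (suc _) = + 0

    -- F placed on the multiples of K, with zeros elsewhere: a recurrence for p becomes one for
    -- p(x^K).
    spread : (ℕ → ℤ) → ℕ → ℤ
    spread F n = [0] (n % K) ℤ.* F (n / K)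

    spread-0 : ∀ F → spread F 0 ≡ F 0
    spread-0 F = trans (cong₂ (λ r d → [0] r ℤ.* F d) (m*n%n≡0 0 K) (m*n/n≡m 0 K)) (ℤₚ.*-identityˡ (F 0))

    spread-recurrence : ∀ p F → Recurrence p F → Recurrence (expand K p) (spread F)
    spread-recurrence p F r n = begin
      ⟨ expand K p ∣ shift n (spread F) ⟩ ≡⟨ pair-expand K p (shift n (spread F)) ⟩
      ⟨ p ∣ (λ j → spread F (n ℕ.+ j ℕ.* K)) ⟩ ≡⟨ pair-cong p
          (λ j → cong₂ (λ r d → [0] r ℤ.* F d) ([m+kn]%n≡m%n n j K)
          (trans (+-distrib-/-∣ʳ n (divides j refl)) (cong (n / K ℕ.+_) (m*n/n≡m j K)))) ⟩
      ⟨ p ∣ (λ j → [0] (n % K) ℤ.* F (n / K ℕ.+ j)) ⟩ ≡⟨ pair-*ᶠ p ([0] (n % K)) (shift (n / K) F) ⟩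
      [0] (n % K) ℤ.* ⟨ p ∣ shift (n / K) F ⟩ ≡⟨ cong ([0] (n % K) ℤ.*_) (r (n / K)) ⟩
      [0] (n % K) ℤ.* + 0 ≡⟨ ℤₚ.*-zeroʳ ([0] (n % K)) ⟩
      + 0 ∎

  -- If N were even, a power 2^(k+1) = 1 + Nt would be odd.
  odd-modulus : ∀ a b → Σ[ k ∈ ℕ ] 3 ℕ.^ suc a ℕ.* 7 ℕ.^ suc b ≡ 1 ℕ.+ 2 ℕ.* k
  odd-modulus a b with parity (3 ℕ.^ suc a ℕ.* 7 ℕ.^ suc b)
  ... | k , inj₂ e = k , e
  ... | s , inj₁ e with power≡1 a b
  ...   | k , t , e′ = ⊥-elim (even≢odd (2 ℕ.^ k) (s ℕ.* t)
      (trans e′ (cong suc (trans (cong (ℕ._* t) e) (ℕₚ.*-assoc 2 s t)))))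

theorem5 : (a b : ℕ) → 1 ≤ a → 1 ≤ b →
    ¬ (Σ[ f ∈ (Fin (2 * (3 ^ a * 7 ^ b)) → Fin (2 * (3 ^ a * 7 ^ b))) ]
    IsGBent1 (2 * (3 ^ a * 7 ^ b)) f)
theorem5 (suc a) (suc b) _ _ (f , bent) = not-bent-mod N (proj₁ odd) (proj₂ odd) f anti
  (reduced-mod-2 anti (proj₁ power) (proj₁ (proj₂ power)) (proj₂ (proj₂ power)))
  -- `recurrence₄₂ 0` evaluates to 1, so this functional takes the value 1 at 1.
  F F-recurrence (spread-0 K recurrence₄₂)
  (recurrence-orthogonal a b F F-recurrence (anti F F-recurrence))
  (λ l → vanishes⇒≈0 1 (suc b) (suc a) ℕₚ.≤-refl _ (bent l))
  where
  N = 3 ℕ.^ suc a ℕ.* 7 ℕ.^ suc b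
  K = 3 ℕ.^ a ℕ.* 7 ℕ.^ b
  instance
    K≢0 : NonZero K
    K≢0 = 3^*7^≢0 a b
  odd = odd-modulus a b
  power = power≡1-odd a b
  21K≡N : ∀ x y → 21 ℕ.* (x ℕ.* y) ≡ 3 ℕ.* x ℕ.* (7 ℕ.* y)
  21K≡N = ℕ-Solver.solve-∀
  anti : ∀ F → Recurrence (Ψ (1 , suc b , suc a)) F → Antiperiodic N F
  anti F r = subst (λ n → Antiperiodic n F) (21K≡N (3 ℕ.^ a) (7 ℕ.^ b)) (recurrence-antiperiodic K {F} r)
  F : ℕ → ℤ
  F = spread K recurrence₄₂
  F-recurrence : Recurrence (Ψ (1 , suc b , suc a)) F
  F-recurrence = spread-recurrence K (Φ₂₁ 1) recurrence₄₂ recurrence₄₂-correct
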